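{- Let $\mathscr{A}=(G,\partial)$ be a unicyclization of a connected graph $G$, let $\beta$ be a basis of $Z_1(G)=\ker\partial_1$, and let $\sigma$ be an edge of $G$. With $\lambda_\sigma(\mathscr{A})$, $\lambda_{ -\sigma}(\mathscr{A})$, $\mathscr{A}_c,\beta_c$, $\mathscr{A}_d,\beta_d$ and $n_\sigma$ as in the context: 1. If $\sigma$ is a loop, then $\lambda_\sigma(\mathscr{A})=a\cdot[\sigma]\in\mathbb{Z}^{E(G)}$ for some $a\in\mathbb{Z}$. 2. If $\sigma$ is not a loop, then $[\lambda_\sigma(\mathscr{A})]_\beta=[\lambda(\mathscr{A}_c)]_{\beta_c}$. 3. If $\partial|_\sigma=\vec 0$, then $\lambda_{ -\sigma}(\mathscr{A})=0$. 4. If $\partial|_\sigma\neq\vec 0$, then $[\lambda_{ -\sigma}(\mathscr{A})]_\beta=n_\sigma\cdot[\lambda(\mathscr{A}_d)]_{\beta_d}$.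
   Context: Graphs are finite; loops and multiple edges are allowed. Fix an orientation of each edge; $[e]$ denotes the generator of $\mathbb{Z}^{E(G)}$ for the edge $e$. $\partial_1:\mathbb{Z}^{E(G)}\to\mathbb{Z}^{V(G)}$ is the (oriented) incidence matrix (a loop gives a zero column). $Z_1(G)=\ker\partial_1$ is, for $G$ connected, a free abelian group of rank $m=|E(G)|-|V(G)|+1$; bases are ordered $\mathbb{Z}$-bases. A unicyclizer of a connected graph $G$ is an integer matrix $\partial$ (rows indexed by $E(G)$) with (1) $\ker\partial=0$, (2) $\partial_1\partial=0$, (3) $\operatorname{rk}(\ker\partial_1/\operatorname{im}\partial)=1$. The pair $\mathscr{A}=(G,\partial)$ is a unicyclization of $G$. For a basis $\beta$ of $Z_1(G)$, $[\cdot]_\beta$ denotes coordinates with respect to $\beta$ (applied columnwise to $\partial$), and the winding number map of $\mathscr{A}$ relative to $\beta$ is $w_{\mathscr{A}}(z)=\det([z]_\beta,[\partial]_\beta)$. A cycletree of $G$ is a connected spanning subgraph $Y$ of $G$ containing exactly one cycle $C_Y$ (a loop, or a pair of parallel edges, may be that cycle). $\mathcal{U}(G)$ is the set of cycletrees. $z_Y\in Z_1(G)$ is the $\{0,\pm1\}$-vector of $C_Y$ with either orientation (irrelevant below). Put $\lambda(\mathscr{A})=\sum_{Y\in\mathcal{U}(G)}w_{\mathscr{A}}(z_Y)z_Y$, $\lambda_\sigma(\mathscr{A})=\sum_{Y\in\mathcal{U}(G),\,\sigma\in Y}w_{\mathscr{A}}(z_Y)z_Y$, $\lambda_{ -\sigma}(\mathscr{A})=\sum_{Y\in\mathcal{U}(G),\,\sigma\notin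 Y}w_{\mathscr{A}}(z_Y)z_Y$. $\partial|_\sigma$ is the row of $\partial$ indexed by $\sigma$, and $n_\sigma$ (the winding difference) is the gcd of its entries. Contraction ($\sigma$ not a loop): $G_c=G/\sigma$ (remove $\sigma$, identify its ends). Deleting the $\sigma$-entry gives an isomorphism $Z_1(G)\to Z_1(G_c)$; $\beta_c$ is the image of $\beta$, and $\partial_c$ is defined by $[\partial_c]_{\beta_c}=[\partial]_\beta$. Then $\mathscr{A}_c=(G_c,\partial_c)$ is a unicyclization, with winding number map and $\lambda(\mathscr{A}_c)$ taken relative to $\beta_c$. Deletion ($\partial|_\sigma\neq\vec0$): $G_d=G-\sigma$ (delete $\sigma$; in this case $\sigma$ is not a bridge). $\mathscr{A}_d=(G_d,\partial_d)$ is a unicyclization with a basis $\beta_d$ of $Z_1(G_d)$ such that $[C]_\beta=[C_d]_{\beta_d}$ and $w_{\mathscr{A}}(C)=n_\sigma\cdot w_{\mathscr{A}_d}(C_d)$ for $C\in Z_1(G)$ with zero coefficient at $\sigma$, where $C_d$ is $C$ with the $\sigma$-entry deleted and $w_{\mathscr{A}_d}$ is relative to $\beta_d$. It is constructed by taking, without loss of generality (changing the basis changes winding numbers at most by a global sign), $\beta$ to be the fundamental cycles of a spanning tree $T$ not containing $\sigma$ (for each edge $e\notin T$, the unique cycle of $T\cup e$, with coefficient $1$ at $e$), with the cycle of $\sigma$ last; $\beta_d$ is obtained from $\beta$ by dropping the cycle of $\sigma$, and $\partial_d$ is defined by the matrix $\begin{pmatrix}[\partial_d]_{\beta_d}&*\\0\cdots0&n_\sigma\end{pmatrix}$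 obtained from $[\partial]_\beta$ by elementary integral column operations not changing the sign of the determinant. $\lambda(\mathscr{A}_d)$ is taken relative to $\beta_d$.
   Formalization: In item 4, 𝒜_d is any outcome of the described construction; none exists if Z₁(G) has rank 2 and the σ-entry of ∂ is negative (the identity then fails by a sign). For a general basis β the identity is stated in the fundamental basis with the explicit global sign relating the winding numbers. -}

module Defs where

open import Data.Bool.Base using (if_then_else_)
open import Data.Fin.Base using (Fin; zero; suc; toℕ; fromℕ; inject₁; punchIn; punchOut)
open import Data.Fin.Permutation.Components using (transpose)
open import Data.Fin.Properties using (_≟_; any?; all?; injective⇒≤; punchInᵢ≢i; punchIn-punchOut; punchIn-injective; fromℕ≢inject₁)
open import Data.Fin.Subset using (Subset; _∈_; _∉_; _∪_; ⁅_⁆; ⊤; inside; outside)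
open import Data.Fin.Subset.Properties using (_∈?_; x∈p∪q⁻; x∈⁅y⁆⇒x≡y)
open import Data.Integer.Base using (ℤ; 0ℤ; 1ℤ; -1ℤ; _+_; _-_; _*_; -_; _^_; _◃_)
open import Data.Integer.GCD using (gcd)
import Data.Integer.Properties as ℤ
open import Data.List.Base as List using (List; []; _∷_; length; lookup; allFin)
import Data.List.Membership.Propositional as List∈
open import Data.List.Membership.Propositional.Properties using (∈-filter⁺; ∈-filter⁻; ∈-allFin)
import Data.List.Membership.DecPropositional as DecMembership
import Data.List.Relation.Unary.All as All
open import Data.List.Relation.Unary.AllPairs using (_∷_)
open import Data.List.Relation.Unary.Any using (here; there)
open import Data.List.Relation.Unary.Unique.Propositional using (Unique)
import Data.List.Relation.Unary.Unique.DecPropositional as DecUnique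
open import Data.List.Properties using (length-map)
open import Data.Nat.Base as ℕ using (ℕ; zero; suc; z≤n; s≤s)
open import Data.Product.Base using (∃; ∃-syntax; _×_; _,_; proj₁; proj₂)
open import Data.Sign.Base using (Sign; opposite)
open import Data.Sum.Base using (_⊎_; inj₁; inj₂)
open import Data.Vec.Base using (_∷_; [])
open import Data.Vec.Functional as Vector using (Vector; removeAt; insertAt; updateAt; init)
open import Data.Vec.Functional.Properties using (insertAt-lookup; insertAt-punchIn)
open import Function.Base using (_∘_)
open import Function.Definitions using (Injective)
open import Relation.Binary.Construct.Closure.Equivalence using (EqClosure)
open import Relation.Binary.Construct.Closure.ReflexiveTransitive using (ε; _◅_; _◅◅_)
open import Relation.Binary.Construct.Closure.Symmetric using (fwd; bwd)
open import Relation.Binary.PropositionalEquality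
open import Relation.Nullary using (¬_; Dec; yes; no; does; contradiction)
open import Relation.Nullary.Decidable using (map′; _×-dec_; _⊎-dec_; _→-dec_; ¬?; dec-true; dec-false; decidable-stable)
open import Relation.Unary using (Pred; Decidable)
open import Level using (0ℓ)

open import Algebra.Properties.Semiring.Sum ℤ.+-*-semiring public
  using (sum; sum-syntax)
open import Algebra.Properties.Semiring.Sum ℤ.+-*-semiring
  using (sum-cong-≗; sum-remove; sum-init-last; ∑-distrib-+; *-distribˡ-sum; sum-replicate-zero)

private
  variable
    m n k v e : ℕ

Matrix : ℕ → ℕ → Set
Matrix m n = Vector (Vector ℤ n) m

δ : Fin n → Fin n → ℤ
δ i j = if does (i ≟ j) then 1ℤ else 0ℤ

-- Laplace expansion along the first column.
det : Matrix n n → ℤ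
det {zero}  M = 1ℤ
det {suc n} M =
  ∑[ i < suc n ] (-1ℤ ^ toℕ i * M i zero * det (λ r c → M (punchIn i r) (suc c)))

linComb : Vector ℤ n → Vector (Vector ℤ m) n → Vector ℤ m
linComb {n} c a i = ∑[ j < n ] (c j * a j i)

-- Elementary integral column operations; the sign records the effect of the
-- whole sequence on a determinant having the matrix as a block of columns.

addColumn : Fin n → Fin n → ℤ → Matrix m n → Matrix m n
addColumn p q c M i = updateAt (M i) q (_+ c * M i p)

swapColumns : Fin n → Fin n → Matrix m n → Matrix m n
swapColumns p q M i = M i ∘ transpose p q

negateColumn : Fin n → Matrix m n → Matrix m n
negateColumn p M i = updateAt (M i) p (λ x → - x)

data ColumnOps {m n} : Sign → Matrix m n → Matrix m n → Set where
  done   : ∀ {M N} → (∀ i j → M i j ≡ N i j) → ColumnOps Sign.+ M N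
  add    : ∀ {s M N} p q c → p ≢ q →
           ColumnOps s (addColumn p q c M) N → ColumnOps s M N
  swap   : ∀ {s M N} p q → p ≢ q →
           ColumnOps s (swapColumns p q M) N → ColumnOps (opposite s) M N
  negate : ∀ {s M N} p →
           ColumnOps s (negateColumn p M) N → ColumnOps (opposite s) M N

-- v vertices and e edges; edge i is oriented from src i to tgt i.
record Graph (v e : ℕ) : Set where
  field
    src tgt : Fin e → Fin v

open Graph public

IsLoop : Graph v e → Fin e → Set
IsLoop G i = src G i ≡ tgt G i

∂₁ : Graph v e → Matrix v e
∂₁ G x i = δ x (tgt G i) - δ x (src G i)

-- A spanning subgraph is given by its set of edges.

Joins : Graph v e → Subset e → Fin v → Fin v → Set
Joins G Y x y = ∃[ i ] i ∈ Y × src G i ≡ x × tgt G i ≡ y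

ConnectedBy : Graph v e → Subset e → Set
ConnectedBy G Y = ∀ x y → EqClosure (Joins G Y) x y

Connected : Graph v e → Set
Connected G = ConnectedBy G ⊤

-- An arc is an edge with a direction of traversal.

Arc : ℕ → Set
Arc e = Fin e × Sign

edge : Arc e → Fin e
edge = proj₁

start end : Graph v e → Arc e → Fin v
start G (i , Sign.+) = src G i
start G (i , Sign.-) = tgt G i
end   G (i , s)      = start G (i , opposite s)

IsWalk : Graph v e → Fin v → List (Arc e) → Fin v → Set
IsWalk G x []       y = x ≡ y
IsWalk G x (a ∷ as) y = x ≡ start G a × IsWalk G (end G a) as y

IsCycle : Graph v e → List (Arc e) → Set
IsCycle G as = as ≢ []
             × (∃[ x ] IsWalk G x as x)
             × Unique (List.map (start G) as)
             × Unique (List.map edge as)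

edges : List (Arc e) → List (Fin e)
edges = List.map edge

_∈ᴱ_ : Fin e → List (Arc e) → Set
i ∈ᴱ as = i List∈.∈ edges as

Within : Subset e → List (Arc e) → Set
Within Y as = ∀ i → i ∈ᴱ as → i ∈ Y

-- Cycles are compared as subgraphs: base point and direction do not matter.
SameEdges : List (Arc e) → List (Arc e) → Set
SameEdges as bs = ∀ i → (i ∈ᴱ as → i ∈ᴱ bs) × (i ∈ᴱ bs → i ∈ᴱ as)

IsCycletree : Graph v e → Subset e → Set
IsCycletree G Y =
  ConnectedBy G Y ×
  (∃[ as ] (IsCycle G as × Within Y as)
         × (∀ bs → IsCycle G bs × Within Y bs → SameEdges as bs))

IsSpanningTree : Graph v e → Subset e → Set
IsSpanningTree G T = ConnectedBy G T × ¬ (∃[ as ] IsCycle G as × Within T as)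

cycleVec : List (Arc e) → Vector ℤ e
cycleVec []             i = 0ℤ
cycleVec ((j , s) ∷ as) i = (s ◃ 1) * δ j i + cycleVec as i

private
  Linked : Graph v e → List (Fin e) → Fin v → Fin v → Set
  Linked G []       x y = x ≡ y
  Linked G (i ∷ is) x y =
    Linked G is x y ⊎
    ((Linked G is x (src G i) × Linked G is (tgt G i) y) ⊎
     (Linked G is x (tgt G i) × Linked G is (src G i) y))

  linked? : (G : Graph v e) → ∀ is x y → Dec (Linked G is x y)
  linked? G []       x y = x ≟ y
  linked? G (i ∷ is) x y = linked? G is x y ⊎-dec
    ((linked? G is x (src G i) ×-dec linked? G is (tgt G i) y) ⊎-dec
     (linked? G is x (tgt G i) ×-dec linked? G is (src G i) y))

  linked-refl : (G : Graph v e) → ∀ is {x} → Linked G is x x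
  linked-refl G []       = refl
  linked-refl G (i ∷ is) = inj₁ (linked-refl G is)

  linked-trans : (G : Graph v e) → ∀ is {x y z} →
                 Linked G is x y → Linked G is y z → Linked G is x z
  linked-trans G [] p q = trans p q
  linked-trans G (i ∷ is) = go
    where
    _∙_ : ∀ {x y z} → Linked G is x y → Linked G is y z → Linked G is x z
    _∙_ = linked-trans G is
    go : ∀ {x y z} → Linked G (i ∷ is) x y → Linked G (i ∷ is) y z → Linked G (i ∷ is) x z
    go (inj₁ p)              (inj₁ q)              = inj₁ (p ∙ q)
    go (inj₁ p)              (inj₂ (inj₁ (q , r))) = inj₂ (inj₁ (p ∙ q , r))
    go (inj₁ p)              (inj₂ (inj₂ (q , r))) = inj₂ (inj₂ (p ∙ q , r))
    go (inj₂ (inj₁ (p , o))) (inj₁ q)              = inj₂ (inj₁ (p , o ∙ q))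
    go (inj₂ (inj₁ (p , o))) (inj₂ (inj₁ (q , r))) = inj₂ (inj₁ (p , r))
    go (inj₂ (inj₁ (p , o))) (inj₂ (inj₂ (q , r))) = inj₁ (p ∙ r)
    go (inj₂ (inj₂ (p , o))) (inj₁ q)              = inj₂ (inj₂ (p , o ∙ q))
    go (inj₂ (inj₂ (p , o))) (inj₂ (inj₁ (q , r))) = inj₁ (p ∙ r)
    go (inj₂ (inj₂ (p , o))) (inj₂ (inj₂ (q , r))) = inj₂ (inj₂ (p , r))

  linked-edge : (G : Graph v e) → ∀ is {i} → i List∈.∈ is →
                Linked G is (src G i) (tgt G i) × Linked G is (tgt G i) (src G i)
  linked-edge G (i ∷ is) (here refl) =
    inj₂ (inj₁ (linked-refl G is , linked-refl G is)) ,
    inj₂ (inj₂ (linked-refl G is , linked-refl G is))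
  linked-edge G (_ ∷ is) (there p) =
    inj₁ (proj₁ (linked-edge G is p)) , inj₁ (proj₂ (linked-edge G is p))

  module _ (G : Graph v e) (Y : Subset e) where

    linked-sound : ∀ is → (∀ {i} → i List∈.∈ is → i ∈ Y) →
                   ∀ {x y} → Linked G is x y → EqClosure (Joins G Y) x y
    linked-sound []       h refl = ε
    linked-sound (i ∷ is) h (inj₁ p) = linked-sound is (h ∘ there) p
    linked-sound (i ∷ is) h (inj₂ (inj₁ (p , q))) =
      linked-sound is (h ∘ there) p ◅◅
      (fwd (i , h (here refl) , refl , refl) ◅ linked-sound is (h ∘ there) q)
    linked-sound (i ∷ is) h (inj₂ (inj₂ (p , q))) =
      linked-sound is (h ∘ there) p ◅◅
      (bwd (i , h (here refl) , refl , refl) ◅ linked-sound is (h ∘ there) q)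

    linked-complete : ∀ is → (∀ {i} → i ∈ Y → i List∈.∈ is) →
                      ∀ {x y} → EqClosure (Joins G Y) x y → Linked G is x y
    linked-complete is h ε = linked-refl G is
    linked-complete is h (fwd (i , i∈Y , refl , refl) ◅ p) =
      linked-trans G is (proj₁ (linked-edge G is (h i∈Y))) (linked-complete is h p)
    linked-complete is h (bwd (i , i∈Y , refl , refl) ◅ p) =
      linked-trans G is (proj₂ (linked-edge G is (h i∈Y))) (linked-complete is h p)

    connectedBy? : Dec (ConnectedBy G Y)
    connectedBy? = map′
      (λ l x y → linked-sound es (λ i∈ → proj₂ (∈-filter⁻ (_∈? Y) {xs = allFin e} i∈)) (l x y))
      (λ c x y → linked-complete es (λ i∈ → ∈-filter⁺ (_∈? Y) (∈-allFin _) i∈) (c x y))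
      (all? λ x → all? λ y → linked? G es x y)
      where es = List.filter (_∈? Y) (allFin e)

  anyArc? : ∀ {P : Pred (Arc e) 0ℓ} → Decidable P → Dec (∃ P)
  anyArc? P? = map′
    (λ { (i , inj₁ p) → (i , Sign.+) , p ; (i , inj₂ p) → (i , Sign.-) , p })
    (λ { ((i , Sign.+) , p) → i , inj₁ p ; ((i , Sign.-) , p) → i , inj₂ p })
    (any? λ i → P? (i , Sign.+) ⊎-dec P? (i , Sign.-))

  anyList≤? : ∀ n {P : Pred (List (Arc e)) 0ℓ} → Decidable P →
              Dec (∃[ as ] length as ℕ.≤ n × P as)
  anyList≤? zero P? = map′ (λ p → [] , z≤n , p) (λ { ([] , _ , p) → p }) (P? [])
  anyList≤? (suc n) P? = map′
    (λ { (inj₁ p) → [] , z≤n , p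
       ; (inj₂ (a , as , l , p)) → a ∷ as , s≤s l , p })
    (λ { ([] , _ , p) → inj₁ p
       ; (a ∷ as , s≤s l , p) → inj₂ (a , as , l , p) })
    (P? [] ⊎-dec anyArc? λ a → anyList≤? n (λ as → P? (a ∷ as)))

  lookup-injective : ∀ {A : Set} {xs : List A} → Unique xs → Injective _≡_ _≡_ (lookup xs)
  lookup-injective {xs = x ∷ xs} (p ∷ u) {zero}  {zero}  eq = refl
  lookup-injective {xs = x ∷ xs} (p ∷ u) {zero}  {suc j} eq =
    contradiction eq (All.lookup p (List∈-lookup xs j))
    where
    List∈-lookup : ∀ {A : Set} (xs : List A) j → lookup xs j List∈.∈ xs
    List∈-lookup (x ∷ xs) zero    = here refl
    List∈-lookup (x ∷ xs) (suc j) = there (List∈-lookup xs j)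
  lookup-injective {xs = x ∷ xs} (p ∷ u) {suc i} {zero}  eq =
    sym (lookup-injective {xs = x ∷ xs} (p ∷ u) {zero} {suc i} (sym eq))
  lookup-injective {xs = x ∷ xs} (p ∷ u) {suc i} {suc j} eq =
    cong suc (lookup-injective u eq)

  cycle-length : (G : Graph v e) → ∀ as → IsCycle G as → length as ℕ.≤ e
  cycle-length G as (_ , _ , _ , u) =
    subst (ℕ._≤ _) (length-map edge as) (injective⇒≤ (lookup-injective u))

  walk? : (G : Graph v e) → ∀ x as y → Dec (IsWalk G x as y)
  walk? G x []       y = x ≟ y
  walk? G x (a ∷ as) y = (x ≟ start G a) ×-dec walk? G (end G a) as y

  cycle? : (G : Graph v e) → Decidable (IsCycle G)
  cycle? G as =
    nonempty? as ×-dec any? (λ x → walk? G x as x) ×-dec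
    DecUnique.unique? _≟_ (List.map (start G) as) ×-dec
    DecUnique.unique? _≟_ (List.map edge as)
    where
    nonempty? : Decidable {A = List (Arc _)} (_≢ [])
    nonempty? []      = no λ ne → ne refl
    nonempty? (_ ∷ _) = yes λ ()

  anyCycle? : (G : Graph v e) {P : Pred (List (Arc e)) 0ℓ} → Decidable P →
              Dec (∃[ as ] IsCycle G as × P as)
  anyCycle? G P? = map′
    (λ { (as , _ , c , p) → as , c , p })
    (λ { (as , c , p) → as , cycle-length G as c , c , p })
    (anyList≤? _ λ as → cycle? G as ×-dec P? as)

  _∈ᴱ?_ : ∀ (i : Fin e) as → Dec (i ∈ᴱ as)
  i ∈ᴱ? as = DecMembership._∈?_ _≟_ i (edges as)

  within? : (Y : Subset e) → Decidable (Within Y)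
  within? Y as = all? λ i → (i ∈ᴱ? as) →-dec (i ∈? Y)

  sameEdges? : (as bs : List (Arc e)) → Dec (SameEdges as bs)
  sameEdges? as bs = all? λ i →
    ((i ∈ᴱ? as) →-dec (i ∈ᴱ? bs)) ×-dec ((i ∈ᴱ? bs) →-dec (i ∈ᴱ? as))

isCycletree? : (G : Graph v e) → Decidable (IsCycletree G)
isCycletree? G Y = connectedBy? G Y ×-dec map′
  (λ { (as , c , w , u) → as , (c , w) , u })
  (λ { (as , (c , w) , u) → as , c , w , u })
  (anyCycle? G λ as → within? Y as ×-dec unique? as)
  where
  unique? : Decidable λ as → ∀ bs → IsCycle G bs × Within Y bs → SameEdges as bs
  unique? as = map′
    (λ none bs cw → decidable-stable (sameEdges? as bs)
      (λ ¬same → none (bs , proj₁ cw , proj₂ cw , ¬same)))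
    (λ all → λ { (bs , c , w , ¬same) → ¬same (all bs (c , w)) })
    (¬? (anyCycle? G λ bs → within? Y bs ×-dec ¬? (sameEdges? as bs)))

allSubsets : ∀ n → List (Subset n)
allSubsets zero    = [] ∷ []
allSubsets (suc n) =
  List.map (inside ∷_) (allSubsets n) List.++ List.map (outside ∷_) (allSubsets n)

cycletrees : Graph v e → List (Subset e)
cycletrees G = List.filter (isCycletree? G) (allSubsets _)

boundary : Graph v e → Vector ℤ e → Vector ℤ v
boundary {e = e} G z x = ∑[ i < e ] (∂₁ G x i * z i)

InKernel : Graph v e → Vector ℤ e → Set
InKernel G z = ∀ x → boundary G z x ≡ 0ℤ

record Z₁ (G : Graph v e) : Set where
  constructor _,_
  field
    vec    : Vector ℤ e
    closed : InKernel G vec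

open Z₁ public

private
  sum-zero : (f : Vector ℤ n) → (∀ i → f i ≡ 0ℤ) → sum f ≡ 0ℤ
  sum-zero {n} f h = trans (sum-cong-≗ h) (sum-replicate-zero n)

module _ {G : Graph v e} where

  0ᶻ : Z₁ G
  0ᶻ = (λ _ → 0ℤ) , λ x → sum-zero _ λ i → ℤ.*-zeroʳ (∂₁ G x i)

  infixl 6 _⊕_
  infixr 7 _·_

  _⊕_ : Z₁ G → Z₁ G → Z₁ G
  vec    (y ⊕ z) i = vec y i + vec z i
  closed (y ⊕ z) x = begin
    boundary G (vec (y ⊕ z)) x
      ≡⟨ sum-cong-≗ (λ i → ℤ.*-distribˡ-+ (∂₁ G x i) (vec y i) (vec z i)) ⟩
    ∑[ i < e ] (∂₁ G x i * vec y i + ∂₁ G x i * vec z i)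
      ≡⟨ ∑-distrib-+ (λ i → ∂₁ G x i * vec y i) (λ i → ∂₁ G x i * vec z i) ⟩
    boundary G (vec y) x + boundary G (vec z) x
      ≡⟨ cong₂ _+_ (closed y x) (closed z x) ⟩
    0ℤ ∎
    where open ≡-Reasoning

  _·_ : ℤ → Z₁ G → Z₁ G
  vec    (c · z) i = c * vec z i
  closed (c · z) x = begin
    boundary G (vec (c · z)) x
      ≡⟨ sum-cong-≗ (λ i → trans (sym (ℤ.*-assoc (∂₁ G x i) c (vec z i)))
           (trans (cong (_* vec z i) (ℤ.*-comm (∂₁ G x i) c)) (ℤ.*-assoc c _ _))) ⟩
    ∑[ i < e ] (c * (∂₁ G x i * vec z i))
      ≡⟨ *-distribˡ-sum c (λ i → ∂₁ G x i * vec z i) ⟨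
    c * boundary G (vec z) x
      ≡⟨ cong (c *_) (closed z x) ⟩
    c * 0ℤ
      ≡⟨ ℤ.*-zeroʳ c ⟩
    0ℤ ∎
    where open ≡-Reasoning

  combine : Vector ℤ n → Vector (Z₁ G) n → Z₁ G
  combine {zero}  c a = 0ᶻ
  combine {suc n} c a = c zero · a zero ⊕ combine (c ∘ suc) (a ∘ suc)

  vec-combine : (c : Vector ℤ n) (a : Vector (Z₁ G) n) →
                ∀ i → vec (combine c a) i ≡ linComb c (vec ∘ a) i
  vec-combine {zero}  c a i = refl
  vec-combine {suc n} c a i =
    cong (λ t → c zero * vec (a zero) i + t) (vec-combine (c ∘ suc) (a ∘ suc) i)

record Basis (G : Graph v e) (m : ℕ) : Set where
  field
    elt         : Vector (Z₁ G) m
    spanning    : ∀ z → ∃[ c ] (∀ i → vec z i ≡ linComb c (vec ∘ elt) i)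
    independent : ∀ c → (∀ i → linComb c (vec ∘ elt) i ≡ 0ℤ) → ∀ j → c j ≡ 0ℤ

  coords : Z₁ G → Vector ℤ m
  coords z = proj₁ (spanning z)

open Basis public

-- Rank of P/Q, for subgroups Q ⊆ P of ℤⁿ: the largest size of a family in P
-- that is ℤ-linearly independent modulo Q.

IndependentMod : (Q : Vector ℤ n → Set) → Vector (Vector ℤ n) m → Set
IndependentMod Q a = ∀ c → Q (linComb c a) → ∀ j → c j ≡ 0ℤ

QuotientRank : (P Q : Vector ℤ n → Set) → ℕ → Set
QuotientRank {n} P Q r =
  (∃[ a ] (∀ j → P (a j)) × IndependentMod {m = r} Q a) ×
  (∀ {s} (a : Vector (Vector ℤ n) s) → (∀ j → P (a j)) → IndependentMod Q a → s ℕ.≤ r)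

column : Matrix m n → Fin n → Vector ℤ m
column M j i = M i j

InImage : Matrix m n → Vector ℤ m → Set
InImage M z = ∃[ c ] (∀ i → z i ≡ linComb c (column M) i)

record IsUnicyclizer (G : Graph v e) (∂ : Matrix e k) : Set where
  field
    kernel-zero : ∀ c → (∀ i → linComb c (column ∂) i ≡ 0ℤ) → ∀ j → c j ≡ 0ℤ
    ∂₁∂-zero    : ∀ j → InKernel G (column ∂ j)
    rank-one    : QuotientRank (InKernel G) (InImage ∂) 1

  columns : Vector (Z₁ G) k
  columns j = column ∂ j , ∂₁∂-zero j

open IsUnicyclizer public

-- Entries are nonnegative gcds; the gcd of no entries is 0.
windingDifference : Matrix e k → Fin e → ℤ
windingDifference ∂ σ = Vector.foldr gcd 0ℤ (∂ σ)

-- The map w, for the matrix with columns ∂.  Since ker ∂ = 0 and the cokernel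
-- has rank one, Z₁ has rank suc k when ∂ has k columns.
winding : {G : Graph v e} → Basis G (suc k) → Vector (Z₁ G) k → Z₁ G → ℤ
winding β ∂ z = det λ i → coords β z i Vector.∷ λ j → coords β (∂ j) i

-- A choice, for every cycletree Y, of the vector of its cycle in one of the
-- two orientations.  Values at other edge sets are never used.
record CycleVectors (G : Graph v e) : Set where
  field
    cycleOf : Subset e → Z₁ G
    isCycle : ∀ {Y} → IsCycletree G Y →
              ∃[ as ] IsCycle G as × Within Y as × (∀ i → vec (cycleOf Y) i ≡ cycleVec as i)

open CycleVectors public

module _ {G : Graph v e} (z : CycleVectors G) (β : Basis G (suc k)) (∂ : Vector (Z₁ G) k) where

  sumOver : List (Subset e) → Z₁ G
  sumOver = List.foldr (λ Y acc → winding β ∂ (cycleOf z Y) · cycleOf z Y ⊕ acc) 0ᶻ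

  lam : Z₁ G
  lam = sumOver (cycletrees G)

  lamWith : Fin e → Z₁ G
  lamWith σ = sumOver (List.filter (σ ∈?_) (cycletrees G))

  lamWithout : Fin e → Z₁ G
  lamWithout σ = sumOver (List.filter (λ Y → ¬? (σ ∈? Y)) (cycletrees G))

merge : {s t : Fin (suc v)} → t ≢ s → Fin (suc v) → Fin v
merge {t = t} t≢s x with t ≟ x
... | yes _  = punchOut t≢s
... | no t≢x = punchOut t≢x

-- The target of σ is removed from the vertex set and sent to the source of σ.
contract : (G : Graph (suc v) (suc e)) (σ : Fin (suc e)) → ¬ IsLoop G σ → Graph v e
src (contract G σ ¬loop) = merge (¬loop ∘ sym) ∘ src G ∘ punchIn σ
tgt (contract G σ ¬loop) = merge (¬loop ∘ sym) ∘ tgt G ∘ punchIn σ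

private
  δ-refl : (i : Fin n) → δ i i ≡ 1ℤ
  δ-refl i = cong (if_then 1ℤ else 0ℤ) (dec-true (i ≟ i) refl)

  δ-≢ : {i j : Fin n} → i ≢ j → δ i j ≡ 0ℤ
  δ-≢ {i = i} {j} i≢j = cong (if_then 1ℤ else 0ℤ) (dec-false (i ≟ j) i≢j)

module _ (G : Graph (suc v) (suc e)) (σ : Fin (suc e)) (¬loop : ¬ IsLoop G σ) where
  private
    s t : Fin (suc v)
    s = src G σ
    t = tgt G σ

    t≢s : t ≢ s
    t≢s = ¬loop ∘ sym

    pre : Fin v → Fin (suc v)
    pre = punchIn t

    δ-pre : ∀ y {x} (t≢x : t ≢ x) → δ y (punchOut t≢x) ≡ δ (pre y) x
    δ-pre y {x} t≢x with y ≟ punchOut t≢x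
    ... | yes refl = sym (trans (cong (λ u → δ u x) (punchIn-punchOut t≢x)) (δ-refl x))
    ... | no  y≢   = sym (δ-≢ λ eq → y≢
          (punchIn-injective t _ _ (trans eq (sym (punchIn-punchOut t≢x)))))

    δ-merge : ∀ y x → δ y (merge t≢s x) ≡ δ (pre y) x + δ (pre y) s * δ t x
    δ-merge y x with t ≟ x
    ... | yes refl = begin
      δ y (punchOut t≢s)         ≡⟨ δ-pre y t≢s ⟩
      δ (pre y) s                ≡⟨ ℤ.*-identityʳ _ ⟨
      δ (pre y) s * 1ℤ           ≡⟨ ℤ.+-identityˡ _ ⟨
      0ℤ + δ (pre y) s * 1ℤ      ≡⟨ cong (_+ δ (pre y) s * 1ℤ) (δ-≢ (punchInᵢ≢i t y)) ⟨
      δ (pre y) t + δ (pre y) s * 1ℤ ∎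
      where open ≡-Reasoning
    ... | no t≢x = begin
      δ y (punchOut t≢x)         ≡⟨ δ-pre y t≢x ⟩
      δ (pre y) x                ≡⟨ ℤ.+-identityʳ _ ⟨
      δ (pre y) x + 0ℤ           ≡⟨ cong (δ (pre y) x +_) (ℤ.*-zeroʳ (δ (pre y) s)) ⟨
      δ (pre y) x + δ (pre y) s * 0ℤ ∎
      where open ≡-Reasoning

    Gc : Graph v e
    Gc = contract G σ ¬loop

    regroup : ∀ a b c d f → (a + f * b) - (c + f * d) ≡ (a - c) + f * (b - d)
    regroup = solve-∀
      where open import Data.Integer.Tactic.RingSolver using (solve-∀)

    ∂₁-row : Fin v → Fin (suc e) → ℤ
    ∂₁-row y i = ∂₁ G (pre y) i + δ (pre y) s * ∂₁ G t i

    ∂₁-contract : ∀ y j → ∂₁ Gc y j ≡ ∂₁-row y (punchIn σ j)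
    ∂₁-contract y j = trans
      (cong₂ _-_ (δ-merge y (tgt G i)) (δ-merge y (src G i)))
      (regroup (δ (pre y) (tgt G i)) (δ t (tgt G i)) _ (δ t (src G i)) (δ (pre y) s))
      where i = punchIn σ j

    ∂₁-tσ : ∂₁ G t σ ≡ 1ℤ
    ∂₁-tσ = cong₂ _-_ (δ-refl t) (δ-≢ t≢s)

    ∂₁-row-σ : ∀ y → ∂₁-row y σ ≡ 0ℤ
    ∂₁-row-σ y = begin
      (δ (pre y) t - δ (pre y) s) + δ (pre y) s * ∂₁ G t σ
        ≡⟨ cong₂ (λ a b → (a - δ (pre y) s) + δ (pre y) s * b) (δ-≢ (punchInᵢ≢i t y)) ∂₁-tσ ⟩
      (0ℤ - δ (pre y) s) + δ (pre y) s * 1ℤ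
        ≡⟨ cancel (δ (pre y) s) ⟩
      0ℤ ∎
      where
      open ≡-Reasoning
      open import Data.Integer.Tactic.RingSolver using (solve-∀)
      cancel : ∀ a → (0ℤ - a) + a * 1ℤ ≡ 0ℤ
      cancel = solve-∀

    boundary-contract : ∀ (z : Vector ℤ (suc e)) y →
      boundary Gc (removeAt z σ) y ≡ boundary G z (pre y) + δ (pre y) s * boundary G z t
    boundary-contract z y = begin
      ∑[ j < e ] (∂₁ Gc y j * z (punchIn σ j))
        ≡⟨ sum-cong-≗ (λ j → cong (_* z (punchIn σ j)) (∂₁-contract y j)) ⟩
      sum (removeAt (λ i → ∂₁-row y i * z i) σ)
        ≡⟨ ℤ.+-identityˡ _ ⟨
      0ℤ + sum (removeAt (λ i → ∂₁-row y i * z i) σ)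
        ≡⟨ cong (λ u → u * z σ + sum (removeAt (λ i → ∂₁-row y i * z i) σ)) (∂₁-row-σ y) ⟨
      ∂₁-row y σ * z σ + sum (removeAt (λ i → ∂₁-row y i * z i) σ)
        ≡⟨ sum-remove {i = σ} (λ i → ∂₁-row y i * z i) ⟨
      ∑[ i < suc e ] (∂₁-row y i * z i)
        ≡⟨ sum-cong-≗ (λ i → expand (∂₁ G (pre y) i) (δ (pre y) s) (∂₁ G t i) (z i)) ⟩
      ∑[ i < suc e ] (∂₁ G (pre y) i * z i + δ (pre y) s * (∂₁ G t i * z i))
        ≡⟨ ∑-distrib-+ (λ i → ∂₁ G (pre y) i * z i) (λ i → δ (pre y) s * (∂₁ G t i * z i)) ⟩
      boundary G z (pre y) + ∑[ i < suc e ] (δ (pre y) s * (∂₁ G t i * z i))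
        ≡⟨ cong (_+_ (boundary G z (pre y))) (*-distribˡ-sum (δ (pre y) s) (λ i → ∂₁ G t i * z i)) ⟨
      boundary G z (pre y) + δ (pre y) s * boundary G z t ∎
      where
      open ≡-Reasoning
      open import Data.Integer.Tactic.RingSolver using (solve-∀)
      expand : ∀ a f b x → (a + f * b) * x ≡ a * x + f * (b * x)
      expand = solve-∀

    boundary-t : (z : Vector ℤ (suc e)) →
      boundary G z t ≡ z σ + ∑[ j < e ] (∂₁ G t (punchIn σ j) * z (punchIn σ j))
    boundary-t z = trans (sum-remove {i = σ} (λ i → ∂₁ G t i * z i))
      (cong (_+ sum (removeAt (λ i → ∂₁ G t i * z i) σ))
        (trans (cong (_* z σ) ∂₁-tσ) (ℤ.*-identityˡ (z σ))))

  contractCycle : Z₁ G → Z₁ Gc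
  vec    (contractCycle z)   = removeAt (vec z) σ
  closed (contractCycle z) y = trans (boundary-contract (vec z) y)
    (trans (cong₂ (λ a b → a + δ (pre y) s * b) (closed z (pre y)) (closed z t))
      (trans (ℤ.+-identityˡ _) (ℤ.*-zeroʳ (δ (pre y) s))))

  private
    lift : Z₁ Gc → Z₁ G
    lift z = ẑ , λ x → row x
      where
      a : ℤ
      a = ∑[ j < e ] (∂₁ G t (punchIn σ j) * vec z j)

      ẑ : Vector ℤ (suc e)
      ẑ = insertAt (vec z) σ (- a)

      row-t : boundary G ẑ t ≡ 0ℤ
      row-t = trans (boundary-t ẑ) (trans
        (cong₂ _+_ (insertAt-lookup (vec z) σ (- a))
          (sum-cong-≗ (λ j → cong (∂₁ G t (punchIn σ j) *_) (insertAt-punchIn (vec z) σ (- a) j))))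
        (ℤ.+-inverseˡ a))

      row-pre : ∀ y → boundary G ẑ (pre y) ≡ 0ℤ
      row-pre y = begin
        boundary G ẑ (pre y)
          ≡⟨ ℤ.+-identityʳ _ ⟨
        boundary G ẑ (pre y) + 0ℤ
          ≡⟨ cong (boundary G ẑ (pre y) +_) (trans (cong (δ (pre y) s *_) row-t) (ℤ.*-zeroʳ (δ (pre y) s))) ⟨
        boundary G ẑ (pre y) + δ (pre y) s * boundary G ẑ t
          ≡⟨ boundary-contract ẑ y ⟨
        boundary Gc (removeAt ẑ σ) y
          ≡⟨ sum-cong-≗ (λ j → cong (∂₁ Gc y j *_) (insertAt-punchIn (vec z) σ (- a) j)) ⟩
        boundary Gc (vec z) y
          ≡⟨ closed z y ⟩
        0ℤ ∎
        where open ≡-Reasoning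

      row : ∀ x → boundary G ẑ x ≡ 0ℤ
      row x with t ≟ x
      ... | yes refl = row-t
      ... | no t≢x   = subst (λ u → boundary G ẑ u ≡ 0ℤ) (punchIn-punchOut t≢x) (row-pre (punchOut t≢x))

    lift-vec : ∀ z j → vec (lift z) (punchIn σ j) ≡ vec z j
    lift-vec z = insertAt-punchIn (vec z) σ _

    contract-injective : (z : Z₁ G) → (∀ j → vec z (punchIn σ j) ≡ 0ℤ) → ∀ i → vec z i ≡ 0ℤ
    contract-injective z h i with σ ≟ i
    ... | no σ≢i = trans (cong (vec z) (sym (punchIn-punchOut σ≢i))) (h (punchOut σ≢i))
    ... | yes refl = begin
      vec z σ                                                              ≡⟨ ℤ.+-identityʳ _ ⟨
      vec z σ + 0ℤ                                                         ≡⟨ cong (vec z σ +_) (sum-zero _ λ j → trans (cong (∂₁ G t (punchIn σ j) *_) (h j)) (ℤ.*-zeroʳ (∂₁ G t (punchIn σ j)))) ⟨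
      vec z σ + ∑[ j < e ] (∂₁ G t (punchIn σ j) * vec z (punchIn σ j))    ≡⟨ boundary-t (vec z) ⟨
      boundary G (vec z) t                                                 ≡⟨ closed z t ⟩
      0ℤ ∎
      where open ≡-Reasoning

  contractBasis : Basis G m → Basis Gc m
  elt         (contractBasis β) = contractCycle ∘ elt β
  spanning    (contractBasis β) z =
    coords β (lift z) , λ j → trans (sym (lift-vec z j)) (proj₂ (spanning β (lift z)) (punchIn σ j))
  independent (contractBasis β) c h = independent β c λ i →
    trans (sym (vec-combine c (elt β) i))
      (contract-injective (combine c (elt β))
        (λ j → trans (vec-combine c (elt β) (punchIn σ j)) (h j)) i)

  -- [∂c]_βc = [∂]_β
  contractColumns : Basis G m → Vector (Z₁ G) k → Vector (Z₁ Gc) k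
  contractColumns β ∂ j = combine (coords β (∂ j)) (elt (contractBasis β))

delete : Graph v (suc e) → Fin (suc e) → Graph v e
src (delete G σ) = src G ∘ punchIn σ
tgt (delete G σ) = tgt G ∘ punchIn σ

record IsFundamentalBasis (G : Graph v e) (T : Subset e) (β : Basis G m) : Set where
  field
    tree             : IsSpanningTree G T
    chord            : Fin m → Fin e
    chord-injective  : Injective _≡_ _≡_ chord
    chord∉T          : ∀ j → chord j ∉ T
    chord-surjective : ∀ i → i ∉ T → ∃[ j ] chord j ≡ i
    fundamental      : ∀ j → ∃[ as ] IsCycle G as × Within (T ∪ ⁅ chord j ⁆) as
                             × (∀ i → vec (elt β j) i ≡ cycleVec as i)
    unit-coefficient : ∀ j → vec (elt β j) (chord j) ≡ 1ℤ

open IsFundamentalBasis public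

-- The auxiliary choices entering the construction of the deletion: the
-- fundamental basis β of a tree avoiding σ, with the cycle of σ last, and the
-- result of reducing [∂]_β to the block form with last row (0 ⋯ 0 n).
record Deletion (G : Graph v e) (σ : Fin e) (n : ℤ)
                (β : Basis G (suc (suc k))) (∂ : Vector (Z₁ G) (suc k)) : Set where
  field
    T             : Subset e
    isFundamental : IsFundamentalBasis G T β
    chord-last    : chord isFundamental (fromℕ (suc k)) ≡ σ
    reduced       : Matrix (suc (suc k)) (suc k)
    operations    : ColumnOps Sign.+ (λ i j → coords β (∂ j) i) reduced
    last-row      : ∀ j → reduced (fromℕ (suc k)) (inject₁ j) ≡ 0ℤ
    corner        : reduced (fromℕ (suc k)) (fromℕ k) ≡ n

open Deletion public

private
  cycleVec-∉ : ∀ as {i : Fin e} → ¬ (i ∈ᴱ as) → cycleVec as i ≡ 0ℤ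
  cycleVec-∉ []             ∉ = refl
  cycleVec-∉ ((j , s) ∷ as) ∉ = cong₂ _+_
    (trans (cong ((s ◃ 1) *_) (δ-≢ λ j≡i → ∉ (here (sym j≡i)))) (ℤ.*-zeroʳ (s ◃ 1)))
    (cycleVec-∉ as (∉ ∘ there))

  boundary-remove : (G : Graph v (suc e)) (σ : Fin (suc e)) (z : Vector ℤ (suc e)) → z σ ≡ 0ℤ →
                    ∀ x → boundary (delete G σ) (removeAt z σ) x ≡ boundary G z x
  boundary-remove G σ z z≡0 x = sym (begin
    boundary G z x
      ≡⟨ sum-remove {i = σ} (λ i → ∂₁ G x i * z i) ⟩
    ∂₁ G x σ * z σ + boundary (delete G σ) (removeAt z σ) x
      ≡⟨ cong (_+ boundary (delete G σ) (removeAt z σ) x) (trans (cong (∂₁ G x σ *_) z≡0) (ℤ.*-zeroʳ (∂₁ G x σ))) ⟩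
    0ℤ + boundary (delete G σ) (removeAt z σ) x
      ≡⟨ ℤ.+-identityˡ _ ⟩
    boundary (delete G σ) (removeAt z σ) x ∎)
    where open ≡-Reasoning

deleteCycle : {G : Graph v (suc e)} (σ : Fin (suc e)) (z : Z₁ G) → vec z σ ≡ 0ℤ → Z₁ (delete G σ)
vec    (deleteCycle σ z z≡0)   = removeAt (vec z) σ
closed (deleteCycle {G = G} σ z z≡0) x = trans (boundary-remove G σ (vec z) z≡0 x) (closed z x)

module _ {G : Graph v (suc e)} {σ : Fin (suc e)} {n : ℤ}
         {β : Basis G (suc (suc k))} {∂ : Vector (Z₁ G) (suc k)} (D : Deletion G σ n β ∂) where
  private
    last : Fin (suc (suc k))
    last = fromℕ (suc k)

    σ∉T : σ ∉ T D
    σ∉T = subst (_∉ T D) (chord-last D) (chord∉T (isFundamental D) last)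

    zero-at-σ : ∀ j → vec (elt β (inject₁ j)) σ ≡ 0ℤ
    zero-at-σ j with fundamental (isFundamental D) (inject₁ j)
    ... | as , _ , within , eq = trans (eq σ) (cycleVec-∉ as λ σ∈ → absurd (x∈p∪q⁻ (T D) _ (within σ σ∈)))
      where
      absurd : ¬ (σ ∈ T D ⊎ σ ∈ ⁅ chord (isFundamental D) (inject₁ j) ⁆)
      absurd (inj₁ σ∈T) = σ∉T σ∈T
      absurd (inj₂ σ∈)  = fromℕ≢inject₁ (chord-injective (isFundamental D)
                            (trans (chord-last D) (x∈⁅y⁆⇒x≡y _ σ∈)))

    one-at-σ : vec (elt β last) σ ≡ 1ℤ
    one-at-σ = subst (λ i → vec (elt β last) i ≡ 1ℤ) (chord-last D)
                 (unit-coefficient (isFundamental D) last)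

    linComb-σ : ∀ c → linComb c (vec ∘ elt β) σ ≡ c last
    linComb-σ c = begin
      linComb c (vec ∘ elt β) σ
        ≡⟨ sum-init-last (λ j → c j * vec (elt β j) σ) ⟩
      sum (init (λ j → c j * vec (elt β j) σ)) + c last * vec (elt β last) σ
        ≡⟨ cong₂ _+_ (sum-zero _ λ j → trans (cong (c (inject₁ j) *_) (zero-at-σ j)) (ℤ.*-zeroʳ (c (inject₁ j))))
                     (trans (cong (c last *_) one-at-σ) (ℤ.*-identityʳ (c last))) ⟩
      0ℤ + c last
        ≡⟨ ℤ.+-identityˡ _ ⟩
      c last ∎
      where open ≡-Reasoning

    linComb-init : ∀ c → c last ≡ 0ℤ → ∀ i →
      linComb c (vec ∘ elt β) i ≡ linComb (init c) (vec ∘ elt β ∘ inject₁) i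
    linComb-init c c≡0 i = begin
      linComb c (vec ∘ elt β) i
        ≡⟨ sum-init-last (λ j → c j * vec (elt β j) i) ⟩
      linComb (init c) (vec ∘ elt β ∘ inject₁) i + c last * vec (elt β last) i
        ≡⟨ cong (λ a → linComb (init c) (vec ∘ elt β ∘ inject₁) i + a * vec (elt β last) i) c≡0 ⟩
      linComb (init c) (vec ∘ elt β ∘ inject₁) i + 0ℤ
        ≡⟨ ℤ.+-identityʳ _ ⟩
      linComb (init c) (vec ∘ elt β ∘ inject₁) i ∎
      where open ≡-Reasoning

    extend : Z₁ (delete G σ) → Z₁ G
    extend z = ẑ , λ x → begin
      boundary G ẑ x                           ≡⟨ boundary-remove G σ ẑ (insertAt-lookup (vec z) σ 0ℤ) x ⟨
      boundary (delete G σ) (removeAt ẑ σ) x   ≡⟨ sum-cong-≗ (λ j → cong (∂₁ (delete G σ) x j *_) (insertAt-punchIn (vec z) σ 0ℤ j)) ⟩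
      boundary (delete G σ) (vec z) x          ≡⟨ closed z x ⟩
      0ℤ ∎
      where
      open ≡-Reasoning
      ẑ : Vector ℤ (suc e)
      ẑ = insertAt (vec z) σ 0ℤ

  deleteBasis : Basis (delete G σ) (suc k)
  elt      deleteBasis j = deleteCycle σ (elt β (inject₁ j)) (zero-at-σ j)
  spanning deleteBasis z = init c , λ j → begin
    vec z j                                                        ≡⟨ insertAt-punchIn (vec z) σ 0ℤ j ⟨
    vec (extend z) (punchIn σ j)                                   ≡⟨ c-spans (punchIn σ j) ⟩
    linComb c (vec ∘ elt β) (punchIn σ j)                          ≡⟨ linComb-init c c-last (punchIn σ j) ⟩
    linComb (init c) (vec ∘ elt β ∘ inject₁) (punchIn σ j)         ∎
    where
    open ≡-Reasoning
    c : Vector ℤ (suc (suc k))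
    c = coords β (extend z)
    c-spans : ∀ i → vec (extend z) i ≡ linComb c (vec ∘ elt β) i
    c-spans = proj₂ (spanning β (extend z))
    c-last : c last ≡ 0ℤ
    c-last = trans (sym (linComb-σ c)) (trans (sym (c-spans σ)) (insertAt-lookup (vec z) σ 0ℤ))
  independent deleteBasis c h j = trans (sym (snoc-init j)) (independent β ĉ ĉ-zero (inject₁ j))
    where
    snoc : ∀ {n} → Vector ℤ n → Vector ℤ (suc n)
    snoc {zero}  d _       = 0ℤ
    snoc {suc n} d zero    = d zero
    snoc {suc n} d (suc i) = snoc (d ∘ suc) i
    snoc-inject₁ : ∀ {n} (d : Vector ℤ n) i → snoc d (inject₁ i) ≡ d i
    snoc-inject₁ {suc n} d zero    = refl
    snoc-inject₁ {suc n} d (suc i) = snoc-inject₁ (d ∘ suc) i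
    snoc-last : ∀ {n} (d : Vector ℤ n) → snoc d (fromℕ n) ≡ 0ℤ
    snoc-last {zero}  d = refl
    snoc-last {suc n} d = snoc-last (d ∘ suc)
    ĉ : Vector ℤ (suc (suc k))
    ĉ = snoc c
    snoc-init : ∀ i → ĉ (inject₁ i) ≡ c i
    snoc-init = snoc-inject₁ c
    ĉ-zero : ∀ i → linComb ĉ (vec ∘ elt β) i ≡ 0ℤ
    ĉ-zero i with σ ≟ i
    ... | yes refl = trans (linComb-σ ĉ) (snoc-last c)
    ... | no σ≢i   = trans (linComb-init ĉ (snoc-last c) i)
      (trans (sum-cong-≗ λ j → cong₂ _*_ (snoc-init j)
                (cong (vec (elt β (inject₁ j))) (sym (punchIn-punchOut σ≢i))))
             (h (punchOut σ≢i)))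

  deleteColumns : Vector (Z₁ (delete G σ)) k
  deleteColumns j = combine (λ i → reduced D (inject₁ i) (inject₁ j)) (elt deleteBasis)

{-# OPTIONS --safe #-}
-- The summand w(z_Y) z_Y does not change when the orientation of the cycle z_Y
-- is reversed.  A connected spanning subgraph Y is a cycletree exactly when its
-- cycle space has rank one, and then z_Y is one of its two generators: the
-- support of a nonzero flow contains a directed cycle, found by walking back
-- along positive flow.  Forgetting the coefficient of σ identifies the cycle
-- space of Y ∋ σ with that of its image in G/σ, and the cycle space of Y ∌ σ
-- with that of the same subgraph of G − σ; so items 2 and 4 hold summand by
-- summand once the winding numbers are compared.  For G/σ they agree because the
-- coordinates do.  For G − σ, column operations of sign + preserve the
-- determinant, whose last row is then (0 ⋯ 0 n_σ).  Two bases differ by a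
-- unimodular matrix, which gives the sign in the second clause of item 4.  In
-- item 3, w(z_Y) ≠ 0 would make z_Y and any cycle through σ independent modulo
-- the image of ∂, whose cokernel has rank one.

module Submission where

open import Defs
open import Data.Bool.Base using (Bool; true; false; not; if_then_else_)
open import Data.Fin.Base using (Fin; zero; suc; toℕ; fromℕ; inject₁; punchIn; punchOut)
open import Data.Fin.Permutation.Components using (transpose)
open import Data.Fin.Properties using (_≟_; any?; injective⇒≤; punchIn-punchOut; punchOut-punchIn; punchOut-cong; punchInᵢ≢i; punchIn-injective; fromℕ≢inject₁; toℕ-inject₁)
open import Data.Fin.Subset using (Subset; _∈_; _∉_; ⁅_⁆; inside; outside)
open import Data.Fin.Subset.Properties using (_∈?_; x∈p∪q⁻; x∈⁅y⁆⇒x≡y)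
open import Data.Integer.Base using (ℤ; 0ℤ; 1ℤ; -1ℤ; +_; -[1+_]; _+_; _-_; _*_; -_; _^_; _◃_; ∣_∣; sign; _≤_; +≤+; ≢-nonZero)
import Data.Integer.Properties as ℤ
open import Data.Integer.Tactic.RingSolver using (solve-∀)
open import Data.List.Base as List using (List; []; _∷_; length; lookup; take)
import Data.List.Membership.DecPropositional as DecMembership
import Data.List.Membership.Propositional as List∈
open import Data.List.Membership.Propositional.Properties using (∈-lookup)
open import Data.List.Properties using (map-∘; map-id; take-map; length-map)
open import Data.List.Relation.Unary.All as All using (All; []; _∷_)
import Data.List.Relation.Unary.All.Properties as All
open import Data.List.Relation.Unary.AllPairs using ([]; _∷_)
open import Data.List.Relation.Unary.Any using (here; there)
open import Data.List.Relation.Unary.Unique.Propositional using (Unique)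
import Data.List.Relation.Unary.Unique.Propositional.Properties as Unique
open import Data.Nat.Base as ℕ using (ℕ; zero; suc)
import Data.Nat.Properties as ℕ
open import Data.Product.Base using (∃-syntax; _×_; _,_; proj₁; proj₂)
open import Data.Sign.Base as Sign using (Sign; opposite)
open import Data.Sum.Base using (_⊎_; inj₁; inj₂; [_,_]′)
import Data.Vec.Base as Vec
open import Data.Vec.Functional as Vector using (Vector; removeAt; insertAt; updateAt; init)
open import Data.Vec.Functional.Properties using (updateAt-updates; updateAt-minimal; insertAt-lookup; insertAt-punchIn)
import Data.Vec.Properties as Vec
open import Function.Base using (_∘_)
open import Level using (0ℓ)
open import Relation.Binary.Construct.Closure.Equivalence using (EqClosure) renaming (symmetric to EqClosure-symmetric)
open import Relation.Binary.Construct.Closure.ReflexiveTransitive using (ε; _◅_; _◅◅_)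
open import Relation.Binary.Construct.Closure.Symmetric using (fwd; bwd)
open import Relation.Binary.PropositionalEquality
open import Relation.Nullary using (¬_; Dec; yes; no; does; contradiction)
open import Relation.Nullary.Decidable using (_×-dec_; ¬?; decidable-stable; dec-true; dec-false)
open import Relation.Unary using (Pred; Decidable)
open import Algebra.Properties.Semiring.Sum ℤ.+-*-semiring
  using (sum-cong-≗; sum-remove; sum-init-last; ∑-distrib-+; ∑-comm; *-distribˡ-sum; *-distribʳ-sum; sum-replicate-zero)

-- Cycletrees are compared through their cycle spaces, not through lists of arcs, because a cycle of
-- G/σ comes from a cycle of G that may or may not run through σ, whereas the flow of G that
-- restricts to a given flow of G/σ is unique in both cases. Deletion has the same linear
-- description, so both operations share the record `Transfer` and the summation lemma
-- `transfer-lam`, with the factor 1 for contraction and n_σ for deletion. Since `det` is defined by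
-- expansion along the first column, everything else about it is derived from alternating forms in
-- an arbitrary number of columns. Fixing the first column [z]_β, or sending all columns through a
-- linear map, yields an alternating form again; and an alternating form in n columns of length n is
-- a multiple of the determinant. The first fact gives the effect of column operations on the block
-- [∂]_β alone, the second gives multiplicativity and hence the change of basis.

private
  variable
    e k m n v : ℕ

-- Alternating forms and determinants

sum-zero : (f : Vector ℤ n) → (∀ i → f i ≡ 0ℤ) → sum f ≡ 0ℤ
sum-zero {n} f h = trans (sum-cong-≗ h) (sum-replicate-zero n)

sum-linear : ∀ a b (f g : Vector ℤ n) → ∑[ i < n ] (a * f i + b * g i) ≡ a * sum f + b * sum g
sum-linear a b f g = trans (∑-distrib-+ (λ i → a * f i) (λ i → b * g i))
  (sym (cong₂ _+_ (*-distribˡ-sum a f) (*-distribˡ-sum b g)))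

infixl 6 _[_]≔_

_[_]≔_ : ∀ {A : Set} → Vector A n → Fin n → A → Vector A n
C [ q ]≔ x = updateAt C q (λ _ → x)

-- The first index is the column: C j i is the entry in row i and column j.
Columns : ℕ → ℕ → Set
Columns m n = Vector (Vector ℤ m) n

infix 4 _≈_

_≈_ : Columns m n → Columns m n → Set
C ≈ D = ∀ j i → C j i ≡ D j i

≔-cong : ∀ (C : Columns m n) q {x y} → x ≗ y → C [ q ]≔ x ≈ C [ q ]≔ y
≔-cong C zero    h zero    = h
≔-cong C zero    h (suc j) i = refl
≔-cong C (suc q) h zero    i = refl
≔-cong C (suc q) h (suc j) = ≔-cong (C ∘ suc) q h j

≔-self : ∀ (C : Columns m n) q {x} → x ≗ C q → C [ q ]≔ x ≈ C
≔-self C zero    h zero    = h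
≔-self C zero    h (suc j) i = refl
≔-self C (suc q) h zero    i = refl
≔-self C (suc q) h (suc j) = ≔-self (C ∘ suc) q h j

∷-≔ : ∀ (x : Vector ℤ m) (C : Columns m n) q y → (x Vector.∷ C) [ suc q ]≔ y ≈ x Vector.∷ (C [ q ]≔ y)
∷-≔ x C q y zero    i = refl
∷-≔ x C q y (suc j) i = refl

∷-cong : ∀ {x y : Vector ℤ m} {C D : Columns m n} → x ≗ y → C ≈ D → x Vector.∷ C ≈ y Vector.∷ D
∷-cong h h′ zero    = h
∷-cong h h′ (suc j) = h′ j

map-≔ : ∀ (L : Vector ℤ k → Vector ℤ m) (C : Columns k n) q x → L ∘ (C [ q ]≔ x) ≈ (L ∘ C) [ q ]≔ L x
map-≔ L C zero    x zero    i = refl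
map-≔ L C zero    x (suc j) i = refl
map-≔ L C (suc q) x zero    i = refl
map-≔ L C (suc q) x (suc j) = map-≔ L (C ∘ suc) q x j

lin : ℤ → ℤ → Vector ℤ m → Vector ℤ m → Vector ℤ m
lin a b x y i = a * x i + b * y i

-- The numbers of rows and columns are independent, so that the notion survives fixing a column,
-- which lowers `n` but not `m`. `respects` is a field because columns are functions and are
-- compared entry by entry.
record IsAlternating (f : Columns m n → ℤ) : Set where
  field
    respects   : ∀ {C D} → C ≈ D → f C ≡ f D
    linear     : ∀ C q a b x y →
                 f (C [ q ]≔ lin a b x y) ≡ a * f (C [ q ]≔ x) + b * f (C [ q ]≔ y)
    alternates : ∀ C p q → p ≢ q → C p ≗ C q → f C ≡ 0ℤ

  -- The zero vector is the combination 0 · 0 + 0 · 0; after `linear`, both summands `0ℤ * _` reduce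
  -- to `0ℤ`.
  zero-column : ∀ C q {x} → (∀ i → x i ≡ 0ℤ) → f (C [ q ]≔ x) ≡ 0ℤ
  zero-column C q {x} h = trans (respects (≔-cong C q h)) (linear C q 0ℤ 0ℤ (λ _ → 0ℤ) (λ _ → 0ℤ))

  linear-sum : ∀ C q c (X : Columns m k) →
               f (C [ q ]≔ linComb c X) ≡ ∑[ j < k ] (c j * f (C [ q ]≔ X j))
  linear-sum {k = zero}  C q c X = zero-column C q λ _ → refl
  linear-sum {k = suc k} C q c X = begin
    f (C [ q ]≔ linComb c X)
      ≡⟨ respects (≔-cong C q λ i → cong (_+_ (c zero * X zero i)) (sym (ℤ.*-identityˡ _))) ⟩
    f (C [ q ]≔ lin (c zero) 1ℤ (X zero) (linComb (c ∘ suc) (X ∘ suc)))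
      ≡⟨ linear C q (c zero) 1ℤ (X zero) _ ⟩
    c zero * f (C [ q ]≔ X zero) + 1ℤ * f (C [ q ]≔ linComb (c ∘ suc) (X ∘ suc))
      ≡⟨ cong (_+_ (c zero * f (C [ q ]≔ X zero)))
           (trans (ℤ.*-identityˡ _) (linear-sum C q (c ∘ suc) (X ∘ suc))) ⟩
    ∑[ j < suc k ] (c j * f (C [ q ]≔ X j)) ∎
    where open ≡-Reasoning

  equal-columns : ∀ C p q → p ≢ q → ∀ {x} → x ≗ C p → f (C [ q ]≔ x) ≡ 0ℤ
  equal-columns C p q p≢q {x} h = alternates _ p q p≢q λ i → begin
    (C [ q ]≔ x) p i   ≡⟨ cong-app (updateAt-minimal p q C p≢q) i ⟩
    C p i              ≡⟨ h i ⟨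
    x i                ≡⟨ cong-app (updateAt-updates q C) i ⟨
    (C [ q ]≔ x) q i   ∎
    where open ≡-Reasoning

  shear : ∀ C p q t → p ≢ q → f (C [ q ]≔ λ i → C q i + t * C p i) ≡ f C
  shear C p q t p≢q = begin
    f (C [ q ]≔ λ i → C q i + t * C p i)
      ≡⟨ respects (≔-cong C q λ i → cong (_+ t * C p i) (sym (ℤ.*-identityˡ (C q i)))) ⟩
    f (C [ q ]≔ lin 1ℤ t (C q) (C p))
      ≡⟨ linear C q 1ℤ t (C q) (C p) ⟩
    1ℤ * f (C [ q ]≔ C q) + t * f (C [ q ]≔ C p)
      ≡⟨ cong₂ (λ a b → 1ℤ * a + t * b) (respects (≔-self C q λ _ → refl))
           (equal-columns C p q p≢q λ _ → refl) ⟩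
    1ℤ * f C + t * 0ℤ
      ≡⟨ simplify (f C) t ⟩
    f C ∎
    where
    open ≡-Reasoning
    simplify : ∀ a t → 1ℤ * a + t * 0ℤ ≡ a
    simplify = solve-∀

  negated : ∀ C q {x} → (∀ i → x i ≡ - C q i) → f (C [ q ]≔ x) ≡ - f C
  negated C q {x} h = begin
    f (C [ q ]≔ x)
      ≡⟨ respects (≔-cong C q λ i → trans (h i) (expand (C q i))) ⟩
    f (C [ q ]≔ lin -1ℤ 0ℤ (C q) (C q))
      ≡⟨ linear C q -1ℤ 0ℤ (C q) (C q) ⟩
    -1ℤ * f (C [ q ]≔ C q) + 0ℤ * f (C [ q ]≔ C q)
      ≡⟨ cong (λ a → -1ℤ * a + 0ℤ * a) (respects (≔-self C q λ _ → refl)) ⟩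
    -1ℤ * f C + 0ℤ * f C
      ≡⟨ expand (f C) ⟨
    - f C ∎
    where
    open ≡-Reasoning
    expand : ∀ a → - a ≡ -1ℤ * a + 0ℤ * a
    expand = solve-∀

  -- Polarization: expand f (…, x + y, …, x + y, …) = 0.
  antisymmetric : ∀ C D p q → p ≢ q → C p ≗ D q → C q ≗ D p →
                  (∀ j → j ≢ p → j ≢ q → C j ≗ D j) → f D ≡ - f C
  antisymmetric C D p q p≢q Cp≗Dq Cq≗Dp same = begin
    f D                                       ≡⟨ respects D≈ ⟩
    f (E y x)                                 ≡⟨ isolate (f (E x y)) (f (E y x)) ⟩
    - f (E x y) + (0ℤ + f (E x y) + (f (E y x) + 0ℤ))
      ≡⟨ cong (_+_ (- f (E x y))) polarized ⟩
    - f (E x y) + 0ℤ                          ≡⟨ ℤ.+-identityʳ _ ⟩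
    - f (E x y)                               ≡⟨ cong -_ (respects C≈) ⟨
    - f C                                     ∎
    where
    open ≡-Reasoning
    x = C p
    y = C q
    E : Vector ℤ _ → Vector ℤ _ → Columns _ _
    E a b = C [ q ]≔ b [ p ]≔ a
    E-p : ∀ a b → E a b p ≡ a
    E-p a b = updateAt-updates p (C [ q ]≔ b)
    E-q : ∀ a b → E a b q ≡ b
    E-q a b = trans (updateAt-minimal q p (C [ q ]≔ b) (≢-sym p≢q)) (updateAt-updates q C)
    E-other : ∀ a b j → j ≢ p → j ≢ q → E a b j ≡ C j
    E-other a b j j≢p j≢q = trans (updateAt-minimal j p (C [ q ]≔ b) j≢p) (updateAt-minimal j q C j≢q)
    characterize : ∀ {F a b} → F p ≗ a → F q ≗ b → (∀ j → j ≢ p → j ≢ q → F j ≗ C j) → F ≈ E a b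
    characterize {F} {a} {b} hp hq h j i with j ≟ p | j ≟ q
    ... | yes refl | _        = trans (hp i) (sym (cong-app (E-p a b) i))
    ... | no _     | yes refl = trans (hq i) (sym (cong-app (E-q a b) i))
    ... | no j≢p   | no j≢q   = trans (h j j≢p j≢q i) (sym (cong-app (E-other a b j j≢p j≢q) i))
    D≈ : D ≈ E y x
    D≈ = characterize (sym ∘ Cq≗Dp) (sym ∘ Cp≗Dq) λ j j≢p j≢q i → sym (same j j≢p j≢q i)
    C≈ : C ≈ E x y
    C≈ = characterize (λ _ → refl) (λ _ → refl) λ _ _ _ _ → refl
    diagonal : ∀ a → f (E a a) ≡ 0ℤ
    diagonal a = alternates _ p q p≢q λ i → cong-app (trans (E-p a a) (sym (E-q a a))) i
    -- The same columns as `E`, updated in the other order: `linear` expands the column updated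
    -- last, which is `p` in `E` and `q` in `F`.
    F : Vector ℤ _ → Vector ℤ _ → Columns _ _
    F a b = C [ p ]≔ a [ q ]≔ b
    E≈F : ∀ a b → F a b ≈ E a b
    E≈F a b = characterize
      (λ i → cong-app (trans (updateAt-minimal p q (C [ p ]≔ a) p≢q) (updateAt-updates p C)) i)
      (λ i → cong-app (updateAt-updates q (C [ p ]≔ a)) i)
      (λ j j≢p j≢q i → cong-app (trans (updateAt-minimal j q (C [ p ]≔ a) j≢q) (updateAt-minimal j p C j≢p)) i)
    s : Vector ℤ _
    s = lin 1ℤ 1ℤ x y
    split-q : ∀ a → f (E a s) ≡ 1ℤ * f (E a x) + 1ℤ * f (E a y)
    split-q a = trans (sym (respects (E≈F a s))) (trans (linear (C [ p ]≔ a) q 1ℤ 1ℤ x y)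
      (cong₂ (λ b c → 1ℤ * b + 1ℤ * c) (respects (E≈F a x)) (respects (E≈F a y))))
    polarized : 0ℤ + f (E x y) + (f (E y x) + 0ℤ) ≡ 0ℤ
    polarized = begin
      0ℤ + f (E x y) + (f (E y x) + 0ℤ)
        ≡⟨ cong₂ (λ a b → a + f (E x y) + (f (E y x) + b)) (diagonal x) (diagonal y) ⟨
      f (E x x) + f (E x y) + (f (E y x) + f (E y y))
        ≡⟨ units (f (E x x)) (f (E x y)) (f (E y x)) (f (E y y)) ⟩
      1ℤ * (1ℤ * f (E x x) + 1ℤ * f (E x y)) + 1ℤ * (1ℤ * f (E y x) + 1ℤ * f (E y y))
        ≡⟨ cong₂ (λ a b → 1ℤ * a + 1ℤ * b) (split-q x) (split-q y) ⟨
      1ℤ * f (E x s) + 1ℤ * f (E y s)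
        ≡⟨ linear (C [ q ]≔ s) p 1ℤ 1ℤ x y ⟨
      f (E s s)
        ≡⟨ diagonal s ⟩
      0ℤ ∎
      where
      units : ∀ a b c d → a + b + (c + d) ≡ 1ℤ * (1ℤ * a + 1ℤ * b) + 1ℤ * (1ℤ * c + 1ℤ * d)
      units = solve-∀
    isolate : ∀ a b → b ≡ - a + (0ℤ + a + (b + 0ℤ))
    isolate = solve-∀

open IsAlternating

-- Lets induction run on the number of columns, and lets column operations act on [∂]_β while the
-- column [z]_β stays in place.
∷-isAlternating : {f : Columns m (suc n) → ℤ} → IsAlternating f → ∀ x → IsAlternating (λ C → f (x Vector.∷ C))
respects   (∷-isAlternating A x) h = respects A (∷-cong (λ _ → refl) h)
linear     (∷-isAlternating {f = f} A x) C q a b y z = begin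
  f (x Vector.∷ (C [ q ]≔ lin a b y z))                                      ≡⟨ respects A (∷-≔ x C q _) ⟨
  f ((x Vector.∷ C) [ suc q ]≔ lin a b y z)                                  ≡⟨ linear A (x Vector.∷ C) (suc q) a b y z ⟩
  a * f ((x Vector.∷ C) [ suc q ]≔ y) + b * f ((x Vector.∷ C) [ suc q ]≔ z)  ≡⟨ cong₂ (λ u v → a * u + b * v) (respects A (∷-≔ x C q y)) (respects A (∷-≔ x C q z)) ⟩
  a * f (x Vector.∷ (C [ q ]≔ y)) + b * f (x Vector.∷ (C [ q ]≔ z))          ∎
  where open ≡-Reasoning
alternates (∷-isAlternating A x) C p q p≢q h = alternates A (x Vector.∷ C) (suc p) (suc q) (λ { refl → p≢q refl }) h

record IsLinear (L : Vector ℤ k → Vector ℤ m) : Set where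
  field
    preserves-≗   : ∀ {x y} → x ≗ y → L x ≗ L y
    preserves-lin : ∀ a b x y → L (lin a b x y) ≗ lin a b (L x) (L y)

open IsLinear

-- Applied to multiplication by a transition matrix, for the change of basis, and to the insertion
-- of a zero row, for minors.
map-isAlternating : {f : Columns m n → ℤ} {L : Vector ℤ k → Vector ℤ m} →
                    IsAlternating f → IsLinear L → IsAlternating (λ C → f (L ∘ C))
respects   (map-isAlternating A l) h = respects A λ j → preserves-≗ l (h j)
linear     (map-isAlternating {f = f} {L} A l) C q a b x y = begin
  f (L ∘ (C [ q ]≔ lin a b x y))                                   ≡⟨ respects A (map-≔ L C q _) ⟩
  f ((L ∘ C) [ q ]≔ L (lin a b x y))                               ≡⟨ respects A (≔-cong (L ∘ C) q (preserves-lin l a b x y)) ⟩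
  f ((L ∘ C) [ q ]≔ lin a b (L x) (L y))                           ≡⟨ linear A (L ∘ C) q a b (L x) (L y) ⟩
  a * f ((L ∘ C) [ q ]≔ L x) + b * f ((L ∘ C) [ q ]≔ L y)          ≡⟨ cong₂ (λ u v → a * u + b * v) (respects A (map-≔ L C q x)) (respects A (map-≔ L C q y)) ⟨
  a * f (L ∘ (C [ q ]≔ x)) + b * f (L ∘ (C [ q ]≔ y))              ∎
  where open ≡-Reasoning
alternates (map-isAlternating A l) C p q p≢q h = alternates A _ p q p≢q (preserves-≗ l h)

linComb-isLinear : (X : Columns m k) → IsLinear (λ c → linComb c X)
preserves-≗   (linComb-isLinear X) h i = sum-cong-≗ λ j → cong (_* X j i) (h j)
preserves-lin (linComb-isLinear X) a b x y i = trans
  (sum-cong-≗ λ j → expand a b (x j) (y j) (X j i))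
  (sum-linear a b (λ j → x j * X j i) (λ j → y j * X j i))
  where
  expand : ∀ a b x y z → (a * x + b * y) * z ≡ a * (x * z) + b * (y * z)
  expand = solve-∀

insertZero-isLinear : (i : Fin (suc m)) → IsLinear (λ x → insertAt x i 0ℤ)
insertZero-isLinear i = record { preserves-≗ = cong-insert i ; preserves-lin = lin-insert i }
  where
  cong-insert : ∀ {m} (i : Fin (suc m)) {x y} → x ≗ y → insertAt x i 0ℤ ≗ insertAt y i 0ℤ
  cong-insert zero h zero = refl
  cong-insert zero h (suc r) = h r
  cong-insert {suc m} (suc i) h zero    = h zero
  cong-insert {suc m} (suc i) h (suc r) = cong-insert i (h ∘ suc) r
  lin-insert : ∀ {m} (i : Fin (suc m)) a b x y →
               insertAt (lin a b x y) i 0ℤ ≗ lin a b (insertAt x i 0ℤ) (insertAt y i 0ℤ)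
  lin-insert zero a b x y zero = sym (cong₂ _+_ (ℤ.*-zeroʳ a) (ℤ.*-zeroʳ b))
  lin-insert zero a b x y (suc r) = refl
  lin-insert {suc m} (suc i) a b x y zero    = refl
  lin-insert {suc m} (suc i) a b x y (suc r) = lin-insert i a b (x ∘ suc) (y ∘ suc) r

-- The determinant is an alternating form

det-cong : ∀ {M N : Matrix n n} → (∀ i j → M i j ≡ N i j) → det M ≡ det N
det-cong {zero}  h = refl
det-cong {suc n} h = sum-cong-≗ λ i →
  cong₂ (λ a b → -1ℤ ^ toℕ i * a * b) (h i zero) (det-cong λ r c → h (punchIn i r) (suc c))

detᶜ : Columns n n → ℤ
detᶜ C = det (λ i j → C j i)

minor : Columns (suc m) (suc n) → Fin (suc m) → Columns m n
minor C i c = removeAt (C (suc c)) i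

-- The first column enters the Laplace expansion only through the coefficients, a later column only
-- through the minors, where induction applies.
detᶜ-linear : ∀ (C : Columns n n) q a b x y →
  detᶜ (C [ q ]≔ lin a b x y) ≡ a * detᶜ (C [ q ]≔ x) + b * detᶜ (C [ q ]≔ y)
detᶜ-linear {suc n} C zero a b x y = trans
  (sum-cong-≗ λ i → expand (-1ℤ ^ toℕ i) a b (x i) (y i) (detᶜ (minor C i)))
  (sum-linear a b (λ i → -1ℤ ^ toℕ i * x i * detᶜ (minor C i)) (λ i → -1ℤ ^ toℕ i * y i * detᶜ (minor C i)))
  where
  expand : ∀ s a b x y d → s * (a * x + b * y) * d ≡ a * (s * x * d) + b * (s * y * d)
  expand = solve-∀
detᶜ-linear {suc n} C (suc q) a b x y = trans
  (sum-cong-≗ λ i → trans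
    (cong (-1ℤ ^ toℕ i * C zero i *_)
      (trans (det-cong λ r c → map-≔ (λ z → removeAt z i) (C ∘ suc) q (lin a b x y) c r)
      (trans (detᶜ-linear (minor C i) q a b (removeAt x i) (removeAt y i))
      (sym (cong₂ (λ u v → a * u + b * v)
        (det-cong λ r c → map-≔ (λ z → removeAt z i) (C ∘ suc) q x c r)
        (det-cong λ r c → map-≔ (λ z → removeAt z i) (C ∘ suc) q y c r))))))
    (expand (-1ℤ ^ toℕ i * C zero i) a b (detᶜ (minor (C [ suc q ]≔ x) i)) (detᶜ (minor (C [ suc q ]≔ y) i))))
  (sum-linear a b (λ i → -1ℤ ^ toℕ i * C zero i * detᶜ (minor (C [ suc q ]≔ x) i))
                  (λ i → -1ℤ ^ toℕ i * C zero i * detᶜ (minor (C [ suc q ]≔ y) i)))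
  where
  expand : ∀ s a b u v → s * (a * u + b * v) ≡ a * (s * u) + b * (s * v)
  expand = solve-∀

-- The terms (i , j) and (punchIn i j , _) of a double Laplace expansion along
-- two equal columns cancel.  D ρ is the complementary minor on the rows ρ.
double-expansion-cancels : ∀ m (x : Vector ℤ (suc (suc m))) (D : (Fin m → Fin (suc (suc m))) → ℤ) →
  (∀ ρ τ → ρ ≗ τ → D ρ ≡ D τ) →
  ∑[ i < suc (suc m) ] ∑[ j < suc m ]
    (-1ℤ ^ toℕ i * x i * (-1ℤ ^ toℕ j * x (punchIn i j) * D (punchIn i ∘ punchIn j))) ≡ 0ℤ
double-expansion-cancels m x D D-cong = begin
  sum (H zero) + ∑[ i < suc m ] (H (suc i) zero + ∑[ j < m ] H (suc i) (suc j))
    ≡⟨ cong (_+_ (sum (H zero))) (∑-distrib-+ (λ i → H (suc i) zero) (λ i → ∑[ j < m ] H (suc i) (suc j))) ⟩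
  sum (H zero) + (∑[ i < suc m ] H (suc i) zero + rest)
    ≡⟨ ℤ.+-assoc (sum (H zero)) _ rest ⟨
  sum (H zero) + ∑[ i < suc m ] H (suc i) zero + rest
    ≡⟨ cong (_+ rest) (∑-distrib-+ (H zero) (λ i → H (suc i) zero)) ⟨
  ∑[ j < suc m ] (H zero j + H (suc j) zero) + rest
    ≡⟨ cong₂ _+_ (sum-zero _ pair) (rest≡0 m x D D-cong) ⟩
  0ℤ ∎
  where
  open ≡-Reasoning
  H : Fin (suc (suc m)) → Fin (suc m) → ℤ
  H i j = -1ℤ ^ toℕ i * x i * (-1ℤ ^ toℕ j * x (punchIn i j) * D (punchIn i ∘ punchIn j))
  rest : ℤ
  rest = ∑[ i < suc m ] ∑[ j < m ] H (suc i) (suc j)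
  opposite-signs : ∀ s a b d → 1ℤ * a * (s * b * d) + -1ℤ * s * b * (1ℤ * a * d) ≡ 0ℤ
  opposite-signs = solve-∀
  -- Deleting the rows `zero` and `suc j` in either order leaves the same rows, by computation; the
  -- two signs differ by one factor -1.
  pair : ∀ j → H zero j + H (suc j) zero ≡ 0ℤ
  pair j = opposite-signs (-1ℤ ^ toℕ j) (x zero) (x (suc j)) (D (λ r → suc (punchIn j r)))
  same-signs : ∀ s t a b d → -1ℤ * s * a * (-1ℤ * t * b * d) ≡ s * a * (t * b * d)
  same-signs = solve-∀
  -- When neither deleted row is `zero`, that row heads every complementary minor. It is absorbed
  -- into `D`, the two extra factors -1 cancel, and a double expansion with one row less remains.
  rest≡0 : ∀ m (x : Vector ℤ (suc (suc m))) (D : (Fin m → Fin (suc (suc m))) → ℤ) → (∀ ρ τ → ρ ≗ τ → D ρ ≡ D τ) →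
    ∑[ i < suc m ] ∑[ j < m ]
      (-1ℤ ^ toℕ (suc i) * x (suc i) * (-1ℤ ^ toℕ (suc j) * x (punchIn (suc i) (suc j)) * D (punchIn (suc i) ∘ punchIn (suc j)))) ≡ 0ℤ
  rest≡0 zero    x D D-cong = sum-zero {1} (λ _ → 0ℤ) λ _ → refl
  rest≡0 (suc m) x D D-cong = trans
    (sum-cong-≗ λ i → sum-cong-≗ λ j → trans
      (same-signs (-1ℤ ^ toℕ i) (-1ℤ ^ toℕ j) (x (suc i)) (x (suc (punchIn i j))) _)
      (cong (λ d → -1ℤ ^ toℕ i * x (suc i) * (-1ℤ ^ toℕ j * x (suc (punchIn i j)) * d))
        (D-cong (punchIn (suc i) ∘ punchIn (suc j)) (zero Vector.∷ (suc ∘ punchIn i ∘ punchIn j)) λ { zero → refl ; (suc r) → refl })))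
    (double-expansion-cancels m (x ∘ suc) (λ ρ → D (zero Vector.∷ (suc ∘ ρ)))
      λ ρ τ h → D-cong _ _ λ { zero → refl ; (suc r) → cong suc (h r) })

detᶜ-isAlternating : IsAlternating (detᶜ {n})
respects   detᶜ-isAlternating h = det-cong λ i j → h j i
linear     detᶜ-isAlternating = detᶜ-linear
alternates (detᶜ-isAlternating {suc n}) = alt
  where
  open ≡-Reasoning

  adjacent : ∀ {n} (C : Columns (suc (suc n)) (suc (suc n))) → C zero ≗ C (suc zero) → detᶜ C ≡ 0ℤ
  adjacent {n} C h = trans
    (sum-cong-≗ λ i → trans (*-distribˡ-sum (-1ℤ ^ toℕ i * C zero i) λ j → -1ℤ ^ toℕ j * C (suc zero) (punchIn i j) * D (punchIn i ∘ punchIn j))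
      (sum-cong-≗ λ j → cong (λ a → -1ℤ ^ toℕ i * C zero i * (-1ℤ ^ toℕ j * a * D (punchIn i ∘ punchIn j))) (sym (h (punchIn i j)))))
    (double-expansion-cancels n (C zero) D λ ρ τ ρ≗τ → det-cong λ r c → cong (C (suc (suc c))) (ρ≗τ r))
    where
    D : (Fin n → Fin (suc (suc n))) → ℤ
    D ρ = det (λ r c → C (suc (suc c)) (ρ r))

  -- A column equal to the first one is moved next to it by a transposition,
  -- which negates every minor.
  first : ∀ {n} (C : Columns (suc n) (suc n)) → IsAlternating (detᶜ {n}) → ∀ q → C zero ≗ C (suc q) → detᶜ C ≡ 0ℤ
  first C A zero h = adjacent C h
  first {suc n} C A (suc q) h = begin
    detᶜ C
      ≡⟨ sum-cong-≗ (λ i → cong (-1ℤ ^ toℕ i * C zero i *_)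
           (antisymmetric A (minor C′ i) (minor C i) zero (suc q) (λ ())
             (λ _ → refl)
             (λ r → cong-app (updateAt-updates (suc (suc q)) (C [ suc zero ]≔ C (suc (suc q)))) (punchIn i r))
             (λ j j≢0 j≢q r → cong-app (trans (updateAt-minimal (suc j) (suc (suc q)) (C [ suc zero ]≔ C (suc (suc q))) (λ { refl → j≢q refl }))
                                              (updateAt-minimal (suc j) (suc zero) C (λ { refl → j≢0 refl }))) (punchIn i r)))) ⟩
    ∑[ i < suc (suc n) ] (-1ℤ ^ toℕ i * C zero i * - detᶜ (minor C′ i))
      ≡⟨ sum-cong-≗ (λ i → negate-term (-1ℤ ^ toℕ i * C zero i) (detᶜ (minor C′ i))) ⟩
    ∑[ i < suc (suc n) ] (-1ℤ * (-1ℤ ^ toℕ i * C zero i * detᶜ (minor C′ i)))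
      ≡⟨ *-distribˡ-sum -1ℤ (λ i → -1ℤ ^ toℕ i * C zero i * detᶜ (minor C′ i)) ⟨
    -1ℤ * detᶜ C′
      ≡⟨ cong (-1ℤ *_) (adjacent C′ h) ⟩
    0ℤ ∎
    where
    C′ : Columns (suc (suc n)) (suc (suc n))
    C′ = C [ suc zero ]≔ C (suc (suc q)) [ suc (suc q) ]≔ C (suc zero)
    negate-term : ∀ a b → a * - b ≡ -1ℤ * (a * b)
    negate-term = solve-∀

  alt : ∀ C p q → p ≢ q → C p ≗ C q → detᶜ C ≡ 0ℤ
  alt C zero    zero    p≢q h = contradiction refl p≢q
  alt C zero    (suc q) p≢q h = first C detᶜ-isAlternating q h
  alt C (suc p) zero    p≢q h = first C detᶜ-isAlternating p (sym ∘ h)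
  alt C (suc p) (suc q) p≢q h = sum-zero _ λ i → trans
    (cong (-1ℤ ^ toℕ i * C zero i *_)
      (alternates detᶜ-isAlternating (minor C i) p q (λ { refl → p≢q refl }) (h ∘ punchIn i)))
    (ℤ.*-zeroʳ (-1ℤ ^ toℕ i * C zero i))

-- Uniqueness of alternating forms and expansion along the last row

punch-view : ∀ (i r : Fin (suc n)) → i ≡ r ⊎ ∃[ j ] punchIn i j ≡ r
punch-view i r with i ≟ r
... | yes i≡r = inj₁ i≡r
... | no  i≢r = inj₂ (punchOut i≢r , punchIn-punchOut i≢r)

δ-refl : (i : Fin n) → δ i i ≡ 1ℤ
δ-refl i = cong (if_then 1ℤ else 0ℤ) (dec-true (i ≟ i) refl)

δ-≢ : {i j : Fin n} → i ≢ j → δ i j ≡ 0ℤ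
δ-≢ {i = i} {j} i≢j = cong (if_then 1ℤ else 0ℤ) (dec-false (i ≟ j) i≢j)

δ-punchIn : ∀ (i : Fin (suc n)) j r → δ (punchIn i j) (punchIn i r) ≡ δ j r
δ-punchIn i j r with j ≟ r
... | yes refl = δ-refl (punchIn i j)
... | no j≢r   = δ-≢ (j≢r ∘ punchIn-injective i j r)

sum-single : ∀ (f : Vector ℤ n) i → (∀ j → i ≢ j → f j ≡ 0ℤ) → sum f ≡ f i
sum-single {suc n} f i h = begin
  sum f                          ≡⟨ sum-remove {i = i} f ⟩
  f i + sum (removeAt f i)       ≡⟨ cong (_+_ (f i)) (sum-zero _ λ j → h (punchIn i j) (≢-sym (punchInᵢ≢i i j))) ⟩
  f i + 0ℤ                       ≡⟨ ℤ.+-identityʳ (f i) ⟩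
  f i                            ∎
  where open ≡-Reasoning

sum-δ : ∀ (f : Vector ℤ n) i → ∑[ j < n ] (f j * δ j i) ≡ f i
sum-δ f i = trans
  (sum-single (λ j → f j * δ j i) i λ j i≢j → trans (cong (f j *_) (δ-≢ (≢-sym i≢j))) (ℤ.*-zeroʳ (f j)))
  (trans (cong (f i *_) (δ-refl i)) (ℤ.*-identityʳ (f i)))

-- If replacing one column by an `R`-related one never changes the form, all columns may be
-- replaced: the tail is handled by induction with the head fixed. In `det-unique` this clears a
-- whole row at once.
replace-all : ∀ {f : Columns m n → ℤ} (R : Vector ℤ m → Vector ℤ m → Set) → IsAlternating f →
  (∀ C q {y} → R (C q) y → f (C [ q ]≔ y) ≡ f C) →
  ∀ A B → (∀ c → R (A c) (B c)) → f B ≡ f A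
replace-all {n = zero}  R alt step A B h = respects alt λ ()
replace-all {n = suc n} {f} R alt step A B h = begin
  f B
    ≡⟨ respects alt (λ { zero _ → refl ; (suc j) _ → refl }) ⟩
  f (B zero Vector.∷ (B ∘ suc))
    ≡⟨ replace-all R (∷-isAlternating alt (B zero))
         (λ C q {y} r → trans (sym (respects alt (∷-≔ (B zero) C q y))) (step (B zero Vector.∷ C) (suc q) r))
         (A ∘ suc) (B ∘ suc) (h ∘ suc) ⟩
  f (B zero Vector.∷ (A ∘ suc))
    ≡⟨ respects alt (λ { zero _ → refl ; (suc j) _ → refl }) ⟩
  f (A [ zero ]≔ B zero)
    ≡⟨ step A zero (h zero) ⟩
  f A ∎
  where open ≡-Reasoning

-- Column `i` passes the `i` columns before it, and each exchange contributes -1. This is where the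
-- sign of the Laplace expansion comes from.
move-to-front : ∀ {f : Columns m (suc n) → ℤ} → IsAlternating f →
  ∀ C i → f (C i Vector.∷ removeAt C i) ≡ -1ℤ ^ toℕ i * f C
move-to-front {f = f} alt C zero = trans
  (respects alt λ { zero _ → refl ; (suc j) _ → refl }) (sym (ℤ.*-identityˡ (f C)))
move-to-front {n = suc n} {f} alt C (suc i) = begin
  f (C (suc i) Vector.∷ removeAt C (suc i))
    ≡⟨ antisymmetric alt (C zero Vector.∷ D) (C (suc i) Vector.∷ removeAt C (suc i)) zero (suc zero) (λ ())
         (λ _ → refl) (λ _ → refl)
         (λ { zero 0≢0 _ → contradiction refl 0≢0
            ; (suc zero) _ 1≢1 → contradiction refl 1≢1
            ; (suc (suc j)) _ _ _ → refl }) ⟩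
  - f (C zero Vector.∷ D)
    ≡⟨ cong -_ (move-to-front (∷-isAlternating alt (C zero)) (C ∘ suc) i) ⟩
  - (-1ℤ ^ toℕ i * f (C zero Vector.∷ (C ∘ suc)))
    ≡⟨ cong (λ a → - (-1ℤ ^ toℕ i * a)) (respects alt λ { zero _ → refl ; (suc j) _ → refl }) ⟩
  - (-1ℤ ^ toℕ i * f C)
    ≡⟨ negate-product (-1ℤ ^ toℕ i) (f C) ⟩
  -1ℤ ^ toℕ (suc i) * f C ∎
  where
  open ≡-Reasoning
  D : Columns _ (suc n)
  D = C (suc i) Vector.∷ removeAt (C ∘ suc) i
  negate-product : ∀ a b → - (a * b) ≡ -1ℤ * a * b
  negate-product = solve-∀

-- Expand the first column in unit vectors eᵢ and clear row i by column
-- operations; what remains is an alternating form of the i-th minor.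
det-unique : ∀ {f : Columns n n → ℤ} → IsAlternating f → ∀ C → f C ≡ detᶜ C * f δ
det-unique {zero}  {f} alt C = trans (respects alt λ ()) (sym (ℤ.*-identityˡ (f δ)))
det-unique {suc n} {f} alt C = begin
  f C
    ≡⟨ respects alt (λ { zero i → sym (sum-δ (C zero) i) ; (suc j) i → refl }) ⟩
  f (C [ zero ]≔ linComb (C zero) δ)
    ≡⟨ linear-sum alt C zero (C zero) δ ⟩
  ∑[ i < suc n ] (C zero i * f (C [ zero ]≔ δ i))
    ≡⟨ sum-cong-≗ (λ i → trans (cong (C zero i *_) (unit-column i))
         (regroup (C zero i) (detᶜ (minor C i)) (-1ℤ ^ toℕ i) (f δ))) ⟩
  ∑[ i < suc n ] (-1ℤ ^ toℕ i * C zero i * detᶜ (minor C i) * f δ)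
    ≡⟨ *-distribʳ-sum (f δ) (λ i → -1ℤ ^ toℕ i * C zero i * detᶜ (minor C i)) ⟨
  detᶜ C * f δ ∎
  where
  open ≡-Reasoning
  regroup : ∀ a d s u → a * (d * (s * u)) ≡ s * a * d * u
  regroup = solve-∀
  module _ (i : Fin (suc n)) where
    cleared : Columns (suc n) n
    cleared c = insertAt (minor C i c) i 0ℤ

    Sheared : Vector ℤ (suc n) → Vector ℤ (suc n) → Set
    Sheared x y = ∃[ t ] ∀ r → y r ≡ x r + t * δ i r

    shear-step : ∀ D q {y} → Sheared (D q) y → f (δ i Vector.∷ (D [ q ]≔ y)) ≡ f (δ i Vector.∷ D)
    shear-step D q {y} (t , h) = begin
      f (δ i Vector.∷ (D [ q ]≔ y))               ≡⟨ respects alt (∷-≔ (δ i) D q y) ⟨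
      f ((δ i Vector.∷ D) [ suc q ]≔ y)           ≡⟨ respects alt (≔-cong (δ i Vector.∷ D) (suc q) h) ⟩
      f ((δ i Vector.∷ D) [ suc q ]≔ λ r → D q r + t * δ i r)
                                                  ≡⟨ shear alt (δ i Vector.∷ D) zero (suc q) t (λ ()) ⟩
      f (δ i Vector.∷ D)                          ∎

    clear : ∀ c r → C (suc c) r ≡ cleared c r + C (suc c) i * δ i r
    clear c r with punch-view i r
    ... | inj₁ refl = sym (trans
      (cong₂ (λ a b → a + C (suc c) i * b) (insertAt-lookup (minor C i c) i 0ℤ) (δ-refl i))
      (trans (ℤ.+-identityˡ _) (ℤ.*-identityʳ _)))
    ... | inj₂ (j , refl) = sym (trans
      (cong₂ (λ a b → a + C (suc c) i * b) (insertAt-punchIn (minor C i c) i 0ℤ j) (δ-≢ (≢-sym (punchInᵢ≢i i j))))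
      (trans (cong (_+_ (C (suc c) (punchIn i j))) (ℤ.*-zeroʳ (C (suc c) i))) (ℤ.+-identityʳ _)))

    insert-δ : ∀ j r → insertAt (δ j) i 0ℤ r ≡ δ (punchIn i j) r
    insert-δ j r with punch-view i r
    ... | inj₁ refl       = trans (insertAt-lookup (δ j) i 0ℤ) (sym (δ-≢ (punchInᵢ≢i i j)))
    ... | inj₂ (k , refl) = trans (insertAt-punchIn (δ j) i 0ℤ k) (sym (δ-punchIn i j k))

    unit-column : f (C [ zero ]≔ δ i) ≡ detᶜ (minor C i) * (-1ℤ ^ toℕ i * f δ)
    unit-column = begin
      f (C [ zero ]≔ δ i)
        ≡⟨ respects alt (λ { zero _ → refl ; (suc j) _ → refl }) ⟩
      f (δ i Vector.∷ (C ∘ suc))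
        ≡⟨ replace-all Sheared (∷-isAlternating alt (δ i)) shear-step cleared (C ∘ suc)
             (λ c → C (suc c) i , clear c) ⟩
      f (δ i Vector.∷ cleared)
        -- Induction applies to the form that inserts a zero row at `i` and prepends `δ i`. Its
        -- value at the unit columns is `f` at `δ` with column `i` moved to the front.
        ≡⟨ det-unique (map-isAlternating (∷-isAlternating alt (δ i)) (insertZero-isLinear i)) (minor C i) ⟩
      detᶜ (minor C i) * f (δ i Vector.∷ λ j → insertAt (δ j) i 0ℤ)
        ≡⟨ cong (detᶜ (minor C i) *_) (respects alt (∷-cong (λ _ → refl) insert-δ)) ⟩
      detᶜ (minor C i) * f (δ i Vector.∷ removeAt δ i)
        ≡⟨ cong (detᶜ (minor C i) *_) (move-to-front alt δ i) ⟩
      detᶜ (minor C i) * (-1ℤ ^ toℕ i * f δ) ∎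

det-δ : ∀ n → detᶜ {n} δ ≡ 1ℤ
det-δ zero    = refl
det-δ (suc n) = trans
  (sum-single (λ i → -1ℤ ^ toℕ i * δ {suc n} zero i * detᶜ (minor δ i)) zero λ i 0≢i →
    trans (cong (λ a → -1ℤ ^ toℕ i * a * detᶜ (minor δ i)) (δ-≢ 0≢i)) (vanish (-1ℤ ^ toℕ i) (detᶜ (minor δ i))))
  (trans (ℤ.*-identityˡ (detᶜ {n} δ)) (det-δ n))
  where
  vanish : ∀ a b → a * 0ℤ * b ≡ 0ℤ
  vanish = solve-∀

-- The expansion runs along the first column, so the last row is reached by induction on the size:
-- the term of the last row vanishes, and every other minor keeps a last row of the same shape.
det-last-row : ∀ n (C : Columns (suc n) (suc n)) → (∀ j → C (inject₁ j) (fromℕ n) ≡ 0ℤ) →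
  detᶜ C ≡ C (fromℕ n) (fromℕ n) * detᶜ {n} (λ j i → C (inject₁ j) (inject₁ i))
det-last-row zero    C h = swap-unit (C zero zero)
  where
  swap-unit : ∀ a → 1ℤ * a * 1ℤ + 0ℤ ≡ a * 1ℤ
  swap-unit = solve-∀
det-last-row (suc n) C h = begin
  detᶜ C
    ≡⟨ sum-init-last (λ i → -1ℤ ^ toℕ i * C zero i * detᶜ (minor C i)) ⟩
  ∑[ i < suc n ] (-1ℤ ^ toℕ (inject₁ i) * C zero (inject₁ i) * detᶜ (minor C (inject₁ i)))
    + -1ℤ ^ toℕ (fromℕ (suc n)) * C zero (fromℕ (suc n)) * detᶜ (minor C (fromℕ (suc n)))
    ≡⟨ cong₂ _+_ (sum-cong-≗ term)
         (trans (cong (λ a → -1ℤ ^ toℕ (fromℕ (suc n)) * a * detᶜ (minor C (fromℕ (suc n)))) (h zero))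
           (vanish (-1ℤ ^ toℕ (fromℕ (suc n))) (detᶜ (minor C (fromℕ (suc n)))))) ⟩
  ∑[ i < suc n ] (corner-entry * (-1ℤ ^ toℕ i * C zero (inject₁ i) * detᶜ (minor block i))) + 0ℤ
    ≡⟨ ℤ.+-identityʳ _ ⟩
  ∑[ i < suc n ] (corner-entry * (-1ℤ ^ toℕ i * C zero (inject₁ i) * detᶜ (minor block i)))
    ≡⟨ *-distribˡ-sum corner-entry (λ i → -1ℤ ^ toℕ i * C zero (inject₁ i) * detᶜ (minor block i)) ⟨
  corner-entry * detᶜ block ∎
  where
  open ≡-Reasoning
  corner-entry : ℤ
  corner-entry = C (fromℕ (suc n)) (fromℕ (suc n))
  block : Columns (suc n) (suc n)
  block j i = C (inject₁ j) (inject₁ i)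
  vanish : ∀ a b → a * 0ℤ * b ≡ 0ℤ
  vanish = solve-∀
  pull : ∀ s c d → s * (c * d) ≡ c * (s * d)
  pull = solve-∀
  punchIn-last : ∀ {n} (i : Fin (suc n)) → punchIn (inject₁ i) (fromℕ n) ≡ fromℕ (suc n)
  punchIn-last zero = refl
  punchIn-last {suc n} (suc i) = cong suc (punchIn-last i)
  punchIn-inject₁ : ∀ {n} (i : Fin (suc n)) (r : Fin n) → punchIn (inject₁ i) (inject₁ r) ≡ inject₁ (punchIn i r)
  punchIn-inject₁ zero    r       = refl
  punchIn-inject₁ (suc i) zero    = refl
  punchIn-inject₁ (suc i) (suc r) = cong suc (punchIn-inject₁ i r)
  minor-expansion : ∀ i → detᶜ (minor C (inject₁ i)) ≡ corner-entry * detᶜ (minor block i)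
  minor-expansion i = trans
    (det-last-row n (minor C (inject₁ i)) λ j → trans (cong (C (suc (inject₁ j))) (punchIn-last i)) (h (suc j)))
    (cong₂ _*_ (cong (C (fromℕ (suc n))) (punchIn-last i))
      (det-cong λ r c → cong (C (suc (inject₁ c))) (punchIn-inject₁ i r)))
  term : ∀ i → -1ℤ ^ toℕ (inject₁ i) * C zero (inject₁ i) * detᶜ (minor C (inject₁ i))
             ≡ corner-entry * (-1ℤ ^ toℕ i * C zero (inject₁ i) * detᶜ (minor block i))
  term i = trans
    (cong₂ (λ a b → -1ℤ ^ a * C zero (inject₁ i) * b) (toℕ-inject₁ i) (minor-expansion i))
    (pull (-1ℤ ^ toℕ i * C zero (inject₁ i)) corner-entry (detᶜ (minor block i)))

-- Signs and column operations

opposite-◃ : ∀ s a → (s ◃ 1) * - a ≡ (opposite s ◃ 1) * a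
opposite-◃ Sign.+ = move
  where
  move : ∀ a → 1ℤ * - a ≡ -1ℤ * a
  move = solve-∀
opposite-◃ Sign.- = move
  where
  move : ∀ a → -1ℤ * - a ≡ 1ℤ * a
  move = solve-∀

◃-involutive : ∀ s → (s ◃ 1) * (s ◃ 1) ≡ 1ℤ
◃-involutive Sign.+ = refl
◃-involutive Sign.- = refl

unit⇒sign : ∀ a b → a * b ≡ 1ℤ → ∃[ s ] a ≡ s ◃ 1
unit⇒sign a b ab≡1 = sign a , trans (sym (ℤ.◃-inverse a))
  (cong (sign a ◃_) (ℕ.m*n≡1⇒m≡1 ∣ a ∣ ∣ b ∣ (trans (sym (ℤ.abs-* a b)) (cong ∣_∣ ab≡1))))

detᶜ-cong : ∀ (C D : Columns n n) → C ≈ D → detᶜ C ≡ detᶜ D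
detᶜ-cong C D h = det-cong {M = λ i j → C j i} {N = λ i j → D j i} λ i j → h j i

columnsOf : Matrix m n → Columns m n
columnsOf M j i = M i j

updateAt-columns : ∀ (M : Matrix m n) q (f : Fin m → ℤ → ℤ) →
  columnsOf (λ i → updateAt (M i) q (f i)) ≈ columnsOf M [ q ]≔ (λ i → f i (M i q))
updateAt-columns M zero    f zero    i = refl
updateAt-columns M zero    f (suc j) i = refl
updateAt-columns M (suc q) f zero    i = refl
updateAt-columns M (suc q) f (suc j) i = updateAt-columns (λ i → M i ∘ suc) q f j i

transpose-first : ∀ (p q : Fin n) → transpose p q p ≡ q
transpose-first p q rewrite dec-true (p ≟ p) refl = refl

transpose-second : ∀ (p q : Fin n) → p ≢ q → transpose p q q ≡ p
transpose-second p q p≢q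
  rewrite dec-false (q ≟ p) (≢-sym p≢q) | dec-true (q ≟ q) refl = refl

transpose-other : ∀ (p q j : Fin n) → j ≢ p → j ≢ q → transpose p q j ≡ j
transpose-other p q j j≢p j≢q
  rewrite dec-false (j ≟ p) j≢p | dec-false (j ≟ q) j≢q = refl

-- Stated for any alternating form on the block, so that it covers a determinant with one further
-- column that the operations do not touch.
columnOps-det : ∀ {f : Columns m n → ℤ} {s M N} → IsAlternating f → ColumnOps s M N →
                f (columnsOf N) ≡ (s ◃ 1) * f (columnsOf M)
columnOps-det {f = f} {M = M} alt (done h) =
  trans (respects alt λ j i → sym (h i j)) (sym (ℤ.*-identityˡ (f (columnsOf M))))
columnOps-det {s = s} {M} alt (add p q c p≢q ops) = trans (columnOps-det alt ops)
  (cong ((s ◃ 1) *_) (trans (respects alt (updateAt-columns M q λ i → _+ c * M i p))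
    (shear alt (columnsOf M) p q c p≢q)))
columnOps-det {f = f} {M = M} alt (swap {s = s} p q p≢q ops) = trans (columnOps-det alt ops)
  (trans (cong ((s ◃ 1) *_) (antisymmetric alt (columnsOf M) (columnsOf (swapColumns p q M)) p q p≢q
      (λ i → cong (M i) (sym (transpose-second p q p≢q)))
      (λ i → cong (M i) (sym (transpose-first p q)))
      (λ j j≢p j≢q i → cong (M i) (sym (transpose-other p q j j≢p j≢q)))))
    (opposite-◃ s (f (columnsOf M))))
columnOps-det {f = f} {M = M} alt (negate {s = s} p ops) = trans (columnOps-det alt ops)
  (trans (cong ((s ◃ 1) *_) (trans (respects alt (updateAt-columns M p λ i x → - x))
      (negated alt (columnsOf M) p λ _ → refl)))
    (opposite-◃ s (f (columnsOf M))))

-- Coordinates, winding numbers and change of basis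

linComb-δ : ∀ (X : Columns m n) j → linComb (δ j) X ≗ X j
linComb-δ X j i = trans (sum-single (λ k → δ j k * X k i) j λ k j≢k → cong (_* X k i) (δ-≢ j≢k))
  (trans (cong (_* X j i) (δ-refl j)) (ℤ.*-identityˡ (X j i)))

-- Associativity of the matrix product: the two summations are interchanged.
linComb-linComb : ∀ (c : Vector ℤ k) (P : Columns n k) (X : Columns m n) →
                  linComb c (λ j → linComb (P j) X) ≗ linComb (linComb c P) X
linComb-linComb {k = k} {n = n} c P X i = begin
  ∑[ j < k ] (c j * ∑[ l < n ] (P j l * X l i))
    ≡⟨ sum-cong-≗ (λ j → trans (*-distribˡ-sum (c j) λ l → P j l * X l i)
         (sum-cong-≗ λ l → sym (ℤ.*-assoc (c j) (P j l) (X l i)))) ⟩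
  ∑[ j < k ] ∑[ l < n ] (c j * P j l * X l i)
    ≡⟨ ∑-comm (λ j l → c j * P j l * X l i) ⟩
  ∑[ l < n ] ∑[ j < k ] (c j * P j l * X l i)
    ≡⟨ sum-cong-≗ (λ l → sym (*-distribʳ-sum (X l i) λ j → c j * P j l)) ⟩
  linComb (linComb c P) X i ∎
  where open ≡-Reasoning

module _ {G : Graph v e} where

  coords-spec : (β : Basis G m) → ∀ z → vec z ≗ linComb (coords β z) (vec ∘ elt β)
  coords-spec β z = proj₂ (spanning β z)

  linComb-injective : (β : Basis G m) → ∀ {c d} →
                      linComb c (vec ∘ elt β) ≗ linComb d (vec ∘ elt β) → c ≗ d
  linComb-injective β {c} {d} h j = ℤ.i-j≡0⇒i≡j (c j) (d j) (trans (as-lin (c j) (d j))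
    (independent β (lin 1ℤ -1ℤ c d) (λ i → trans
      (preserves-lin (linComb-isLinear (vec ∘ elt β)) 1ℤ -1ℤ c d i)
      (trans (cong (λ a → 1ℤ * a + -1ℤ * linComb d (vec ∘ elt β) i) (h i))
        (cancel (linComb d (vec ∘ elt β) i)))) j))
    where
    as-lin : ∀ a b → a - b ≡ 1ℤ * a + -1ℤ * b
    as-lin = solve-∀
    cancel : ∀ a → 1ℤ * a + -1ℤ * a ≡ 0ℤ
    cancel = solve-∀

  -- `coords` is merely the witness supplied by `spanning`; independence pins it down. The
  -- identities between coordinates below rest on this.
  coords-unique : (β : Basis G m) → ∀ z c → vec z ≗ linComb c (vec ∘ elt β) → coords β z ≗ c
  coords-unique β z c h = linComb-injective β λ i → trans (sym (coords-spec β z i)) (h i)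

  coords-linComb : (β : Basis G m) → ∀ z c (x : Vector (Z₁ G) k) → vec z ≗ linComb c (vec ∘ x) →
                   coords β z ≗ linComb c (coords β ∘ x)
  coords-linComb β z c x h = coords-unique β z (linComb c (coords β ∘ x)) λ i → begin
    vec z i                                                       ≡⟨ h i ⟩
    linComb c (vec ∘ x) i                                         ≡⟨ sum-cong-≗ (λ j → cong (c j *_) (coords-spec β (x j) i)) ⟩
    linComb c (λ j → linComb (coords β (x j)) (vec ∘ elt β)) i    ≡⟨ linComb-linComb c (coords β ∘ x) (vec ∘ elt β) i ⟩
    linComb (linComb c (coords β ∘ x)) (vec ∘ elt β) i            ∎
    where open ≡-Reasoning

  coords-scale : (β : Basis G m) → ∀ a y z → (∀ i → vec z i ≡ a * vec y i) → ∀ j → coords β z j ≡ a * coords β y j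
  coords-scale β a y z h j = trans
    (coords-linComb β z (λ (_ : Fin 1) → a) (λ _ → y) (λ i → trans (h i) (sym (ℤ.+-identityʳ _))) j)
    (ℤ.+-identityʳ _)

  coords-cong : (β : Basis G m) → ∀ y z → vec y ≗ vec z → coords β y ≗ coords β z
  coords-cong β y z h = coords-unique β y (coords β z) λ i → trans (h i) (coords-spec β z i)

  -- Up to sign, the index in `Z₁ G` of the subgroup spanned by the tuple, or zero when that index
  -- is infinite.
  volume : Basis G m → Vector (Z₁ G) m → ℤ
  volume β z = detᶜ (coords β ∘ z)

  windingColumns : Basis G (suc k) → Vector (Z₁ G) k → Z₁ G → Columns (suc k) (suc k)
  windingColumns β ∂ z = coords β z Vector.∷ (coords β ∘ ∂)

  winding-as-form : (β : Basis G (suc k)) (∂ : Vector (Z₁ G) k) → ∀ z →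
    winding β ∂ z ≡ detᶜ (windingColumns β ∂ z)
  winding-as-form β ∂ z = detᶜ-cong (columnsOf λ i → coords β z i Vector.∷ λ j → coords β (∂ j) i)
    (windingColumns β ∂ z) λ { zero _ → refl ; (suc j) _ → refl }

  winding-volume : (β : Basis G (suc k)) (∂ : Vector (Z₁ G) k) → ∀ z → winding β ∂ z ≡ volume β (z Vector.∷ ∂)
  winding-volume β ∂ z = trans (winding-as-form β ∂ z) (detᶜ-cong (windingColumns β ∂ z)
    (coords β ∘ (z Vector.∷ ∂)) λ { zero _ → refl ; (suc j) _ → refl })

  winding-linComb : (β : Basis G (suc k)) (∂ : Vector (Z₁ G) k) → ∀ z c (x : Vector (Z₁ G) n) →
    vec z ≗ linComb c (vec ∘ x) → winding β ∂ z ≡ ∑[ j < n ] (c j * winding β ∂ (x j))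
  winding-linComb β ∂ z c x h = begin
    winding β ∂ z
      ≡⟨ winding-as-form β ∂ z ⟩
    detᶜ C
      ≡⟨ detᶜ-cong C (C [ zero ]≔ linComb c (coords β ∘ x))
           (λ { zero → coords-linComb β z c x h ; (suc j) _ → refl }) ⟩
    detᶜ (C [ zero ]≔ linComb c (coords β ∘ x))
      ≡⟨ linear-sum detᶜ-isAlternating C zero c (coords β ∘ x) ⟩
    sum (λ j → c j * detᶜ (C [ zero ]≔ coords β (x j)))
      ≡⟨ sum-cong-≗ (λ j → cong (c j *_) (trans
           (detᶜ-cong (C [ zero ]≔ coords β (x j)) (windingColumns β ∂ (x j))
             λ { zero _ → refl ; (suc l) _ → refl })
           (sym (winding-as-form β ∂ (x j))))) ⟩
    sum (λ j → c j * winding β ∂ (x j)) ∎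
    where
    open ≡-Reasoning
    C : Columns _ _
    C = windingColumns β ∂ z

  winding-scale : (β : Basis G (suc k)) (∂ : Vector (Z₁ G) k) → ∀ a y z → (∀ i → vec z i ≡ a * vec y i) →
                  winding β ∂ z ≡ a * winding β ∂ y
  winding-scale β ∂ a y z h = trans
    (winding-linComb β ∂ z (λ (_ : Fin 1) → a) (λ _ → y) (λ i → trans (h i) (sym (ℤ.+-identityʳ _))))
    (ℤ.+-identityʳ _)

  -- The column is repeated in the determinant. With linearity, the winding number therefore depends
  -- only on the class modulo the image of ∂.
  winding-column : (β : Basis G (suc k)) (∂ : Vector (Z₁ G) k) → ∀ j → winding β ∂ (∂ j) ≡ 0ℤ
  winding-column β ∂ j = trans (winding-as-form β ∂ (∂ j))
    (alternates detᶜ-isAlternating (windingColumns β ∂ (∂ j)) zero (suc j) (λ ()) λ _ → refl)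

  -- Multiplicativity of the determinant: C ↦ det (C · P) is an alternating form, hence det C times
  -- its value at the unit columns, which is the determinant of the transition matrix `P`.
  change-of-basis : (β β′ : Basis G m) → ∃[ u ] ∀ z → volume β′ z ≡ volume β z * u
  change-of-basis β β′ = detᶜ (λ j → linComb (δ j) P) , λ z → trans
    (respects detᶜ-isAlternating λ j → coords-linComb β′ (z j) (coords β (z j)) (elt β) (coords-spec β (z j)))
    (det-unique (map-isAlternating detᶜ-isAlternating (linComb-isLinear P)) (coords β ∘ z))
    where
    P : Columns _ _
    P = coords β′ ∘ elt β

  volume-basis : (β : Basis G m) → volume β (elt β) ≡ 1ℤ
  volume-basis {m} β = trans
    (respects detᶜ-isAlternating λ j → coords-unique β (elt β j) (δ j) (sym ∘ linComb-δ (vec ∘ elt β) j))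
    (det-δ m)

  -- Both changes are evaluated on the elements of β itself: the volume starts as 1, becomes `u`,
  -- and then `u * u′`, which is again the volume relative to β.
  volume-basis-unit : (β β′ : Basis G m) →
                      proj₁ (change-of-basis β β′) * proj₁ (change-of-basis β′ β) ≡ 1ℤ
  volume-basis-unit β β′ = begin
    u * u′                             ≡⟨ cong (_* u′) (ℤ.*-identityˡ u) ⟨
    1ℤ * u * u′                        ≡⟨ cong (λ a → a * u * u′) (volume-basis β) ⟨
    volume β (elt β) * u * u′          ≡⟨ cong (_* u′) (proj₂ (change-of-basis β β′) (elt β)) ⟨
    volume β′ (elt β) * u′             ≡⟨ proj₂ (change-of-basis β′ β) (elt β) ⟨
    volume β (elt β)                   ≡⟨ volume-basis β ⟩
    1ℤ                                 ∎
    where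
    open ≡-Reasoning
    u u′ : ℤ
    u  = proj₁ (change-of-basis β β′)
    u′ = proj₁ (change-of-basis β′ β)

  winding-basis : (β β′ : Basis G (suc k)) (∂ : Vector (Z₁ G) k) →
                  ∃[ s ] ∀ z → winding β ∂ z ≡ (s ◃ 1) * winding β′ ∂ z
  winding-basis β β′ ∂ = proj₁ unit , λ z → begin
    winding β ∂ z                                  ≡⟨ winding-volume β ∂ z ⟩
    volume β (z Vector.∷ ∂)                        ≡⟨ proj₂ (change-of-basis β′ β) (z Vector.∷ ∂) ⟩
    volume β′ (z Vector.∷ ∂) * u                   ≡⟨ cong₂ _*_ (winding-volume β′ ∂ z) (sym (proj₂ unit)) ⟨
    winding β′ ∂ z * (proj₁ unit ◃ 1)              ≡⟨ ℤ.*-comm (winding β′ ∂ z) (proj₁ unit ◃ 1) ⟩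
    (proj₁ unit ◃ 1) * winding β′ ∂ z              ∎
    where
    open ≡-Reasoning
    u : ℤ
    u = proj₁ (change-of-basis β′ β)
    unit : ∃[ s ] u ≡ s ◃ 1
    unit = unit⇒sign u (proj₁ (change-of-basis β β′)) (volume-basis-unit β′ β)

-- Cycles and the cycle space

module _ (G : Graph v e) where

  boundary-cong : ∀ {x y} → x ≗ y → boundary G x ≗ boundary G y
  boundary-cong h u = sum-cong-≗ λ i → cong (∂₁ G u i *_) (h i)

  boundary-lin : ∀ a b x y → boundary G (lin a b x y) ≗ lin a b (boundary G x) (boundary G y)
  boundary-lin a b x y u = trans
    (sum-cong-≗ λ i → expand (∂₁ G u i) a b (x i) (y i))
    (sum-linear a b (λ i → ∂₁ G u i * x i) (λ i → ∂₁ G u i * y i))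
    where
    expand : ∀ d a b x y → d * (a * x + b * y) ≡ a * (d * x) + b * (d * y)
    expand = solve-∀

  boundary-zero : ∀ {x} → (∀ i → x i ≡ 0ℤ) → ∀ u → boundary G x u ≡ 0ℤ
  boundary-zero h u = sum-zero _ λ i → trans (cong (∂₁ G u i *_) (h i)) (ℤ.*-zeroʳ (∂₁ G u i))

  boundary-δ : ∀ j u → boundary G (δ j) u ≡ ∂₁ G u j
  boundary-δ j u = trans
    (sum-single (λ i → ∂₁ G u i * δ j i) j λ i j≢i → trans (cong (∂₁ G u i *_) (δ-≢ j≢i)) (ℤ.*-zeroʳ (∂₁ G u i)))
    (trans (cong (∂₁ G u j *_) (δ-refl j)) (ℤ.*-identityʳ (∂₁ G u j)))

  lin-closed : ∀ a b {x y} → InKernel G x → InKernel G y → InKernel G (lin a b x y)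
  lin-closed a b {x} {y} hx hy u = trans (boundary-lin a b x y u)
    (trans (cong₂ (λ c d → a * c + b * d) (hx u) (hy u)) (cong₂ _+_ (ℤ.*-zeroʳ a) (ℤ.*-zeroʳ b)))

  -- The sum telescopes: each arc contributes δ at its end minus δ at its start, in whichever
  -- direction the edge is traversed.
  walk-boundary : ∀ {x y} as → IsWalk G x as y → ∀ u → boundary G (cycleVec as) u ≡ δ u y - δ u x
  walk-boundary {x} [] refl u = trans (boundary-zero (λ _ → refl) u) (sym (ℤ.+-inverseʳ (δ u x)))
  walk-boundary {x} {y} ((j , s) ∷ as) (refl , w) u = begin
    boundary G (cycleVec ((j , s) ∷ as)) u
      ≡⟨ boundary-cong (λ i → cong (_+_ ((s ◃ 1) * δ j i)) (sym (ℤ.*-identityˡ (cycleVec as i)))) u ⟩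
    boundary G (lin (s ◃ 1) 1ℤ (δ j) (cycleVec as)) u
      ≡⟨ boundary-lin (s ◃ 1) 1ℤ (δ j) (cycleVec as) u ⟩
    (s ◃ 1) * boundary G (δ j) u + 1ℤ * boundary G (cycleVec as) u
      ≡⟨ cong₂ (λ a b → (s ◃ 1) * a + 1ℤ * b) (boundary-δ j u) (walk-boundary as w u) ⟩
    (s ◃ 1) * ∂₁ G u j + 1ℤ * (δ u y - δ u (end G (j , s)))
      ≡⟨ telescope s ⟩
    δ u y - δ u (start G (j , s)) ∎
    where
    open ≡-Reasoning
    telescope₊ : ∀ a b c → 1ℤ * (a - b) + 1ℤ * (c - a) ≡ c - b
    telescope₊ = solve-∀
    telescope₋ : ∀ a b c → -1ℤ * (b - a) + 1ℤ * (c - a) ≡ c - b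
    telescope₋ = solve-∀
    telescope : ∀ s → (s ◃ 1) * ∂₁ G u j + 1ℤ * (δ u y - δ u (end G (j , s))) ≡ δ u y - δ u (start G (j , s))
    telescope Sign.+ = telescope₊ (δ u (tgt G j)) (δ u (src G j)) (δ u y)
    telescope Sign.- = telescope₋ (δ u (src G j)) (δ u (tgt G j)) (δ u y)

cycle-closed : {G : Graph v e} → ∀ as → IsCycle G as → InKernel G (cycleVec as)
cycle-closed {G = G} as (_ , (x , w) , _) u = trans (walk-boundary G as w u) (ℤ.+-inverseʳ (δ u x))

cycleVec-∉ : ∀ as {i : Fin e} → ¬ (i ∈ᴱ as) → cycleVec as i ≡ 0ℤ
cycleVec-∉ []             ∉ = refl
cycleVec-∉ ((j , s) ∷ as) ∉ = cong₂ _+_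
  (trans (cong ((s ◃ 1) *_) (δ-≢ λ j≡i → ∉ (here (sym j≡i)))) (ℤ.*-zeroʳ (s ◃ 1)))
  (cycleVec-∉ as (∉ ∘ there))

-- The edges are distinct, so exactly one arc contributes to the coefficient and nothing cancels.
cycleVec-∈ : ∀ as {i : Fin e} → Unique (edges as) → i ∈ᴱ as → ∃[ s ] cycleVec as i ≡ s ◃ 1
cycleVec-∈ ((j , s) ∷ as) (j∉ ∷ u) (here refl) = s , trans
  (cong₂ (λ a b → (s ◃ 1) * a + b) (δ-refl j) (cycleVec-∉ as (All.All¬⇒¬Any j∉)))
  (trans (ℤ.+-identityʳ _) (ℤ.*-identityʳ (s ◃ 1)))
cycleVec-∈ ((j , s) ∷ as) {i} (j∉ ∷ u) (there i∈) with cycleVec-∈ as u i∈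
... | t , eq = t , trans
  (cong₂ (λ a b → (s ◃ 1) * a + b) (δ-≢ (All.lookup j∉ i∈)) eq)
  (trans (cong (_+ (t ◃ 1)) (ℤ.*-zeroʳ (s ◃ 1))) (ℤ.+-identityˡ (t ◃ 1)))

-- Directed cycles in the support of a flow

sum-nonneg : (f : Vector ℤ n) → (∀ i → 0ℤ ≤ f i) → 0ℤ ≤ sum f
sum-nonneg {zero}  f h = ℤ.≤-refl
sum-nonneg {suc n} f h = ℤ.+-mono-≤ (h zero) (sum-nonneg (f ∘ suc) (h ∘ suc))

sum-nonneg-zero : (f : Vector ℤ n) → (∀ i → 0ℤ ≤ f i) → sum f ≡ 0ℤ → ∀ i → f i ≡ 0ℤ
sum-nonneg-zero {suc n} f h sum≡0 i = ℤ.≤-antisym (begin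
  f i                            ≡⟨ ℤ.+-identityʳ (f i) ⟨
  f i + 0ℤ                       ≤⟨ ℤ.+-monoʳ-≤ (f i) (sum-nonneg _ λ j → h (punchIn i j)) ⟩
  f i + sum (removeAt f i)       ≡⟨ sum-remove {i = i} f ⟨
  sum f                          ≡⟨ sum≡0 ⟩
  0ℤ                             ∎) (h i)
  where open ℤ.≤-Reasoning

unique-length : (xs : List (Fin n)) → Unique xs → length xs ℕ.≤ n
unique-length xs u = injective⇒≤ λ {i} {j} → lookup-injective xs u i j
  where
  lookup-injective : ∀ (xs : List (Fin n)) → Unique xs → ∀ i j → lookup xs i ≡ lookup xs j → i ≡ j
  lookup-injective (x ∷ xs) (x∉ ∷ u) zero    zero    eq = refl
  lookup-injective (x ∷ xs) (x∉ ∷ u) zero    (suc j) eq = contradiction eq (All.lookup x∉ (∈-lookup j))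
  lookup-injective (x ∷ xs) (x∉ ∷ u) (suc i) zero    eq = contradiction (sym eq) (All.lookup x∉ (∈-lookup i))
  lookup-injective (x ∷ xs) (x∉ ∷ u) (suc i) (suc j) eq = cong suc (lookup-injective xs u i j eq)

-- Every edge i with w i ≠ 0 is traversed in the direction of positive flow.
module _ {G : Graph v e} (w : Vector ℤ e) (w-closed : InKernel G w) where
  private
    arc : Fin e → Arc e
    arc i = i , sign (w i)

    initial : Fin e → Fin v
    initial i = start G (arc i)

    flow : ∀ u i → ∂₁ G u i * w i ≡ (δ u (end G (arc i)) - δ u (initial i)) * + ∣ w i ∣
    flow u i = directed (w i)
      where
      reverse : ∀ a b c → (a - b) * - c ≡ (b - a) * c
      reverse = solve-∀
      directed : ∀ a → ∂₁ G u i * a ≡ (δ u (end G (i , sign a)) - δ u (start G (i , sign a))) * + ∣ a ∣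
      directed (+ n)    = refl
      directed -[1+ n ] = reverse (δ u (tgt G i)) (δ u (src G i)) (+ suc n)

    -- If no positive flow entered the start vertex of `j`, conservation would force the total
    -- outflow there to vanish; being a sum of nonnegative terms, it would vanish on `j` as well.
    predecessor : ∀ j → w j ≢ 0ℤ → ∃[ i ] w i ≢ 0ℤ × end G (arc i) ≡ initial j
    predecessor j wj≢0 with any? (λ i → ¬? (w i ℤ.≟ 0ℤ) ×-dec (end G (arc i) ≟ initial j))
    ... | yes found = found
    ... | no none = contradiction (ℤ.∣i∣≡0⇒i≡0 (ℤ.+-injective (begin
      + ∣ w j ∣           ≡⟨ ℤ.*-identityˡ _ ⟨
      1ℤ * + ∣ w j ∣      ≡⟨ cong (_* + ∣ w j ∣) (δ-refl (initial j)) ⟨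
      outflow j           ≡⟨ sum-nonneg-zero outflow outflow-nonneg outflow-zero j ⟩
      0ℤ                  ∎))) wj≢0
      where
      open ≡-Reasoning
      outflow : Vector ℤ e
      outflow i = δ (initial j) (initial i) * + ∣ w i ∣
      outflow-nonneg : ∀ i → 0ℤ ≤ outflow i
      outflow-nonneg i with initial j ≟ initial i
      ... | yes _ = subst (0ℤ ≤_) (sym (ℤ.*-identityˡ (+ ∣ w i ∣))) (+≤+ ℕ.z≤n)
      ... | no _  = ℤ.≤-refl
      no-inflow : ∀ i → outflow i ≡ -1ℤ * (∂₁ G (initial j) i * w i)
      no-inflow i with w i ℤ.≟ 0ℤ
      ... | yes wi≡0 = trans (cong (λ a → δ (initial j) (initial i) * + ∣ a ∣) wi≡0)
        (trans (ℤ.*-zeroʳ (δ (initial j) (initial i)))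
          (sym (trans (cong (λ a → -1ℤ * (∂₁ G (initial j) i * a)) wi≡0) (cong (-1ℤ *_) (ℤ.*-zeroʳ (∂₁ G (initial j) i))))))
      ... | no wi≢0 = sym (trans (cong (-1ℤ *_) (flow (initial j) i))
        (trans (cong (λ a → -1ℤ * ((a - δ (initial j) (initial i)) * + ∣ w i ∣)) (δ-≢ λ eq → none (i , wi≢0 , sym eq)))
          (negate-twice (δ (initial j) (initial i)) (+ ∣ w i ∣))))
        where
        negate-twice : ∀ a b → -1ℤ * ((0ℤ - a) * b) ≡ a * b
        negate-twice = solve-∀
      outflow-zero : sum outflow ≡ 0ℤ
      outflow-zero = trans (sum-cong-≗ no-inflow)
        (trans (sym (*-distribˡ-sum -1ℤ λ i → ∂₁ G (initial j) i * w i)) (cong (-1ℤ *_) (w-closed (initial j))))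

    _∈ⱽ?_ : ∀ (x : Fin v) xs → Dec (x List∈.∈ xs)
    _∈ⱽ?_ = DecMembership._∈?_ _≟_

    -- Stops the walk where it first reaches `x` as a start vertex. The part kept does not depart
    -- from `x`, so an arc starting at `x` can be prepended without repeating a start vertex.
    cut : ∀ es {u y} x → IsWalk G u (List.map arc es) y → x List∈.∈ List.map initial es →
          ∃[ k ] IsWalk G u (List.map arc (take k es)) x × ¬ (x List∈.∈ List.map initial (take k es))
    cut (i ∷ es) x (u≡ , w) x∈ with x ≟ initial i | x∈
    ... | yes x≡ | _        = 0 , trans u≡ (sym x≡) , λ ()
    ... | no x≢  | here x≡  = contradiction x≡ x≢
    ... | no x≢  | there x∈ with cut es x w x∈
    ...   | k , w′ , x∉ = suc k , (u≡ , w′) , λ { (here x≡) → x≢ x≡ ; (there x∈′) → x∉ x∈′ }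

    Closing : List (Fin e) → Set
    Closing es = es ≢ [] × (∃[ x ] IsWalk G x (List.map arc es) x)
               × Unique (List.map initial es) × All (λ i → w i ≢ 0ℤ) es

    -- The walk grows backwards by predecessors until a start vertex repeats. The start vertices of
    -- `j ∷ es` are distinct, so there are at most `v` of them; with no fuel left, the last
    -- hypothesis would read v ≤ length es, one too few.
    extend : ∀ fuel j es {y} → IsWalk G (initial j) (List.map arc (j ∷ es)) y →
             Unique (List.map initial (j ∷ es)) → All (λ i → w i ≢ 0ℤ) (j ∷ es) →
             v ℕ.≤ fuel ℕ.+ length es → ∃[ es ] Closing es
    extend zero j es walk u nz v≤ = contradiction
      (ℕ.≤-trans (subst (ℕ._≤ v) (length-map initial (j ∷ es)) (unique-length _ u)) v≤) ℕ.1+n≰n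
    extend (suc fuel) j es {y} walk u nz@(wj≢0 ∷ _) v≤ with predecessor j wj≢0
    ... | i , wi≢0 , end≡ with initial i ∈ⱽ? List.map initial (j ∷ es)
    ...   | no i∉ = extend fuel i (j ∷ es) (refl , subst (λ x → IsWalk G x (List.map arc (j ∷ es)) y) (sym end≡) walk)
                      (All.¬Any⇒All¬ _ i∉ ∷ u) (wi≢0 ∷ nz)
                      (subst (v ℕ.≤_) (sym (ℕ.+-suc fuel (length es))) v≤)
    ...   | yes i∈ with cut (j ∷ es) (initial i) walk i∈
    ...     | k , walk′ , i∉ = i ∷ take k (j ∷ es) , (λ ()) ,
                (initial i , refl , subst (λ x → IsWalk G x (List.map arc (take k (j ∷ es))) (initial i)) (sym end≡) walk′) ,
                All.¬Any⇒All¬ _ i∉ ∷ subst Unique (take-map k (j ∷ es)) (Unique.take⁺ k u) ,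
                wi≢0 ∷ All.take⁺ k nz

    edges-map : ∀ es → edges (List.map arc es) ≡ es
    edges-map es = trans (sym (map-∘ es)) (map-id es)

  support-contains-cycle : ∀ i → w i ≢ 0ℤ → ∃[ as ] IsCycle G as × (∀ j → j ∈ᴱ as → w j ≢ 0ℤ)
  support-contains-cycle i wi≢0 with extend v i [] (refl , refl) ([] ∷ []) (wi≢0 ∷ []) (ℕ.m≤m+n v 0)
  ... | es , es≢[] , closed-walk , u , nz = List.map arc es ,
    ( (λ eq → es≢[] (trans (sym (edges-map es)) (cong edges eq)))
    , closed-walk
    , subst Unique (map-∘ es) u
    -- The arc at an edge is determined by `w`, so equal edges have equal start vertices: distinct
    -- starts force distinct edges.
    , subst Unique (sym (edges-map es)) (Unique.map⁻ u)) ,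
    λ j j∈ → All.lookup nz (subst (j List∈.∈_) (edges-map es) j∈)

-- Cycletrees and generators of cycle spaces

SupportedOn : Subset e → Vector ℤ e → Set
SupportedOn Y w = ∀ i → i ∉ Y → w i ≡ 0ℤ

-- `generates` asks for integer multiples, not rational ones; this is what makes two generators
-- agree up to sign.
record IsGenerator (G : Graph v e) (Y : Subset e) (z : Vector ℤ e) : Set where
  field
    isClosed  : InKernel G z
    supported : SupportedOn Y z
    nonzero   : ∃[ i ] z i ≢ 0ℤ
    generates : ∀ w → InKernel G w → SupportedOn Y w → ∃[ c ] ∀ i → w i ≡ c * z i

open IsGenerator

sign≢0 : ∀ s → s ◃ 1 ≢ 0ℤ
sign≢0 Sign.+ ()
sign≢0 Sign.- ()

cycleVec-supported : ∀ {Y : Subset e} as → Within Y as → SupportedOn Y (cycleVec as)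
cycleVec-supported as within i i∉Y = cycleVec-∉ as λ i∈ → i∉Y (within i i∈)

module _ {G : Graph v e} {Y : Subset e} where

  -- Subtract from `w` the multiple of the cycle that cancels its coefficient at an edge `i` of the
  -- cycle. If something remained, its support would contain a cycle in `Y` avoiding `i`, but all
  -- cycles in `Y` have the same edges.
  cycletree⇒generator : IsCycletree G Y → ∀ as → IsCycle G as → Within Y as → IsGenerator G Y (cycleVec as)
  cycletree⇒generator _ [] (as≢[] , _) _ = contradiction refl as≢[]
  cycletree⇒generator (_ , bs , _ , same) as@((i , _) ∷ _) cyc@(_ , _ , _ , u) within = record
    { isClosed  = cycle-closed as cyc
    ; supported = cycleVec-supported as within
    ; nonzero   = i , λ eq → sign≢0 (proj₁ unit) (trans (sym (proj₂ unit)) eq)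
    ; generates = λ w closed supp → w i * (s ◃ 1) , multiple w closed supp
    }
    where
    unit : ∃[ s ] cycleVec as i ≡ s ◃ 1
    unit = cycleVec-∈ as u (here refl)
    s : Sign
    s = proj₁ unit
    module _ (w : Vector ℤ e) (closed : InKernel G w) (supp : SupportedOn Y w) where
      -- The coefficient of the cycle at `i` is the sign `s`, which is its own inverse.
      a : ℤ
      a = w i * (s ◃ 1)
      difference : Vector ℤ e
      difference = lin 1ℤ (- a) w (cycleVec as)
      vanishes-at-i : difference i ≡ 0ℤ
      vanishes-at-i = trans (cong (λ b → 1ℤ * w i + (- a) * b) (proj₂ unit))
        (trans (regroup (w i) (s ◃ 1)) (trans (cong (λ b → w i - w i * b) (◃-involutive s)) (cancel (w i))))
        where
        regroup : ∀ x b → 1ℤ * x + (- (x * b)) * b ≡ x - x * (b * b)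
        regroup = solve-∀
        cancel : ∀ x → x - x * 1ℤ ≡ 0ℤ
        cancel = solve-∀
      difference-supported : SupportedOn Y difference
      difference-supported j j∉Y = trans
        (cong₂ (λ b c → 1ℤ * b + (- a) * c) (supp j j∉Y) (cycleVec-supported as within j j∉Y))
        (cong (_+_ 0ℤ) (ℤ.*-zeroʳ (- a)))
      difference-zero : ∀ j → difference j ≡ 0ℤ
      difference-zero j = decidable-stable (difference j ℤ.≟ 0ℤ) λ dj≢0 →
        impossible (support-contains-cycle {G = G} difference
          (lin-closed G 1ℤ (- a) closed (cycle-closed as cyc)) j dj≢0)
        where
        impossible : ¬ (∃[ cs ] IsCycle G cs × (∀ j → j ∈ᴱ cs → difference j ≢ 0ℤ))
        impossible (cs , cyc′ , nz) = nz i
          -- Both cycles are compared with the reference cycle `bs` of the cycletree.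
          (proj₁ (same cs (cyc′ , within′) i) (proj₂ (same as (cyc , within) i) (here refl)))
          vanishes-at-i
          where
          within′ : Within Y cs
          within′ l l∈ = decidable-stable (l ∈? Y) λ l∉Y → nz l l∈ (difference-supported l l∉Y)
      multiple : ∀ j → w j ≡ a * cycleVec as j
      multiple j = trans (split (w j) a (cycleVec as j))
        (trans (cong (_+ a * cycleVec as j) (difference-zero j)) (ℤ.+-identityˡ _))
        where
        split : ∀ x a y → x ≡ (1ℤ * x + (- a) * y) + a * y
        split = solve-∀

  -- Each generator is a multiple of the other, and cancelling a nonzero entry shows that the two
  -- multipliers are inverse integers.
  generators-agree : ∀ {y z} → IsGenerator G Y y → IsGenerator G Y z → ∃[ s ] ∀ i → z i ≡ (s ◃ 1) * y i
  generators-agree {y} {z} gy gz with generates gy z (isClosed gz) (supported gz) | generates gz y (isClosed gy) (supported gy)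
  ... | c , z≡cy | d , y≡dz with unit⇒sign c d (cd≡1 (nonzero gz))
    where
    cd≡1 : (∃[ i ] z i ≢ 0ℤ) → c * d ≡ 1ℤ
    cd≡1 (i , zi≢0) = ℤ.*-cancelʳ-≡ (c * d) 1ℤ (z i) {{≢-nonZero zi≢0}} (begin
      c * d * z i    ≡⟨ ℤ.*-assoc c d (z i) ⟩
      c * (d * z i)  ≡⟨ cong (c *_) (y≡dz i) ⟨
      c * y i        ≡⟨ z≡cy i ⟨
      z i            ≡⟨ ℤ.*-identityˡ (z i) ⟨
      1ℤ * z i       ∎)
      where open ≡-Reasoning
  ...   | s , c≡s = s , λ i → trans (z≡cy i) (cong (_* y i) c≡s)

  -- The vector of any cycle in `Y` is a nonzero multiple of `z`, so the edge set of every such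
  -- cycle is exactly the support of `z`. Existence comes from the directed cycle in that support.
  generator⇒cycletree : ∀ {z} → ConnectedBy G Y → IsGenerator G Y z → IsCycletree G Y
  generator⇒cycletree {z} conn g with support-contains-cycle {G = G} z (isClosed g) (proj₁ (nonzero g)) (proj₂ (nonzero g))
  ... | as , cyc , nz = conn , as , (cyc , within) , λ bs (cyc′ , within′) i →
      ( (λ i∈ → decidable-stable (i ∈ᴱ? bs) λ i∉ →
          nz i i∈ (zero-off bs cyc′ within′ i i∉))
      , (λ i∈ → decidable-stable (i ∈ᴱ? as) λ i∉ →
          sign≢0 _ (trans (sym (proj₂ (cycleVec-∈ bs (proj₂ (proj₂ (proj₂ cyc′))) i∈)))
            (multiple-zero (cycleVec bs) (generates g (cycleVec bs) (cycle-closed bs cyc′) (cycleVec-supported bs within′))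
              (zero-off as cyc within i i∉)))))
    where
    _∈ᴱ?_ : ∀ (i : Fin e) as → Dec (i ∈ᴱ as)
    i ∈ᴱ? as = DecMembership._∈?_ _≟_ i (edges as)
    within : Within Y as
    within i i∈ = decidable-stable (i ∈? Y) λ i∉Y → nz i i∈ (supported g i i∉Y)
    multiple-zero : ∀ y {i} → (∃[ c ] ∀ i → y i ≡ c * z i) → z i ≡ 0ℤ → y i ≡ 0ℤ
    multiple-zero y {i} (c , eq) zi≡0 = trans (eq i) (trans (cong (c *_) zi≡0) (ℤ.*-zeroʳ c))
    -- The cycle vector is a nonzero multiple of z.
    zero-off : ∀ bs → IsCycle G bs → Within Y bs → ∀ i → ¬ (i ∈ᴱ bs) → z i ≡ 0ℤ
    zero-off [] (bs≢[] , _) _ = contradiction refl bs≢[]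
    zero-off bs@((j , _) ∷ _) cyc within i i∉ with generates g (cycleVec bs) (cycle-closed bs cyc) (cycleVec-supported bs within)
    ... | c , eq with ℤ.i*j≡0⇒i≡0∨j≡0 c (trans (sym (eq i)) (cycleVec-∉ bs i∉))
    ...   | inj₂ zi≡0 = zi≡0
    ...   | inj₁ c≡0  = contradiction
      (trans (sym (proj₂ unit)) (trans (eq j) (cong (_* z j) c≡0))) (sign≢0 (proj₁ unit))
      where
      unit : ∃[ s ] cycleVec bs j ≡ s ◃ 1
      unit = cycleVec-∈ bs (proj₂ (proj₂ (proj₂ cyc))) (here refl)

-- Sums over subsets and cycletrees

insertEdge : Fin (suc e) → Bool → Subset e → Subset (suc e)
insertEdge σ b Y = Vec.insertAt Y σ b

module _ (σ : Fin (suc e)) (b : Bool) (Y : Subset e) where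

  ∈-insertEdge⁺ : ∀ {j} → j ∈ Y → punchIn σ j ∈ insertEdge σ b Y
  ∈-insertEdge⁺ {j} j∈ = Vec.lookup⇒[]= (punchIn σ j) (insertEdge σ b Y)
    (trans (Vec.insertAt-punchIn Y σ b j) (Vec.[]=⇒lookup j∈))

  ∈-insertEdge⁻ : ∀ {j} → punchIn σ j ∈ insertEdge σ b Y → j ∈ Y
  ∈-insertEdge⁻ {j} j∈ = Vec.lookup⇒[]= j Y
    (trans (sym (Vec.insertAt-punchIn Y σ b j)) (Vec.[]=⇒lookup j∈))

σ∈insertEdge : ∀ (σ : Fin (suc e)) Y → σ ∈ insertEdge σ inside Y
σ∈insertEdge σ Y = Vec.lookup⇒[]= σ (insertEdge σ inside Y) (Vec.insertAt-lookup Y σ inside)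

σ∉insertEdge : ∀ (σ : Fin (suc e)) Y → σ ∉ insertEdge σ outside Y
σ∉insertEdge σ Y σ∈ with trans (sym (Vec.insertAt-lookup Y σ outside)) (Vec.[]=⇒lookup σ∈)
... | ()

indicator : ∀ {P : Set} → Dec P → ℤ → ℤ
indicator P? a = if does P? then a else 0ℤ

indicator-true : ∀ {P : Set} (P? : Dec P) {a} → P → indicator P? a ≡ a
indicator-true (yes _) p = refl
indicator-true (no ¬p) p = contradiction p ¬p

indicator-zero : ∀ {P : Set} (P? : Dec P) {a} → (P → a ≡ 0ℤ) → indicator P? a ≡ 0ℤ
indicator-zero (yes p) h = h p
indicator-zero (no _)  h = refl

indicator-match : ∀ {P Q : Set} (P? : Dec P) (Q? : Dec Q) → (P → Q) → (Q → P) →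
  ∀ {a b} c → (P → Q → a ≡ c * b) → indicator P? a ≡ c * indicator Q? b
indicator-match (yes p) (yes q) _   _   c h = h p q
indicator-match (yes p) (no ¬q) p⇒q _   c h = contradiction (p⇒q p) ¬q
indicator-match (no ¬p) (yes q) _   q⇒p c h = contradiction (q⇒p q) ¬p
indicator-match (no _)  (no _)  _   _   c h = sym (ℤ.*-zeroʳ c)

total : ∀ {A : Set} → (A → ℤ) → List A → ℤ
total f = List.foldr (λ a acc → f a + acc) 0ℤ

module _ {A : Set} where

  total-++ : ∀ (f : A → ℤ) xs ys → total f (xs List.++ ys) ≡ total f xs + total f ys
  total-++ f []       ys = sym (ℤ.+-identityˡ _)
  total-++ f (x ∷ xs) ys = trans (cong (_+_ (f x)) (total-++ f xs ys)) (sym (ℤ.+-assoc (f x) _ _))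

  total-map : ∀ {B : Set} (f : B → ℤ) (g : A → B) xs → total f (List.map g xs) ≡ total (f ∘ g) xs
  total-map f g []       = refl
  total-map f g (x ∷ xs) = cong (_+_ (f (g x))) (total-map f g xs)

  total-cong : ∀ {f g : A → ℤ} → (∀ x → f x ≡ g x) → ∀ xs → total f xs ≡ total g xs
  total-cong h []       = refl
  total-cong h (x ∷ xs) = cong₂ _+_ (h x) (total-cong h xs)

  total-zero : ∀ {f : A → ℤ} → (∀ x → f x ≡ 0ℤ) → ∀ xs → total f xs ≡ 0ℤ
  total-zero h []       = refl
  total-zero h (x ∷ xs) = cong₂ _+_ (h x) (total-zero h xs)

  total-scale : ∀ a (f : A → ℤ) xs → total (λ x → a * f x) xs ≡ a * total f xs
  total-scale a f []       = sym (ℤ.*-zeroʳ a)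
  total-scale a f (x ∷ xs) = trans (cong (_+_ (a * f x)) (total-scale a f xs)) (sym (ℤ.*-distribˡ-+ a (f x) (total f xs)))

  total-filter : ∀ {P : Pred A 0ℓ} (P? : Decidable P) f xs →
                 total f (List.filter P? xs) ≡ total (λ x → indicator (P? x) (f x)) xs
  total-filter P? f [] = refl
  total-filter P? f (x ∷ xs) with does (P? x)
  ... | true  = cong (_+_ (f x)) (total-filter P? f xs)
  ... | false = trans (total-filter P? f xs) (sym (ℤ.+-identityˡ _))

-- `allSubsets` branches on the first edge. Induction on the position of σ makes it branch on σ, at
-- the price of exchanging the middle two of four partial sums.
total-allSubsets : ∀ (σ : Fin (suc e)) (f : Subset (suc e) → ℤ) →
  total f (allSubsets (suc e)) ≡ total (f ∘ insertEdge σ inside) (allSubsets e) + total (f ∘ insertEdge σ outside) (allSubsets e)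
total-allSubsets {e} zero f = trans (total-++ f (List.map (inside Vec.∷_) (allSubsets e)) _)
  (cong₂ _+_ (total-map f (inside Vec.∷_) (allSubsets e)) (total-map f (outside Vec.∷_) (allSubsets e)))
total-allSubsets {suc e} (suc σ) f = begin
  total f (allSubsets (suc (suc e)))
    ≡⟨ split (suc e) f ⟩
  total (f ∘ (inside Vec.∷_)) (allSubsets (suc e)) + total (f ∘ (outside Vec.∷_)) (allSubsets (suc e))
    ≡⟨ cong₂ _+_ (total-allSubsets σ (f ∘ (inside Vec.∷_))) (total-allSubsets σ (f ∘ (outside Vec.∷_))) ⟩
  (ii + io) + (oi + oo)
    ≡⟨ exchange ii io oi oo ⟩
  (ii + oi) + (io + oo)
    ≡⟨ cong₂ _+_ (split e (f ∘ insertEdge (suc σ) inside)) (split e (f ∘ insertEdge (suc σ) outside)) ⟨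
  total (f ∘ insertEdge (suc σ) inside) (allSubsets (suc e)) + total (f ∘ insertEdge (suc σ) outside) (allSubsets (suc e)) ∎
  where
  open ≡-Reasoning
  split : ∀ e (f : Subset (suc e) → ℤ) → total f (allSubsets (suc e))
        ≡ total (f ∘ (inside Vec.∷_)) (allSubsets e) + total (f ∘ (outside Vec.∷_)) (allSubsets e)
  split e f = total-allSubsets zero f
  ii io oi oo : ℤ
  ii = total (λ Y → f (inside  Vec.∷ insertEdge σ inside Y)) (allSubsets e)
  io = total (λ Y → f (inside  Vec.∷ insertEdge σ outside Y)) (allSubsets e)
  oi = total (λ Y → f (outside Vec.∷ insertEdge σ inside Y)) (allSubsets e)
  oo = total (λ Y → f (outside Vec.∷ insertEdge σ outside Y)) (allSubsets e)
  exchange : ∀ a b c d → (a + b) + (c + d) ≡ (a + c) + (b + d)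
  exchange = solve-∀

total-filter₂ : ∀ {A : Set} {C P : Pred A 0ℓ} (C? : Decidable C) (P? : Decidable P) f xs →
  total f (List.filter P? (List.filter C? xs)) ≡ total (λ x → indicator (C? x) (indicator (P? x) (f x))) xs
total-filter₂ C? P? f xs = trans (total-filter P? f (List.filter C? xs)) (total-filter C? (λ x → indicator (P? x) (f x)) xs)

total-filter₂-zero : ∀ {A : Set} {C P : Pred A 0ℓ} (C? : Decidable C) (P? : Decidable P) {f} xs →
  (∀ x → C x → P x → f x ≡ 0ℤ) → total f (List.filter P? (List.filter C? xs)) ≡ 0ℤ
total-filter₂-zero C? P? {f} xs h = trans (total-filter₂ C? P? f xs)
  (total-zero (λ x → indicator-zero (C? x) λ c → indicator-zero (P? x) (h x c)) xs)

-- Turning the filters into indicators lets the sums run over all subsets and be compared term by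
-- term. `P` kills the half in which the membership of σ is `not b`.
total-correspondence : ∀ {C P : Pred (Subset (suc e)) 0ℓ} {C′ : Pred (Subset e) 0ℓ}
  (C? : Decidable C) (P? : Decidable P) (C′? : Decidable C′) σ b →
  (∀ Y → P (insertEdge σ b Y)) → (∀ Y → ¬ P (insertEdge σ (not b) Y)) →
  (∀ Y → C (insertEdge σ b Y) → C′ Y) → (∀ Y → C′ Y → C (insertEdge σ b Y)) →
  ∀ a f f′ → (∀ Y → C (insertEdge σ b Y) → C′ Y → f (insertEdge σ b Y) ≡ a * f′ Y) →
  total f (List.filter P? (List.filter C? (allSubsets (suc e)))) ≡ a * total f′ (List.filter C′? (allSubsets e))
total-correspondence {e = e} C? P? C′? σ b P-b ¬P-b C⇒C′ C′⇒C a f f′ h = begin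
  total f (List.filter P? (List.filter C? (allSubsets (suc e))))
    ≡⟨ total-filter₂ C? P? f (allSubsets (suc e)) ⟩
  total F (allSubsets (suc e))
    ≡⟨ total-allSubsets σ F ⟩
  total (F ∘ insertEdge σ inside) (allSubsets e) + total (F ∘ insertEdge σ outside) (allSubsets e)
    ≡⟨ sides b ⟩
  total (F ∘ insertEdge σ b) (allSubsets e) + total (F ∘ insertEdge σ (not b)) (allSubsets e)
    ≡⟨ cong₂ _+_ (total-cong match (allSubsets e)) (total-zero vanish (allSubsets e)) ⟩
  total (λ Y → a * F′ Y) (allSubsets e) + 0ℤ
    ≡⟨ ℤ.+-identityʳ _ ⟩
  total (λ Y → a * F′ Y) (allSubsets e)
    ≡⟨ total-scale a F′ (allSubsets e) ⟩
  a * total F′ (allSubsets e)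
    ≡⟨ cong (a *_) (total-filter C′? f′ (allSubsets e)) ⟨
  a * total f′ (List.filter C′? (allSubsets e)) ∎
  where
  open ≡-Reasoning
  F : Subset (suc e) → ℤ
  F Y = indicator (C? Y) (indicator (P? Y) (f Y))
  F′ : Subset e → ℤ
  F′ Y = indicator (C′? Y) (f′ Y)
  sides : ∀ b → total (F ∘ insertEdge σ inside) (allSubsets e) + total (F ∘ insertEdge σ outside) (allSubsets e)
              ≡ total (F ∘ insertEdge σ b) (allSubsets e) + total (F ∘ insertEdge σ (not b)) (allSubsets e)
  sides true  = refl
  sides false = ℤ.+-comm (total (F ∘ insertEdge σ inside) (allSubsets e)) _
  vanish : ∀ Y → F (insertEdge σ (not b) Y) ≡ 0ℤ
  vanish Y = indicator-zero (C? (insertEdge σ (not b) Y)) λ _ →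
    indicator-zero (P? (insertEdge σ (not b) Y)) λ p → contradiction p (¬P-b Y)
  match : ∀ Y → F (insertEdge σ b Y) ≡ a * F′ Y
  match Y = indicator-match (C? (insertEdge σ b Y)) (C′? Y) (C⇒C′ Y) (C′⇒C Y) a λ c c′ →
    trans (indicator-true (P? (insertEdge σ b Y)) (P-b Y)) (h Y c c′)

total-cycletrees-zero : ∀ (G : Graph v e) {P : Pred (Subset e) 0ℓ} (P? : Decidable P) f →
  (∀ Y → IsCycletree G Y → P Y → f Y ≡ 0ℤ) → total f (List.filter P? (cycletrees G)) ≡ 0ℤ
total-cycletrees-zero G P? f = total-filter₂-zero (isCycletree? G) P? {f} (allSubsets _)

vec-sumOver : {G : Graph v e} (z : CycleVectors G) (β : Basis G (suc k)) (∂ : Vector (Z₁ G) k) → ∀ Ys i →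
  vec (sumOver z β ∂ Ys) i ≡ total (λ Y → winding β ∂ (cycleOf z Y) * vec (cycleOf z Y) i) Ys
vec-sumOver z β ∂ []       i = refl
vec-sumOver z β ∂ (Y ∷ Ys) i = cong (_+_ (winding β ∂ (cycleOf z Y) * vec (cycleOf z Y) i)) (vec-sumOver z β ∂ Ys i)

without? : ∀ (σ : Fin e) → Decidable (λ (Y : Subset e) → ¬ (σ ∈ Y))
without? σ Y = ¬? (σ ∈? Y)

module _ {G : Graph v e} (z : CycleVectors G) (β : Basis G (suc k)) (∂ : Vector (Z₁ G) k) where

  summand : Fin e → Subset e → ℤ
  summand i Y = winding β ∂ (cycleOf z Y) * vec (cycleOf z Y) i

  vec-lam : ∀ i → vec (lam z β ∂) i ≡ total (summand i) (cycletrees G)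
  vec-lam = vec-sumOver z β ∂ (cycletrees G)

  vec-lamWith : ∀ σ i → vec (lamWith z β ∂ σ) i ≡ total (summand i) (List.filter (σ ∈?_) (cycletrees G))
  vec-lamWith σ = vec-sumOver z β ∂ (List.filter (σ ∈?_) (cycletrees G))

  vec-lamWithout : ∀ σ i → vec (lamWithout z β ∂ σ) i ≡ total (summand i) (List.filter (without? σ) (cycletrees G))
  vec-lamWithout σ = vec-sumOver z β ∂ (List.filter (without? σ) (cycletrees G))

-- Transfer of cycletrees and of their summands

IsGenerator-resp-≗ : {G : Graph v e} {Y : Subset e} → ∀ {y z} → y ≗ z → IsGenerator G Y y → IsGenerator G Y z
isClosed  (IsGenerator-resp-≗ {G = G} h g) u = trans (sym (boundary-cong G h u)) (isClosed g u)
supported (IsGenerator-resp-≗ h g) i i∉ = trans (sym (h i)) (supported g i i∉)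
nonzero   (IsGenerator-resp-≗ h g) = proj₁ (nonzero g) , λ eq → proj₂ (nonzero g) (trans (h _) eq)
generates (IsGenerator-resp-≗ h g) w w-closed supp =
  proj₁ (generates g w w-closed supp) , λ i →
    trans (proj₂ (generates g w w-closed supp) i) (cong (_*_ (proj₁ (generates g w w-closed supp))) (h i))

cycleOf-isGenerator : {G : Graph v e} (z : CycleVectors G) → ∀ {Y} → IsCycletree G Y → IsGenerator G Y (vec (cycleOf z Y))
cycleOf-isGenerator z ct with isCycle z ct
... | as , cyc , within , eq = IsGenerator-resp-≗ (sym ∘ eq) (cycletree⇒generator ct as cyc within)

-- The spanning subgraph Y of G and its image Y′ in a contraction or deletion
-- of σ are both connected or both not, and forgetting the coefficient of σ
-- identifies their cycle spaces.
record Transfer {v v′ : ℕ} (G : Graph v (suc e)) (σ : Fin (suc e)) (G′ : Graph v′ e)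
                (Y : Subset (suc e)) (Y′ : Subset e) : Set where
  field
    connected⇒      : ConnectedBy G Y → ConnectedBy G′ Y′
    connected⇐      : ConnectedBy G′ Y′ → ConnectedBy G Y
    punchIn∈⁻       : ∀ {j} → punchIn σ j ∈ Y → j ∈ Y′
    restrict-closed : ∀ w → InKernel G w → SupportedOn Y w → InKernel G′ (removeAt w σ)
    lift            : ∀ w′ → InKernel G′ w′ → SupportedOn Y′ w′ →
                      ∃[ w ] InKernel G w × SupportedOn Y w × removeAt w σ ≗ w′
    injective       : ∀ w → InKernel G w → SupportedOn Y w → (∀ j → removeAt w σ j ≡ 0ℤ) → ∀ i → w i ≡ 0ℤ

  restrict-supported : ∀ {w} → SupportedOn Y w → SupportedOn Y′ (removeAt w σ)
  restrict-supported supp j j∉ = supp (punchIn σ j) (j∉ ∘ punchIn∈⁻)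

  generator⇒ : ∀ {z} → IsGenerator G Y z → IsGenerator G′ Y′ (removeAt z σ)
  generator⇒ {z} g = record
    { isClosed  = restrict-closed z (isClosed g) (supported g)
    ; supported = restrict-supported (supported g)
    ; nonzero   = decidable-stable (any? λ j → ¬? (z (punchIn σ j) ℤ.≟ 0ℤ)) λ none →
        proj₂ (nonzero g) (injective z (isClosed g) (supported g)
          (λ j → decidable-stable (z (punchIn σ j) ℤ.≟ 0ℤ) λ z≢0 → none (j , z≢0)) _)
    ; generates = λ w′ closed supp → multiple (lift w′ closed supp)
    }
    where
    multiple : ∀ {w′} → (∃[ w ] InKernel G w × SupportedOn Y w × removeAt w σ ≗ w′) →
               ∃[ c ] ∀ j → w′ j ≡ c * z (punchIn σ j)
    multiple (w , w-closed , supp , eq) = proj₁ (generates g w w-closed supp) , λ j →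
      trans (sym (eq j)) (proj₂ (generates g w w-closed supp) (punchIn σ j))

  -- If the restriction of `w` is `c` times that of `z`, then w - c z restricts to zero and vanishes
  -- by `injective`, so the multiplier found without σ is valid at σ too.
  generator⇐ : ∀ {z′} → IsGenerator G′ Y′ z′ → ∃[ z ] IsGenerator G Y z
  generator⇐ {z′} g with lift z′ (isClosed g) (supported g)
  ... | z , z-closed , supp , eq = z , record
    { isClosed  = z-closed
    ; supported = supp
    ; nonzero   = punchIn σ (proj₁ (nonzero g)) , λ zi≡0 → proj₂ (nonzero g) (trans (sym (eq _)) zi≡0)
    ; generates = λ w w-closed w-supp → multiple w w-closed w-supp
        (generates g (removeAt w σ) (restrict-closed w w-closed w-supp) (restrict-supported w-supp))
    }
    where
    multiple : ∀ w → InKernel G w → SupportedOn Y w → (∃[ c ] ∀ j → removeAt w σ j ≡ c * z′ j) →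
               ∃[ c ] ∀ i → w i ≡ c * z i
    multiple w w-closed w-supp (c , h) = c , λ i → trans (split (w i) c (z i))
      (trans (cong (_+ c * z i) (injective difference (lin-closed G 1ℤ (- c) {w} {z} w-closed z-closed)
        (λ i i∉ → trans (cong₂ (λ a b → 1ℤ * a + (- c) * b) (w-supp i i∉) (supp i i∉)) (cong (_+_ 0ℤ) (ℤ.*-zeroʳ (- c))))
        (λ j → trans (cong₂ (λ a b → 1ℤ * a + (- c) * b) (h j) (eq j)) (cancel c (z′ j))) i))
      (ℤ.+-identityˡ _))
      where
      difference : Vector ℤ _
      difference = lin 1ℤ (- c) w z
      split : ∀ x a y → x ≡ (1ℤ * x + (- a) * y) + a * y
      split = solve-∀
      cancel : ∀ c y → 1ℤ * (c * y) + (- c) * y ≡ 0ℤ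
      cancel = solve-∀

  cycletree⇒ : (z : CycleVectors G) → IsCycletree G Y → IsCycletree G′ Y′
  cycletree⇒ z ct = generator⇒cycletree (connected⇒ (proj₁ ct)) (generator⇒ (cycleOf-isGenerator z ct))

  cycletree⇐ : (z′ : CycleVectors G′) → IsCycletree G′ Y′ → IsCycletree G Y
  cycletree⇐ z′ ct = generator⇒cycletree (connected⇐ (proj₁ ct)) (proj₂ (generator⇐ (cycleOf-isGenerator z′ ct)))

  cycleOf-agree : (z : CycleVectors G) (z′ : CycleVectors G′) → IsCycletree G Y → IsCycletree G′ Y′ →
                  ∃[ s ] ∀ j → vec (cycleOf z′ Y′) j ≡ (s ◃ 1) * vec (cycleOf z Y) (punchIn σ j)
  cycleOf-agree z z′ ct ct′ = generators-agree (generator⇒ (cycleOf-isGenerator z ct)) (cycleOf-isGenerator z′ ct′)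

open Transfer

transfer-total : ∀ {v v′} {G : Graph v (suc e)} {σ : Fin (suc e)} {G′ : Graph v′ e} →
  CycleVectors G → CycleVectors G′ →
  ∀ {P : Pred (Subset (suc e)) 0ℓ} (P? : Decidable P) b →
  (∀ Y → P (insertEdge σ b Y)) → (∀ Y → ¬ P (insertEdge σ (not b) Y)) →
  (∀ Y → Transfer G σ G′ (insertEdge σ b Y) Y) →
  ∀ a f f′ → (∀ Y → IsCycletree G (insertEdge σ b Y) → IsCycletree G′ Y → f (insertEdge σ b Y) ≡ a * f′ Y) →
  total f (List.filter P? (cycletrees G)) ≡ a * total f′ (cycletrees G′)
transfer-total {G = G} {σ} {G′} z z′ P? b P-b ¬P-b t =
  total-correspondence (isCycletree? G) P? (isCycletree? G′) σ b P-b ¬P-b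
    (λ Y → cycletree⇒ (t Y) z) (λ Y → cycletree⇐ (t Y) z′)

swap-signs : ∀ s w x → (s ◃ 1) * w * ((s ◃ 1) * x) ≡ w * x
swap-signs s w x = trans (regroup (s ◃ 1) w x) (trans (cong (_* (w * x)) (◃-involutive s)) (ℤ.*-identityˡ (w * x)))
  where
  regroup : ∀ s w x → s * w * (s * x) ≡ s * s * (w * x)
  regroup = solve-∀

-- The two orientations of a cycle give the same summand.
transfer-lam : ∀ {v v′} {G : Graph v (suc e)} {σ : Fin (suc e)} {G′ : Graph v′ e} {k k′}
  (z : CycleVectors G) (β : Basis G (suc k)) (∂ : Vector (Z₁ G) k)
  (z′ : CycleVectors G′) (β′ : Basis G′ (suc k′)) (∂′ : Vector (Z₁ G′) k′) →
  ∀ {P : Pred (Subset (suc e)) 0ℓ} (P? : Decidable P) b →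
  (∀ Y → P (insertEdge σ b Y)) → (∀ Y → ¬ P (insertEdge σ (not b) Y)) →
  (∀ Y → Transfer G σ G′ (insertEdge σ b Y) Y) →
  ∀ a → (∀ Y y y′ → SupportedOn (insertEdge σ b Y) (vec y) → vec y′ ≗ removeAt (vec y) σ →
                    winding β ∂ y ≡ a * winding β′ ∂′ y′) →
  ∀ j → total (summand z β ∂ (punchIn σ j)) (List.filter P? (cycletrees G)) ≡ a * vec (lam z′ β′ ∂′) j
transfer-lam {G = G} {σ} {G′} z β ∂ z′ β′ ∂′ P? b P-b ¬P-b t a h j = trans
  (transfer-total z z′ P? b P-b ¬P-b t a (summand z β ∂ (punchIn σ j)) (summand z′ β′ ∂′ j) summands)
  (cong (a *_) (sym (vec-lam z′ β′ ∂′ j)))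
  where
  summands : ∀ Y → IsCycletree G (insertEdge σ b Y) → IsCycletree G′ Y →
             summand z β ∂ (punchIn σ j) (insertEdge σ b Y) ≡ a * summand z′ β′ ∂′ j Y
  summands Y ct ct′ = sym (begin
    a * (winding β′ ∂′ y′ * vec y′ j)
      ≡⟨ cong (a *_) (cong₂ _*_ (winding-scale β′ ∂′ (s ◃ 1) ŷ y′ agree) (agree j)) ⟩
    a * ((s ◃ 1) * winding β′ ∂′ ŷ * ((s ◃ 1) * vec y (punchIn σ j)))
      ≡⟨ cong (a *_) (swap-signs s (winding β′ ∂′ ŷ) (vec y (punchIn σ j))) ⟩
    a * (winding β′ ∂′ ŷ * vec y (punchIn σ j))
      ≡⟨ ℤ.*-assoc a (winding β′ ∂′ ŷ) (vec y (punchIn σ j)) ⟨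
    a * winding β′ ∂′ ŷ * vec y (punchIn σ j)
      ≡⟨ cong (_* vec y (punchIn σ j)) (h Y y ŷ y-supported λ _ → refl) ⟨
    winding β ∂ y * vec y (punchIn σ j) ∎)
    where
    open ≡-Reasoning
    y : Z₁ G
    y = cycleOf z (insertEdge σ b Y)
    y-supported : SupportedOn (insertEdge σ b Y) (vec y)
    y-supported = supported (cycleOf-isGenerator z ct)
    -- `y′` is the vector chosen in the smaller graph, `ŷ` the restriction of the one chosen in `G`.
    -- The choices are independent, so they agree only up to a sign.
    y′ ŷ : Z₁ G′
    y′ = cycleOf z′ Y
    ŷ  = removeAt (vec y) σ , restrict-closed (t Y) (vec y) (closed y) y-supported
    agreement : ∃[ s ] ∀ j → vec y′ j ≡ (s ◃ 1) * vec y (punchIn σ j)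
    agreement = cycleOf-agree (t Y) z z′ ct ct′
    s : Sign
    s = proj₁ agreement
    agree : ∀ j → vec y′ j ≡ (s ◃ 1) * vec y (punchIn σ j)
    agree = proj₂ agreement

-- Contraction

-- A step may become a path: contraction collapses σ to no step at all, and lifting an edge of G/σ
-- may require a detour through σ.
EqClosure-bind : ∀ {A B : Set} {R : A → A → Set} {S : B → B → Set} (f : A → B) →
  (∀ {x y} → R x y → EqClosure S (f x) (f y)) → ∀ {x y} → EqClosure R x y → EqClosure S (f x) (f y)
EqClosure-bind f h ε           = ε
EqClosure-bind f h (fwd r ◅ p) = h r ◅◅ EqClosure-bind f h p
EqClosure-bind {S = S} f h (bwd r ◅ p) = EqClosure-symmetric S (h r) ◅◅ EqClosure-bind f h p

≡⇒EqClosure : ∀ {A : Set} {R : A → A → Set} {x y} → x ≡ y → EqClosure R x y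
≡⇒EqClosure refl = ε

linComb-zero : (c : Vector ℤ n) (X : Columns m n) → (∀ j → c j ≡ 0ℤ) → ∀ i → linComb c X i ≡ 0ℤ
linComb-zero c X h i = sum-zero _ λ j → cong (_* X j i) (h j)

winding-cong : ∀ {v v′ e e′} {G : Graph v e} {G′ : Graph v′ e′} (β : Basis G (suc k)) (β′ : Basis G′ (suc k)) ∂ ∂′ z z′ →
  coords β z ≗ coords β′ z′ → (∀ j → coords β (∂ j) ≗ coords β′ (∂′ j)) → winding β ∂ z ≡ winding β′ ∂′ z′
winding-cong β β′ ∂ ∂′ z z′ hz h∂ = trans (winding-as-form β ∂ z) (trans
  (detᶜ-cong (windingColumns β ∂ z) (windingColumns β′ ∂′ z′) λ { zero → hz ; (suc j) → h∂ j })
  (sym (winding-as-form β′ ∂′ z′)))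

module Contraction (G : Graph (suc v) (suc e)) (σ : Fin (suc e)) (¬loop : ¬ IsLoop G σ) where
  private
    s t : Fin (suc v)
    s = src G σ
    t = tgt G σ

    t≢s : t ≢ s
    t≢s = ¬loop ∘ sym

    Gc : Graph v e
    Gc = contract G σ ¬loop

    quotient : Fin (suc v) → Fin v
    quotient = merge t≢s

    quotient-punchIn : ∀ x → quotient (punchIn t x) ≡ x
    quotient-punchIn x with t ≟ punchIn t x
    ... | yes t≡ = contradiction (sym t≡) (punchInᵢ≢i t x)
    ... | no t≢  = trans (punchOut-cong t refl) (punchOut-punchIn t)

    quotient-ends : quotient s ≡ quotient t
    quotient-ends with t ≟ s | t ≟ t
    ... | yes t≡s | _       = contradiction t≡s t≢s
    ... | no _    | yes _   = punchOut-cong t refl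
    ... | no _    | no t≢t  = contradiction refl t≢t

    module _ (Y : Subset e) where
      Y⁺ : Subset (suc e)
      Y⁺ = insertEdge σ inside Y

      σ-joins : EqClosure (Joins G Y⁺) s t
      σ-joins = fwd (σ , σ∈insertEdge σ Y , refl , refl) ◅ ε

      -- Only `t` is moved, namely to `s`, and σ joins the two inside `Y⁺`.
      section-quotient : ∀ x → EqClosure (Joins G Y⁺) x (punchIn t (quotient x))
      section-quotient x with t ≟ x
      ... | yes refl = EqClosure-symmetric _ σ-joins ◅◅ ≡⇒EqClosure (sym (punchIn-punchOut t≢s))
      ... | no t≢x   = ≡⇒EqClosure (sym (punchIn-punchOut t≢x))

      quotient-joins : ∀ {x y} → Joins G Y⁺ x y → EqClosure (Joins Gc Y) (quotient x) (quotient y)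
      quotient-joins (i , i∈ , refl , refl) with punch-view σ i
      ... | inj₁ refl       = ≡⇒EqClosure quotient-ends
      ... | inj₂ (j , refl) = fwd (j , ∈-insertEdge⁻ σ inside Y i∈ , refl , refl) ◅ ε

      section-joins : ∀ {x y} → Joins Gc Y x y → EqClosure (Joins G Y⁺) (punchIn t x) (punchIn t y)
      section-joins (j , j∈ , refl , refl) =
        EqClosure-symmetric _ (section-quotient (src G (punchIn σ j))) ◅◅
        (fwd (punchIn σ j , ∈-insertEdge⁺ σ inside Y j∈ , refl , refl) ◅
         section-quotient (tgt G (punchIn σ j)))

  module _ (β : Basis G m) where
    private
      βc : Basis Gc m
      βc = contractBasis G σ ¬loop β

    coords-contract : ∀ z → coords βc (contractCycle G σ ¬loop z) ≗ coords β z
    coords-contract z = coords-unique βc (contractCycle G σ ¬loop z) (coords β z) λ j → coords-spec β z (punchIn σ j)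

    coords-contractColumns : (∂ : Vector (Z₁ G) k) → ∀ j → coords βc (contractColumns G σ ¬loop β ∂ j) ≗ coords β (∂ j)
    coords-contractColumns ∂ j = coords-unique βc (contractColumns G σ ¬loop β ∂ j) (coords β (∂ j))
      (vec-combine (coords β (∂ j)) (elt βc))

    -- The basis inverts the forgetful map: a cycle of G/σ lifts to the cycle of `G` with the same
    -- coordinates, and independence of the contracted basis gives injectivity.
    contraction-transfer : ∀ Y → Transfer G σ Gc (insertEdge σ inside Y) Y
    contraction-transfer Y = record
      { connected⇒      = λ conn x y → subst₂ (EqClosure (Joins Gc Y)) (quotient-punchIn x) (quotient-punchIn y)
          (EqClosure-bind quotient (quotient-joins Y) (conn (punchIn t x) (punchIn t y)))
      ; connected⇐      = λ conn x y → section-quotient Y x ◅◅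
          (EqClosure-bind (punchIn t) (section-joins Y) (conn (quotient x) (quotient y)) ◅◅
           EqClosure-symmetric _ (section-quotient Y y))
      ; punchIn∈⁻       = ∈-insertEdge⁻ σ inside Y
      ; restrict-closed = λ w w-closed _ → closed (contractCycle G σ ¬loop (w , w-closed))
      ; lift            = λ w w-closed supp → lift-cycle (w , w-closed) supp
      ; injective       = λ w w-closed _ h i → trans (coords-spec β (w , w-closed) i)
          (linComb-zero (coords β (w , w-closed)) (vec ∘ elt β) (independent βc (coords β (w , w-closed))
            λ j → trans (sym (coords-spec β (w , w-closed) (punchIn σ j))) (h j)) i)
      }
      where
      lift-cycle : ∀ (z : Z₁ Gc) → SupportedOn Y (vec z) →
                   ∃[ w ] InKernel G w × SupportedOn (insertEdge σ inside Y) w × removeAt w σ ≗ vec z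
      lift-cycle z supp = vec ẑ , closed ẑ , supported-lift , restricts
        where
        ẑ : Z₁ G
        ẑ = combine (coords βc z) (elt β)
        restricts : removeAt (vec ẑ) σ ≗ vec z
        restricts j = trans (vec-combine (coords βc z) (elt β) (punchIn σ j)) (sym (coords-spec βc z j))
        supported-lift : SupportedOn (insertEdge σ inside Y) (vec ẑ)
        supported-lift i i∉ with punch-view σ i
        ... | inj₁ refl       = contradiction (σ∈insertEdge σ Y) i∉
        ... | inj₂ (j , refl) = trans (restricts j) (supp j (i∉ ∘ ∈-insertEdge⁺ σ inside Y))

  -- The two vectors agree away from σ, that is, after contraction, and contraction preserves
  -- coordinates.
  lamWith-contract : (z : CycleVectors G) (zc : CycleVectors Gc) (β : Basis G (suc k)) (∂ : Vector (Z₁ G) k) →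
    coords β (lamWith z β ∂ σ) ≗ coords (contractBasis G σ ¬loop β)
      (lam zc (contractBasis G σ ¬loop β) (contractColumns G σ ¬loop β ∂))
  lamWith-contract z zc β ∂ i = trans (sym (coords-contract β Λ i))
    (coords-cong βc (contractCycle G σ ¬loop Λ) Λc restricts i)
    where
    βc : Basis Gc _
    βc = contractBasis G σ ¬loop β
    ∂c : Vector (Z₁ Gc) _
    ∂c = contractColumns G σ ¬loop β ∂
    Λ : Z₁ G
    Λ = lamWith z β ∂ σ
    Λc : Z₁ Gc
    Λc = lam zc βc ∂c
    restricts : removeAt (vec Λ) σ ≗ vec Λc
    restricts j = trans (vec-lamWith z β ∂ σ (punchIn σ j)) (trans
      (transfer-lam z β ∂ zc βc ∂c (σ ∈?_) inside (σ∈insertEdge σ) (σ∉insertEdge σ) (contraction-transfer β)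
        1ℤ same-winding j)
      (ℤ.*-identityˡ (vec Λc j)))
      where
      same-winding : ∀ Y y yc → SupportedOn (insertEdge σ inside Y) (vec y) → vec yc ≗ removeAt (vec y) σ →
                     winding β ∂ y ≡ 1ℤ * winding βc ∂c yc
      same-winding Y y yc _ eq = trans
        (winding-cong β βc ∂ ∂c y yc
          (λ i → trans (sym (coords-contract β y i)) (sym (coords-cong βc yc (contractCycle G σ ¬loop y) eq i)))
          (λ j i → sym (coords-contractColumns β ∂ j i)))
        (sym (ℤ.*-identityˡ (winding βc ∂c yc)))

-- Deletion

module _ {G : Graph v (suc e)} {σ : Fin (suc e)} where

  boundary-delete : (z : Vector ℤ (suc e)) → z σ ≡ 0ℤ → boundary (delete G σ) (removeAt z σ) ≗ boundary G z
  boundary-delete z zσ≡0 x = sym (trans (sum-remove {i = σ} (λ i → ∂₁ G x i * z i))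
    (trans (cong (λ a → ∂₁ G x σ * a + boundary (delete G σ) (removeAt z σ) x) zσ≡0)
      (trans (cong (_+ boundary (delete G σ) (removeAt z σ) x) (ℤ.*-zeroʳ (∂₁ G x σ))) (ℤ.+-identityˡ _))))

  deletion-transfer : ∀ Y → Transfer G σ (delete G σ) (insertEdge σ outside Y) Y
  deletion-transfer Y = record
    { connected⇒      = λ conn x y → EqClosure-bind (λ x → x) joins⇒ (conn x y)
    ; connected⇐      = λ conn x y → EqClosure-bind (λ x → x) joins⇐ (conn x y)
    ; punchIn∈⁻       = ∈-insertEdge⁻ σ outside Y
    ; restrict-closed = λ w w-closed supp x → trans (boundary-delete w (supp σ (σ∉insertEdge σ Y)) x) (w-closed x)
    ; lift            = λ w w-closed supp → insertAt w σ 0ℤ ,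
        (λ x → trans (sym (boundary-delete (insertAt w σ 0ℤ) (insertAt-lookup w σ 0ℤ) x))
          (trans (boundary-cong (delete G σ) (insertAt-punchIn w σ 0ℤ) x) (w-closed x))) ,
        supported-lift w supp ,
        insertAt-punchIn w σ 0ℤ
    ; injective       = λ w _ supp h i → zero-everywhere w supp h i
    }
    where
    joins⇒ : ∀ {x y} → Joins G (insertEdge σ outside Y) x y → EqClosure (Joins (delete G σ) Y) x y
    joins⇒ (i , i∈ , refl , refl) with punch-view σ i
    ... | inj₁ refl       = contradiction i∈ (σ∉insertEdge σ Y)
    ... | inj₂ (j , refl) = fwd (j , ∈-insertEdge⁻ σ outside Y i∈ , refl , refl) ◅ ε
    joins⇐ : ∀ {x y} → Joins (delete G σ) Y x y → EqClosure (Joins G (insertEdge σ outside Y)) x y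
    joins⇐ (j , j∈ , refl , refl) = fwd (punchIn σ j , ∈-insertEdge⁺ σ outside Y j∈ , refl , refl) ◅ ε
    supported-lift : ∀ w → SupportedOn Y w → SupportedOn (insertEdge σ outside Y) (insertAt w σ 0ℤ)
    supported-lift w supp i i∉ with punch-view σ i
    ... | inj₁ refl       = insertAt-lookup w σ 0ℤ
    ... | inj₂ (j , refl) = trans (insertAt-punchIn w σ 0ℤ j) (supp j (i∉ ∘ ∈-insertEdge⁺ σ outside Y))
    zero-everywhere : ∀ w → SupportedOn (insertEdge σ outside Y) w → (∀ j → removeAt w σ j ≡ 0ℤ) → ∀ i → w i ≡ 0ℤ
    zero-everywhere w supp h i with punch-view σ i
    ... | inj₁ refl       = supp σ (σ∉insertEdge σ Y)
    ... | inj₂ (j , refl) = h j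

module _ {G : Graph v e} where

  lamWithout-scale : ∀ (z : CycleVectors G) (β β′ : Basis G (suc k)) (∂ : Vector (Z₁ G) k) a →
    (∀ c → winding β ∂ c ≡ a * winding β′ ∂ c) → ∀ σ i →
    vec (lamWithout z β ∂ σ) i ≡ a * vec (lamWithout z β′ ∂ σ) i
  lamWithout-scale z β β′ ∂ a h σ i = begin
    vec (lamWithout z β ∂ σ) i
      ≡⟨ vec-lamWithout z β ∂ σ i ⟩
    total (summand z β ∂ i) Ys
      ≡⟨ total-cong (λ Y → trans (cong (_* vec (cycleOf z Y) i) (h (cycleOf z Y))) (ℤ.*-assoc a _ _)) Ys ⟩
    total (λ Y → a * summand z β′ ∂ i Y) Ys
      ≡⟨ total-scale a (summand z β′ ∂ i) Ys ⟩
    a * total (summand z β′ ∂ i) Ys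
      ≡⟨ cong (a *_) (vec-lamWithout z β′ ∂ σ i) ⟨
    a * vec (lamWithout z β′ ∂ σ) i ∎
    where
    open ≡-Reasoning
    Ys : List (Subset e)
    Ys = List.filter (without? σ) (cycletrees G)

-- The implicit arguments of deleteBasis and deleteColumns are written out: when
-- they are inferred, records are η-expanded, and comparing two occurrences of
-- λ(𝒜_d) then unfolds both.
module DeletionProperties {G : Graph v (suc e)} {σ : Fin (suc e)} {n : ℤ} {β : Basis G (suc (suc k))}
                          {∂ : Vector (Z₁ G) (suc k)} (D : Deletion G σ n β ∂) where
  private
    last : Fin (suc (suc k))
    last = fromℕ (suc k)

    linComb-init-last : ∀ c (X : Columns m (suc (suc k))) i →
      linComb c X i ≡ linComb (init c) (X ∘ inject₁) i + c last * X last i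
    linComb-init-last c X i = sum-init-last (λ j → c j * X j i)

    zero-at-σ : ∀ j → vec (elt β (inject₁ j)) σ ≡ 0ℤ
    zero-at-σ j with fundamental (isFundamental D) (inject₁ j)
    ... | as , _ , within , eq = trans (eq σ) (cycleVec-∉ as λ σ∈ → avoids (x∈p∪q⁻ (T D) _ (within σ σ∈)))
      where
      avoids : ¬ (σ ∈ T D ⊎ σ ∈ ⁅ chord (isFundamental D) (inject₁ j) ⁆)
      avoids (inj₁ σ∈T) = chord∉T (isFundamental D) last (subst (_∈ T D) (sym (chord-last D)) σ∈T)
      avoids (inj₂ σ∈)  = fromℕ≢inject₁ (chord-injective (isFundamental D) (trans (chord-last D) (x∈⁅y⁆⇒x≡y _ σ∈)))

    one-at-σ : vec (elt β last) σ ≡ 1ℤ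
    one-at-σ = trans (cong (vec (elt β last)) (sym (chord-last D))) (unit-coefficient (isFundamental D) last)

  -- Only the last fundamental cycle passes through σ, with coefficient 1, so the entry at σ reads
  -- off the last coordinate.
  coords-last : ∀ z → coords β z last ≡ vec z σ
  coords-last z = sym (begin
    vec z σ
      ≡⟨ coords-spec β z σ ⟩
    linComb (coords β z) (vec ∘ elt β) σ
      ≡⟨ linComb-init-last (coords β z) (vec ∘ elt β) σ ⟩
    linComb (init (coords β z)) (vec ∘ elt β ∘ inject₁) σ + coords β z last * vec (elt β last) σ
      ≡⟨ cong₂ (λ a b → a + coords β z last * b)
           (sum-zero _ λ j → trans (cong (coords β z (inject₁ j) *_) (zero-at-σ j)) (ℤ.*-zeroʳ (coords β z (inject₁ j))))
           one-at-σ ⟩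
    0ℤ + coords β z last * 1ℤ
      ≡⟨ trans (ℤ.+-identityˡ _) (ℤ.*-identityʳ (coords β z last)) ⟩
    coords β z last ∎)
    where open ≡-Reasoning

  -- The factor `a` serves two uses: 1 for the winding number of a single cycle, and `n` for λ
  -- itself.
  coords-delete : ∀ a z zd → vec z σ ≡ 0ℤ → (∀ j → vec z (punchIn σ j) ≡ a * vec zd j) →
                  ∀ i → coords β z (inject₁ i) ≡ a * coords (deleteBasis {G = G} {σ} {n} {β} {∂} D) zd i
  coords-delete a z zd zσ≡0 h i = trans
    (sym (coords-unique (deleteBasis {G = G} {σ} {n} {β} {∂} D) z′ (init (coords β z)) spans i))
    (coords-scale (deleteBasis {G = G} {σ} {n} {β} {∂} D) a zd z′ h i)
    where
    open ≡-Reasoning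
    z′ : Z₁ (delete G σ)
    z′ = deleteCycle σ z zσ≡0
    spans : ∀ j → vec z (punchIn σ j) ≡ linComb (init (coords β z)) (vec ∘ elt (deleteBasis {G = G} {σ} {n} {β} {∂} D)) j
    spans j = begin
      vec z (punchIn σ j)
        ≡⟨ coords-spec β z (punchIn σ j) ⟩
      linComb (coords β z) (vec ∘ elt β) (punchIn σ j)
        ≡⟨ linComb-init-last (coords β z) (vec ∘ elt β) (punchIn σ j) ⟩
      linComb (init (coords β z)) (vec ∘ elt (deleteBasis {G = G} {σ} {n} {β} {∂} D)) j + coords β z last * vec (elt β last) (punchIn σ j)
        ≡⟨ cong (λ a → linComb (init (coords β z)) (vec ∘ elt (deleteBasis {G = G} {σ} {n} {β} {∂} D)) j + a * vec (elt β last) (punchIn σ j))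
             (trans (coords-last z) zσ≡0) ⟩
      linComb (init (coords β z)) (vec ∘ elt (deleteBasis {G = G} {σ} {n} {β} {∂} D)) j + 0ℤ
        ≡⟨ ℤ.+-identityʳ _ ⟩
      linComb (init (coords β z)) (vec ∘ elt (deleteBasis {G = G} {σ} {n} {β} {∂} D)) j ∎

  coords-deleteColumns : ∀ j → coords (deleteBasis {G = G} {σ} {n} {β} {∂} D) ((deleteColumns {G = G} {σ} {n} {β} {∂} D) j) ≗ λ i → reduced D (inject₁ i) (inject₁ j)
  coords-deleteColumns j = coords-unique (deleteBasis {G = G} {σ} {n} {β} {∂} D) ((deleteColumns {G = G} {σ} {n} {β} {∂} D) j) (λ i → reduced D (inject₁ i) (inject₁ j))
    (vec-combine (λ i → reduced D (inject₁ i) (inject₁ j)) (elt (deleteBasis {G = G} {σ} {n} {β} {∂} D)))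

  winding-delete : ∀ z zd → vec z σ ≡ 0ℤ → vec zd ≗ removeAt (vec z) σ →
                   winding β ∂ z ≡ n * winding (deleteBasis {G = G} {σ} {n} {β} {∂} D) (deleteColumns {G = G} {σ} {n} {β} {∂} D) zd
  winding-delete z zd zσ≡0 eq = begin
    winding β ∂ z
      ≡⟨ winding-as-form β ∂ z ⟩
    detᶜ (windingColumns β ∂ z)
      ≡⟨ trans (columnOps-det (∷-isAlternating detᶜ-isAlternating (coords β z)) (operations D)) (ℤ.*-identityˡ _) ⟨
    detᶜ C
      -- The operations leave the column of `z` alone, and its last entry is the coefficient at σ,
      -- which is zero. With `last-row` the entire last row vanishes up to the corner.
      ≡⟨ det-last-row (suc k) C (λ { zero → trans (coords-last z) zσ≡0 ; (suc j) → last-row D j }) ⟩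
    reduced D last (fromℕ k) * detᶜ block
      ≡⟨ cong (_* detᶜ block) (corner D) ⟩
    n * detᶜ block
      ≡⟨ cong (n *_) (detᶜ-cong block (windingColumns (deleteBasis {G = G} {σ} {n} {β} {∂} D) (deleteColumns {G = G} {σ} {n} {β} {∂} D) zd)
           λ { zero i → trans (coords-delete 1ℤ z zd zσ≡0 (λ j → trans (sym (eq j)) (sym (ℤ.*-identityˡ (vec zd j)))) i)
                          (ℤ.*-identityˡ (coords (deleteBasis {G = G} {σ} {n} {β} {∂} D) zd i))
             ; (suc j) i → sym (coords-deleteColumns j i) }) ⟩
    n * detᶜ (windingColumns (deleteBasis {G = G} {σ} {n} {β} {∂} D) (deleteColumns {G = G} {σ} {n} {β} {∂} D) zd)
      ≡⟨ cong (n *_) (winding-as-form (deleteBasis {G = G} {σ} {n} {β} {∂} D) (deleteColumns {G = G} {σ} {n} {β} {∂} D) zd) ⟨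
    n * winding (deleteBasis {G = G} {σ} {n} {β} {∂} D) (deleteColumns {G = G} {σ} {n} {β} {∂} D) zd ∎
    where
    open ≡-Reasoning
    C : Columns (suc (suc k)) (suc (suc k))
    C = coords β z Vector.∷ columnsOf (reduced D)
    block : Columns (suc k) (suc k)
    block j i = C (inject₁ j) (inject₁ i)

  module _ (z : CycleVectors G) (zd : CycleVectors (delete G σ)) where

    lamWithout-σ : vec (lamWithout z β ∂ σ) σ ≡ 0ℤ
    lamWithout-σ = trans (vec-lamWithout z β ∂ σ σ)
      (total-cycletrees-zero G (without? σ) (summand z β ∂ σ) λ Y ct σ∉ → trans
        (cong (winding β ∂ (cycleOf z Y) *_) (supported (cycleOf-isGenerator z ct) σ σ∉))
        (ℤ.*-zeroʳ (winding β ∂ (cycleOf z Y))))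

    lamWithout-delete : ∀ i → coords β (lamWithout z β ∂ σ) (inject₁ i)
                            ≡ n * coords (deleteBasis {G = G} {σ} {n} {β} {∂} D) (lam zd (deleteBasis {G = G} {σ} {n} {β} {∂} D) (deleteColumns {G = G} {σ} {n} {β} {∂} D)) i
    lamWithout-delete = coords-delete n (lamWithout z β ∂ σ) (lam zd (deleteBasis {G = G} {σ} {n} {β} {∂} D) (deleteColumns {G = G} {σ} {n} {β} {∂} D)) lamWithout-σ
      λ j → trans (vec-lamWithout z β ∂ σ (punchIn σ j))
        (transfer-lam z β ∂ zd (deleteBasis {G = G} {σ} {n} {β} {∂} D) (deleteColumns {G = G} {σ} {n} {β} {∂} D) (without? σ) outside
          (σ∉insertEdge σ) (λ Y σ∉ → σ∉ (σ∈insertEdge σ Y)) deletion-transfer n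
          (λ Y y yd supp → winding-delete y yd (supp σ (σ∉insertEdge σ Y))) j)

    lamWithout-delete-last : coords β (lamWithout z β ∂ σ) (fromℕ (suc k)) ≡ 0ℤ
    lamWithout-delete-last = trans (coords-last (lamWithout z β ∂ σ)) lamWithout-σ

  -- This makes the passage to a fundamental basis explicit. The sign relating the winding numbers
  -- for `β₀` and β is the same for every cycletree, so it comes out of the sum.
  lamWithout-delete-basis : (z : CycleVectors G) (zd : CycleVectors (delete G σ)) (β₀ : Basis G (suc (suc k))) →
    ∃[ s ] (∀ c → winding β₀ ∂ c ≡ (s ◃ 1) * winding β ∂ c)
         × (∀ i → coords β (lamWithout z β₀ ∂ σ) (inject₁ i)
                ≡ (s ◃ 1) * (n * coords (deleteBasis {G = G} {σ} {n} {β} {∂} D) (lam zd (deleteBasis {G = G} {σ} {n} {β} {∂} D) (deleteColumns {G = G} {σ} {n} {β} {∂} D)) i))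
         × coords β (lamWithout z β₀ ∂ σ) (fromℕ (suc k)) ≡ 0ℤ
  lamWithout-delete-basis z zd β₀ = s , change
    , (λ i → trans (scaled (inject₁ i)) (cong ((s ◃ 1) *_) (lamWithout-delete z zd i)))
    , trans (scaled last) (trans (cong ((s ◃ 1) *_) (lamWithout-delete-last z zd)) (ℤ.*-zeroʳ (s ◃ 1)))
    where
    s : Sign
    s = proj₁ (winding-basis β₀ β ∂)
    change : ∀ c → winding β₀ ∂ c ≡ (s ◃ 1) * winding β ∂ c
    change = proj₂ (winding-basis β₀ β ∂)
    scaled : ∀ i → coords β (lamWithout z β₀ ∂ σ) i ≡ (s ◃ 1) * coords β (lamWithout z β ∂ σ) i
    scaled = coords-scale β (s ◃ 1) (lamWithout z β ∂ σ) (lamWithout z β₀ ∂ σ)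
      (lamWithout-scale z β₀ β ∂ (s ◃ 1) change σ)

-- Loops and edges with zero row

multiple-of-δ : (f : Vector ℤ n) (σ : Fin n) → (∀ i → σ ≢ i → f i ≡ 0ℤ) → ∀ i → f i ≡ f σ * δ σ i
multiple-of-δ f σ h i with σ ≟ i
... | yes refl = sym (ℤ.*-identityʳ (f σ))
... | no σ≢i   = trans (h i σ≢i) (sym (ℤ.*-zeroʳ (f σ)))

module _ {G : Graph v e} where

  -- A loop is a cycle by itself, hence the cycle of every cycletree that contains it.
  loop-generator : ∀ {σ Y} → IsLoop G σ → IsCycletree G Y → σ ∈ Y → IsGenerator G Y (cycleVec ((σ , Sign.+) ∷ []))
  loop-generator {σ} loop ct σ∈ = cycletree⇒generator ct ((σ , Sign.+) ∷ [])
    ((λ ()) , (src G σ , refl , sym loop) , ([] ∷ []) , ([] ∷ [])) λ { _ (here refl) → σ∈ }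

  lamWith-loop : (z : CycleVectors G) (β : Basis G (suc k)) (∂ : Vector (Z₁ G) k) → ∀ {σ} → IsLoop G σ →
    ∀ i → vec (lamWith z β ∂ σ) i ≡ vec (lamWith z β ∂ σ) σ * δ σ i
  lamWith-loop z β ∂ {σ} loop = multiple-of-δ (vec (lamWith z β ∂ σ)) σ λ i σ≢i → trans
    (vec-lamWith z β ∂ σ i)
    (total-cycletrees-zero G (σ ∈?_) (summand z β ∂ i) λ Y ct σ∈ →
      trans (cong (winding β ∂ (cycleOf z Y) *_) (off-loop σ≢i ct σ∈)) (ℤ.*-zeroʳ (winding β ∂ (cycleOf z Y))))
    where
    off-loop : ∀ {i} → σ ≢ i → ∀ {Y} → IsCycletree G Y → σ ∈ Y → vec (cycleOf z Y) i ≡ 0ℤ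
    off-loop {i} σ≢i ct σ∈ = trans (proj₂ agreement i) (trans
      (cong ((proj₁ agreement ◃ 1) *_) (cycleVec-∉ ((σ , Sign.+) ∷ []) λ { (here i≡σ) → σ≢i (sym i≡σ) }))
      (ℤ.*-zeroʳ (proj₁ agreement ◃ 1)))
      where
      agreement : ∃[ s ] ∀ i → vec (cycleOf z _) i ≡ (s ◃ 1) * cycleVec ((σ , Sign.+) ∷ []) i
      agreement = generators-agree (loop-generator loop ct σ∈) (cycleOf-isGenerator z ct)

  path⇒walk : ∀ {Y x y} → EqClosure (Joins G Y) x y → ∃[ as ] IsWalk G x as y × Within Y as
  path⇒walk ε = [] , refl , λ _ ()
  path⇒walk (fwd (i , i∈ , refl , refl) ◅ p) with path⇒walk p
  ... | as , walk , within = (i , Sign.+) ∷ as , (refl , walk) , λ { _ (here refl) → i∈ ; j (there j∈) → within j j∈ }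
  path⇒walk (bwd (i , i∈ , refl , refl) ◅ p) with path⇒walk p
  ... | as , walk , within = (i , Sign.-) ∷ as , (refl , walk) , λ { _ (here refl) → i∈ ; j (there j∈) → within j j∈ }

  -- Close σ up by a walk inside `Y` from its target back to its source. The walk may repeat
  -- vertices, but it avoids σ, so the coefficient at σ stays 1.
  cycle-through : ∀ {Y σ} → ConnectedBy G Y → σ ∉ Y → ∃[ x ] InKernel G x × x σ ≡ 1ℤ
  cycle-through {Y} {σ} conn σ∉ with path⇒walk (conn (tgt G σ) (src G σ))
  ... | as , walk , within = cycleVec ((σ , Sign.+) ∷ as) ,
    (λ u → trans (walk-boundary G ((σ , Sign.+) ∷ as) (refl , walk) u) (ℤ.+-inverseʳ (δ u (src G σ)))) ,
    cong₂ (λ a b → 1ℤ * a + b) (δ-refl σ) (cycleVec-supported as within σ σ∉)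

  -- If w(z) ≠ 0, then z and a cycle x with coefficient 1 at σ are independent
  -- modulo the columns of ∂, which contradicts the rank being one.
  winding-vanishes : ∀ {∂ : Matrix e k} (u : IsUnicyclizer G ∂) (β : Basis G (suc k)) {σ} → (∀ j → ∂ σ j ≡ 0ℤ) →
    ∀ x → vec x σ ≡ 1ℤ → ∀ z → vec z σ ≡ 0ℤ → winding β (columns u) z ≡ 0ℤ
  winding-vanishes {k = k} {∂} u β {σ} row≡0 x xσ≡1 z zσ≡0 =
    decidable-stable (winding β (columns u) z ℤ.≟ 0ℤ) λ w≢0 →
      -- Rank one bounds the size of an independent family by 1, so the pair would give 2 ≤ 1.
      ℕ.1+n≰n (proj₂ (rank-one u) (vec ∘ pair) (closed ∘ pair) (independent-pair w≢0))
    where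
    pair : Vector (Z₁ G) 2
    pair = x Vector.∷ z Vector.∷ Vector.[]
    module _ (w≢0 : winding β (columns u) z ≢ 0ℤ) (c : Vector ℤ 2) (image : InImage ∂ (linComb c (vec ∘ pair))) where
      d : Vector ℤ k
      d = proj₁ image
      -- Compare entries at σ: `x` has 1, `z` has 0, and the image of ∂ has 0 there.
      c₀≡0 : c zero ≡ 0ℤ
      c₀≡0 = begin
        c zero                                           ≡⟨ simplify (c zero) (c (suc zero)) ⟩
        c zero * 1ℤ + (c (suc zero) * 0ℤ + 0ℤ)           ≡⟨ cong₂ (λ a b → c zero * a + (c (suc zero) * b + 0ℤ)) xσ≡1 zσ≡0 ⟨
        linComb c (vec ∘ pair) σ                         ≡⟨ proj₂ image σ ⟩
        linComb d (column ∂) σ                           ≡⟨ sum-zero _ (λ j → trans (cong (d j *_) (row≡0 j)) (ℤ.*-zeroʳ (d j))) ⟩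
        0ℤ                                               ∎
        where
        open ≡-Reasoning
        simplify : ∀ a b → a ≡ a * 1ℤ + (b * 0ℤ + 0ℤ)
        simplify = solve-∀
      y : Z₁ G
      y = combine c pair
      -- The winding number of `y` is computed twice: from the pair, where only the `z` term
      -- survives, and from the columns of ∂, on which it vanishes.
      c₁w≡0 : c (suc zero) * winding β (columns u) z ≡ 0ℤ
      c₁w≡0 = begin
        c (suc zero) * w z                               ≡⟨ simplify (c (suc zero) * w z) (w x) ⟩
        0ℤ * w x + (c (suc zero) * w z + 0ℤ)             ≡⟨ cong (λ a → a * w x + (c (suc zero) * w z + 0ℤ)) c₀≡0 ⟨
        sum (λ j → c j * w (pair j))                     ≡⟨ winding-linComb β (columns u) y c pair (vec-combine c pair) ⟨
        w y                                              ≡⟨ winding-linComb β (columns u) y d (columns u) (λ i → trans (vec-combine c pair i) (proj₂ image i)) ⟩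
        sum (λ j → d j * w (columns u j))                ≡⟨ sum-zero _ (λ j → trans (cong (d j *_) (winding-column β (columns u) j)) (ℤ.*-zeroʳ (d j))) ⟩
        0ℤ                                               ∎
        where
        open ≡-Reasoning
        w : Z₁ G → ℤ
        w = winding β (columns u)
        simplify : ∀ a b → a ≡ 0ℤ * b + (a + 0ℤ)
        simplify = solve-∀
      c₁≡0 : c (suc zero) ≡ 0ℤ
      c₁≡0 = [ (λ c₁≡0 → c₁≡0) , (λ w≡0 → contradiction w≡0 w≢0) ]′ (ℤ.i*j≡0⇒i≡0∨j≡0 (c (suc zero)) c₁w≡0)
      independent-pair : ∀ j → c j ≡ 0ℤ
      independent-pair zero       = c₀≡0
      independent-pair (suc zero) = c₁≡0

  lamWithout-vanishes : ∀ (z : CycleVectors G) {∂ : Matrix e k} (u : IsUnicyclizer G ∂) (β : Basis G (suc k)) {σ} →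
    (∀ j → ∂ σ j ≡ 0ℤ) → ∀ i → vec (lamWithout z β (columns u) σ) i ≡ 0ℤ
  lamWithout-vanishes z u β {σ} row≡0 i = trans
    (vec-lamWithout z β (columns u) σ i)
    (total-cycletrees-zero G (without? σ) (summand z β (columns u) i) λ Y ct σ∉ → cong (_* vec (cycleOf z Y) i) (vanish Y ct σ∉))
    where
    vanish : ∀ Y → IsCycletree G Y → σ ∉ Y → winding β (columns u) (cycleOf z Y) ≡ 0ℤ
    vanish Y ct σ∉ = winding-vanishes u β row≡0 (proj₁ x , proj₁ (proj₂ x)) (proj₂ (proj₂ x)) (cycleOf z Y)
      (supported (cycleOf-isGenerator z ct) σ σ∉)
      where
      x : ∃[ x ] InKernel G x × x σ ≡ 1ℤ
      x = cycle-through (proj₁ ct) σ∉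

-- Item 4 is stated for `suc k` columns, since a nonzero row has at least one entry. The basis β_d
-- has one element less than β, so equality of coordinates there means agreement on the initial ones
-- and zero at the last, the coordinate of the fundamental cycle of σ. Its second clause starts from
-- an arbitrary β and a fundamental β′.
proposition4p5p1 : ∀ {v e : ℕ} (G : Graph (suc v) (suc e)) → Connected G →
    (σ : Fin (suc e)) (z : CycleVectors G) →
    ( ∀ {k : ℕ} (∂ : Matrix (suc e) k) (u : IsUnicyclizer G ∂) (β : Basis G (suc k)) →
    ( IsLoop G σ →
    ∃[ a ] (∀ i → vec (lamWith z β (columns u) σ) i ≡ a * δ σ i) )
    × ( (¬loop : ¬ IsLoop G σ) (zc : CycleVectors (contract G σ ¬loop)) →
    ∀ i → coords β (lamWith z β (columns u) σ) i
    ≡ coords (contractBasis G σ ¬loop β)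
    (lam zc (contractBasis G σ ¬loop β) (contractColumns G σ ¬loop β (columns u))) i )
    × ( (∀ j → ∂ σ j ≡ 0ℤ) →
    ∀ i → vec (lamWithout z β (columns u) σ) i ≡ 0ℤ ) )
    ×
    ( ∀ {k : ℕ} (∂ : Matrix (suc e) (suc k)) (u : IsUnicyclizer G ∂) (β : Basis G (suc (suc k))) →
    ¬ (∀ j → ∂ σ j ≡ 0ℤ) →
    (zd : CycleVectors (delete G σ)) →
    ( (D : Deletion G σ (windingDifference ∂ σ) β (columns u)) →
    (∀ i → coords β (lamWithout z β (columns u) σ) (inject₁ i)
    ≡ windingDifference ∂ σ
    * coords (deleteBasis D) (lam zd (deleteBasis D) (deleteColumns D)) i)
    × coords β (lamWithout z β (columns u) σ) (fromℕ (suc k)) ≡ 0ℤ )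
    × ( (β′ : Basis G (suc (suc k))) (D : Deletion G σ (windingDifference ∂ σ) β′ (columns u)) →
    ∃[ s ] (∀ c → winding β (columns u) c ≡ (s ◃ 1) * winding β′ (columns u) c)
    × (∀ i → coords β′ (lamWithout z β (columns u) σ) (inject₁ i)
    ≡ (s ◃ 1) * (windingDifference ∂ σ
    * coords (deleteBasis D) (lam zd (deleteBasis D) (deleteColumns D)) i))
    × coords β′ (lamWithout z β (columns u) σ) (fromℕ (suc k)) ≡ 0ℤ ) )
proposition4p5p1 G _ σ z =
  (λ ∂ u β →
      (λ loop → vec (lamWith z β (columns u) σ) σ , lamWith-loop z β (columns u) loop)
    , (λ ¬loop zc → Contraction.lamWith-contract G σ ¬loop z zc β (columns u))
    , lamWithout-vanishes z u β)
  , λ ∂ u β _ zd →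
      (λ D → DeletionProperties.lamWithout-delete D z zd , DeletionProperties.lamWithout-delete-last D z zd)
    , λ β′ D → DeletionProperties.lamWithout-delete-basis D z zd β
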